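{- There exists $C>0$ such that for all $k\in\mathbb{N}$ with $k\ge 2$, every strongly $Ck^{2}\log^{2}k$-connected tournament contains $k$ edge-disjoint Hamilton cycles.
   Context: A tournament is an orientation of a complete graph; a Hamilton cycle is a consistently oriented cycle through all vertices. A digraph $D$ is strongly $k$-connected if $|D|>k$ and for every $S\subseteq V(D)$ with $|S|\le k-1$, $D-S$ is strongly connected (every vertex has a directed path to every other vertex). $\log$ denotes the binary logarithm and $\log^2 k=(\log k)^2$. -}

module Defs where

open import Data.Nat using (ℕ; zero; suc; _+_; _*_; _≤_; _<_)
open import Data.Bool using (Bool; true; false)
open import Data.Fin using (Fin)
open import Data.Fin.Subset using (Subset; _∈_; _∉_; ∣_∣)
open import Data.Product using (_×_; ∃)
open import Data.Sum using (_⊎_)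
open import Relation.Binary.PropositionalEquality using (_≡_; _≢_)
open import Relation.Nullary using (¬_)

Digraph : ℕ → Set
Digraph n = Fin n → Fin n → Bool

IsTournament : ∀ {n} → Digraph n → Set
IsTournament {n} T =
  (∀ (u : Fin n) → T u u ≡ false) ×
  (∀ (u v : Fin n) → u ≢ v →
     (T u v ≡ true × T v u ≡ false) ⊎ (T u v ≡ false × T v u ≡ true))

data PathAvoiding {n} (D : Digraph n) (S : Subset n) : Fin n → Fin n → Set where
  here : ∀ {u} → u ∉ S → PathAvoiding D S u u
  step : ∀ {u w v} → u ∉ S → D u w ≡ true → PathAvoiding D S w v → PathAvoiding D S u v

StronglyConnectedAvoiding : ∀ {n} → Digraph n → Subset n → Set
StronglyConnectedAvoiding {n} D S =
  ∀ (u v : Fin n) → u ∉ S → v ∉ S → PathAvoiding D S u v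

StronglyConnected : ∀ {n} → ℕ → Digraph n → Set
StronglyConnected {n} k D =
  k < n × (∀ (S : Subset n) → suc ∣ S ∣ ≤ k → StronglyConnectedAvoiding D S)

iterate : ∀ {A : Set} → (A → A) → ℕ → A → A
iterate f zero x = x
iterate f (suc m) x = f (iterate f m x)

-- A Hamilton cycle, encoded by its successor map s: every arc v → s v is an
-- arc of D, and the orbit of every vertex under s is all of V(D)
-- (so s is a single cyclic permutation through all vertices).
IsHamiltonCycle : ∀ {n} → Digraph n → (Fin n → Fin n) → Set
IsHamiltonCycle {n} D s =
  (∀ (v : Fin n) → D v (s v) ≡ true) ×
  (∀ (v w : Fin n) → ∃ λ m → iterate s m v ≡ w)

-- k pairwise edge-disjoint Hamilton cycles: the arc of cycle i leaving v
-- differs from the arc of cycle j leaving v, for i ≠ j.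
EdgeDisjointHamiltonCycles : ∀ {n} → Digraph n → (k : ℕ) → (Fin k → Fin n → Fin n) → Set
EdgeDisjointHamiltonCycles {n} D k H =
  (∀ (i : Fin k) → IsHamiltonCycle D (H i)) ×
  (∀ (i j : Fin k) → i ≢ j → ∀ (v : Fin n) → H i v ≢ H j v)

{-# OPTIONS --safe #-}

{-
The argument follows Kühn, Lapinskas, Osthus and Patel.  Halving a neighbourhood c times yields a path
on at most c + 1 vertices that receives an arc from every vertex outside a set of size 2^-c times the
minimum degree, and dually one that sends an arc to almost every vertex.  For each of the k cycles we
reserve a track: a path containing many gaps (an almost out-dominating path, a bridge of one or two
vertices, an almost in-dominating path) and, for every vertex v of a gap, an arc x → y with x → v → y.
The tracks are disjoint; their pieces are linked through further dominating paths, which Menger's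
theorem joins in some order, the order being irrelevant since every link can use any of them.

The cycles are chosen one by one, avoiding the arcs of earlier cycles and those reserved for later ones,
so that every vertex misses only O(k) arcs.  Then O(k) paths suffice to cover the vertices off the track.
If a path ends in a vertex without the required dominated neighbours, a neighbour of that vertex is cut
out of its path and attached; doing this first for the few reserved vertices, whose degree may be small,
and then for the exceptional sets makes all ends good at the cost of a constant factor in the number of
paths.  A path with good ends fits into any unspoilt gap, so that all paths merge into one cycle, and the
gap vertices skipped on the way are inserted into their arcs x → y.
-}
module Submission where

open import Defs
open import Data.Bool using (true)
import Data.Bool.Properties as Boolₚ
open import Data.Empty using (⊥; ⊥-elim)
open import Data.Fin using (Fin)
import Data.Fin as Fin
import Data.Fin.Properties as Finₚ
open import Data.Fin.Subset as Sub using (Subset; inside; outside; ∣_∣)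
import Data.Fin.Subset.Properties as Subₚ
open import Data.List using (List; []; _∷_; _++_; [_]; length; map; concat; concatMap; filter; reverse; allFin; lookup; deduplicate; cartesianProduct)
open import Data.List.Membership.Propositional using (_∈_; _∉_; find; lose)
open import Data.List.Membership.Propositional.Properties
  using (∈-++⁺ˡ; ∈-++⁺ʳ; ∈-++⁻; ∈-∃++; ∈-map⁺; ∈-map⁻; ∈-filter⁺; ∈-filter⁻; ∈-allFin; ∈-lookup;
         ∈-deduplicate⁺; ∈-deduplicate⁻; ∈-cartesianProduct⁺)
import Data.List.Properties as Lₚ
open import Data.List.Relation.Binary.Disjoint.Propositional using (Disjoint)
open import Data.List.Relation.Binary.Permutation.Propositional as Perm
  using (_↭_; ↭-refl; ↭-sym; ↭-trans; ↭-reflexive; prep; swap)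
import Data.List.Relation.Binary.Permutation.Propositional.Properties as Permₚ
import Data.List.Relation.Binary.Permutation.Setoid.Properties as PermSₚ
open import Data.List.Relation.Binary.Subset.Propositional using (_⊆_)
open import Data.List.Relation.Unary.All as All using (All; []; _∷_)
import Data.List.Relation.Unary.All.Properties as Allₚ
open import Data.List.Relation.Unary.AllPairs as AP using (AllPairs; []; _∷_)
import Data.List.Relation.Unary.AllPairs.Properties as APₚ
open import Data.List.Relation.Unary.Any using (here; there; any?)
import Data.List.Relation.Unary.Unique.DecPropositional.Properties as UDₚ
open import Data.List.Relation.Unary.Unique.Propositional using (Unique)
import Data.List.Relation.Unary.Unique.Propositional.Properties as Uₚ
open import Data.Nat
  using (ℕ; zero; suc; _+_; _*_; _^_; _∸_; _≤_; _<_; z≤n; s≤s; _≤?_; _<?_; ⌈_/2⌉; >-nonZero; nonZero)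
open import Data.Nat.Induction using (<-rec)
open import Data.Nat.ListAction using (sum)
open import Data.Nat.Logarithm using (⌈log₂_⌉; ⌈log₂⌉-mono-≤; ⌈log₂⌈n/2⌉⌉≡⌈log₂n⌉∸1)
open import Data.Nat.Properties as ℕₚ using (≤-refl; ≤-trans; ≤-reflexive; module ≤-Reasoning)
open import Data.Nat.Solver using (module +-*-Solver)
open import Data.Product using (_×_; _,_; ∃; ∃₂; Σ; proj₁; proj₂)
open import Data.Sum using (_⊎_; inj₁; inj₂; [_,_]′)
open import Data.Unit using (⊤; tt)
import Data.Vec as Vec
import Data.Vec.Properties as Vecₚ
open import Function using (_∘_; id)
open import Relation.Binary.PropositionalEquality hiding ([_])
open import Relation.Nullary using (¬_; Dec; yes; no; contradiction)
open import Relation.Nullary.Decidable using (¬?; _×-dec_)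
open import Relation.Unary using (Decidable)
import Algebra.Solver.CommutativeMonoid as CMSolver
import Algebra.Solver.Monoid as MSolver

-- What makes the exceptional sets harmless is the choice of the first vertices of the dominating
-- paths: they are the vertices of least out-degree and of least in-degree. What such a path fails
-- to dominate is thus a tiny fraction of a number that is a lower bound for the degrees of all
-- other vertices, so an ordinary vertex always has neighbours outside every exceptional set. The
-- chosen extreme vertices themselves have only the degree guaranteed by connectivity; hence the
-- vertices reserved beforehand must be few compared with the connectivity K, and every reserved
-- segment is lengthened by two vertices at either end before it is linked. Origin of the bound:
-- O(k) forbidden arcs at each vertex call for O(k) gaps per track. Domination up to a fraction
-- polynomially small in k needs c = O(log k), so a track has O(k log k) gap vertices. Each of them
-- has its own reserved arc, each such arc has to be linked into the track, and each link takes two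
-- dominating paths of O(log k) vertices. Over k tracks this makes O(k^2 log^2 k) reserved vertices,
-- and K has to be a constant multiple of that.

module ↭-Solver {A : Set} = CMSolver (Permₚ.++-commutativeMonoid {A = A}) using (solve; _⊜_; _⊕_)

module ++-Solver {A : Set} = MSolver (Lₚ.++-monoid A) using (solve; _⊜_; _⊕_)

-- Lists: permutations, duplicate-free lists and contiguous sublists

module _ {A : Set} where

  Unique-resp-↭ : ∀ {xs ys : List A} → xs ↭ ys → Unique xs → Unique ys
  Unique-resp-↭ p = PermSₚ.Unique-resp-↭ (setoid A) (Perm.↭⇒↭ₛ p)

  ↭-∈ : ∀ {xs ys : List A} {v} → xs ↭ ys → v ∈ xs → v ∈ ys
  ↭-∈ = Permₚ.∈-resp-↭

  unique-++ˡ : ∀ (xs : List A) {ys} → Unique (xs ++ ys) → Unique xs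
  unique-++ˡ [] _ = []
  unique-++ˡ (x ∷ xs) (p ∷ u) = Allₚ.++⁻ˡ xs p ∷ unique-++ˡ xs u

  unique-++ʳ : ∀ (xs : List A) {ys} → Unique (xs ++ ys) → Unique ys
  unique-++ʳ [] u = u
  unique-++ʳ (x ∷ xs) (p ∷ u) = unique-++ʳ xs u

  unique-++-disjoint : ∀ (xs : List A) {ys} → Unique (xs ++ ys) → Disjoint xs ys
  unique-++-disjoint (x ∷ xs) (p ∷ u) (here refl , q) = All.lookup (Allₚ.++⁻ʳ xs p) q refl
  unique-++-disjoint (x ∷ xs) (p ∷ u) (there i , q) = unique-++-disjoint xs u (i , q)

  unique-head : ∀ {x} {xs : List A} → Unique (x ∷ xs) → x ∉ xs
  unique-head (p ∷ _) i = All.lookup p i refl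

  unique-tail : ∀ {x} {xs : List A} → Unique (x ∷ xs) → Unique xs
  unique-tail (_ ∷ u) = u

  unique-∷ : ∀ {x} {xs : List A} → x ∉ xs → Unique xs → Unique (x ∷ xs)
  unique-∷ n u = Allₚ.¬Any⇒All¬ _ n ∷ u

  lookup-injective : ∀ {xs : List A} → Unique xs → ∀ i j → lookup xs i ≡ lookup xs j → i ≡ j
  lookup-injective (p ∷ u) Fin.zero Fin.zero e = refl
  lookup-injective (p ∷ u) Fin.zero (Fin.suc j) e = contradiction e (All.lookup p (∈-lookup j))
  lookup-injective (p ∷ u) (Fin.suc i) Fin.zero e = contradiction (sym e) (All.lookup p (∈-lookup i))
  lookup-injective (p ∷ u) (Fin.suc i) (Fin.suc j) e = cong Fin.suc (lookup-injective u i j e)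

  ∈-remove : ∀ {v w : A} (xs : List A) {ys} → v ∈ xs ++ w ∷ ys → v ≢ w → v ∈ xs ++ ys
  ∈-remove [] (here e) ne = contradiction e ne
  ∈-remove [] (there i) ne = i
  ∈-remove (x ∷ xs) (here e) ne = here e
  ∈-remove (x ∷ xs) (there i) ne = there (∈-remove xs i ne)

  length-remove : ∀ (xs : List A) {w ys} → length (xs ++ w ∷ ys) ≡ suc (length (xs ++ ys))
  length-remove [] = refl
  length-remove (x ∷ xs) = cong suc (length-remove xs)

  unique-⊆⇒length≤ : ∀ {xs ys : List A} → Unique xs → xs ⊆ ys → length xs ≤ length ys
  unique-⊆⇒length≤ [] s = z≤n
  unique-⊆⇒length≤ {x ∷ xs} (p ∷ u) s with ∈-∃++ (s (here refl))
  ... | ys₁ , ys₂ , refl = ≤-trans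
    (s≤s (unique-⊆⇒length≤ u (λ {v} i → ∈-remove ys₁ (s (there i)) (λ e → All.lookup p i (sym e)))))
    (≤-reflexive (sym (length-remove ys₁)))

  ∈-concatMap⁺′ : ∀ {B : Set} (f : B → List A) {bs b v} → b ∈ bs → v ∈ f b → v ∈ concatMap f bs
  ∈-concatMap⁺′ f (here refl) i = ∈-++⁺ˡ i
  ∈-concatMap⁺′ f {b ∷ bs} (there j) i = ∈-++⁺ʳ (f b) (∈-concatMap⁺′ f j i)

  ∈-concatMap⁻′ : ∀ {B : Set} (f : B → List A) bs {v} → v ∈ concatMap f bs → ∃ λ b → b ∈ bs × v ∈ f b
  ∈-concatMap⁻′ f (b ∷ bs) i with ∈-++⁻ (f b) i
  ... | inj₁ j = b , here refl , j
  ... | inj₂ j with ∈-concatMap⁻′ f bs j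
  ...   | b′ , p , q = b′ , there p , q

  concatMap-↭ : ∀ {B : Set} (f : B → List A) {bs cs} → bs ↭ cs → concatMap f bs ↭ concatMap f cs
  concatMap-↭ f _↭_.refl = ↭-refl
  concatMap-↭ f (prep x p) = Permₚ.++⁺ˡ (f x) (concatMap-↭ f p)
  concatMap-↭ f (swap x y p) =
    ↭-trans (Permₚ.++⁺ˡ (f x) (Permₚ.++⁺ˡ (f y) (concatMap-↭ f p))) (Permₚ.shifts (f x) (f y))
  concatMap-↭ f (_↭_.trans p q) = ↭-trans (concatMap-↭ f p) (concatMap-↭ f q)

  ∈-↭∷ : ∀ {x : A} {xs} → x ∈ xs → ∃ λ ys → xs ↭ x ∷ ys
  ∈-↭∷ i with ∈-∃++ i
  ... | l , r , refl = l ++ r , Permₚ.shift _ l r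

  concatMap-++ : ∀ {B : Set} (f : B → List A) bs cs → concatMap f (bs ++ cs) ≡ concatMap f bs ++ concatMap f cs
  concatMap-++ f bs cs = Lₚ.concatMap-++ f bs cs

  Infix : List A → List A → Set
  Infix P l = ∃₂ λ a b → l ≡ a ++ P ++ b

  infix-refl : ∀ {P} → Infix P P
  infix-refl {P} = [] , [] , sym (Lₚ.++-identityʳ P)

  infix-++ˡ : ∀ {P l} r → Infix P l → Infix P (r ++ l)
  infix-++ˡ {P} r (a , b , refl) = r ++ a , b , sym (Lₚ.++-assoc r a (P ++ b))

  infix-++ʳ : ∀ {P l} r → Infix P l → Infix P (l ++ r)
  infix-++ʳ {P} r (a , b , refl) = a , b ++ r ,
    trans (Lₚ.++-assoc a (P ++ b) r) (cong (a ++_) (Lₚ.++-assoc P b r))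

  infix-trans : ∀ {P Q l} → Infix P Q → Infix Q l → Infix P l
  infix-trans i (a , b , refl) = infix-++ˡ a (infix-++ʳ b i)

  infix-∈ : ∀ {P l v} → Infix P l → v ∈ P → v ∈ l
  infix-∈ (a , b , refl) i = ∈-++⁺ʳ a (∈-++⁺ˡ i)

  infix-split : ∀ {P : List A} {y} l₁ {l₂} → Infix P (l₁ ++ y ∷ l₂) → y ∉ P → Infix P l₁ ⊎ Infix P l₂
  infix-split {[]} l₁ i n = inj₁ ([] , l₁ , refl)
  infix-split {p ∷ P} [] ([] , b , e) n = contradiction (here (Lₚ.∷-injectiveˡ e)) n
  infix-split {p ∷ P} [] (x ∷ a , b , refl) n = inj₂ (a , b , refl)
  infix-split {p ∷ P} (x ∷ l₁) ([] , b , e) n = inj₁ ([] , go P l₁ (Lₚ.∷-injectiveʳ e) (n ∘ there)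
    , cong₂ _∷_ (Lₚ.∷-injectiveˡ e) (eq P l₁ (Lₚ.∷-injectiveʳ e) (n ∘ there)))
    where
    go : ∀ P l₁ {y l₂ b} → l₁ ++ y ∷ l₂ ≡ P ++ b → y ∉ P → List A
    go [] l₁ e n = l₁
    go (p ∷ P) [] e n = ⊥-elim (n (here (Lₚ.∷-injectiveˡ e)))
    go (p ∷ P) (x ∷ l₁) e n = go P l₁ (Lₚ.∷-injectiveʳ e) (n ∘ there)
    eq : ∀ P l₁ {y l₂ b} (e : l₁ ++ y ∷ l₂ ≡ P ++ b) (n : y ∉ P) → l₁ ≡ P ++ go P l₁ e n
    eq [] l₁ e n = refl
    eq (p ∷ P) [] e n = ⊥-elim (n (here (Lₚ.∷-injectiveˡ e)))
    eq (p ∷ P) (x ∷ l₁) e n = cong₂ _∷_ (Lₚ.∷-injectiveˡ e) (eq P l₁ (Lₚ.∷-injectiveʳ e) (n ∘ there))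
  infix-split {p ∷ P} (x ∷ l₁) (x′ ∷ a , b , e) n with infix-split l₁ (a , b , Lₚ.∷-injectiveʳ e) n
  ... | inj₁ i = inj₁ (infix-++ˡ [ x ] i)
  ... | inj₂ i = inj₂ i

  infix-dropˡ : ∀ {P : List A} G {l} → Infix P (G ++ l) → Disjoint G P → P ≢ [] → Infix P l
  infix-dropˡ [] i d ne = i
  infix-dropˡ (g ∷ G) i d ne with infix-split [] i (λ j → d (here refl , j))
  ... | inj₁ ([] , [] , e) = contradiction (sym (trans e (Lₚ.++-identityʳ _))) ne
  ... | inj₁ ([] , b ∷ bs , e) with Lₚ.++-conicalˡ _ _ (sym e)
  ...   | e′ = contradiction e′ ne
  infix-dropˡ (g ∷ G) i d ne | inj₂ j = infix-dropˡ G j (λ (p , q) → d (there p , q)) ne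

  -- A contiguous piece that avoids the block `G` cannot straddle it. This is why opening a gap, or
  -- putting a vertex into an arc, destroys nothing that is reserved elsewhere on the path.
  infix-splitG : ∀ {P : List A} l₁ G {l₂} → Infix P (l₁ ++ G ++ l₂) → Disjoint G P → P ≢ [] → G ≢ [] →
    Infix P l₁ ⊎ Infix P l₂
  infix-splitG l₁ [] i d ne ne′ = contradiction refl ne′
  infix-splitG l₁ (g ∷ G) i d ne _ with infix-split l₁ i (λ j → d (here refl , j))
  ... | inj₁ j = inj₁ j
  ... | inj₂ j = inj₂ (infix-dropˡ G j (λ (p , q) → d (there p , q)) ne)

  pairs : List A → List (A × A)
  pairs [] = []
  pairs (a ∷ []) = []
  pairs (a ∷ b ∷ l) = (a , b) ∷ pairs (b ∷ l)

  pairs-infix : ∀ {a b} l → (a , b) ∈ pairs l → Infix (a ∷ b ∷ []) l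
  pairs-infix (a ∷ b ∷ l) (here refl) = [] , l , refl
  pairs-infix (a ∷ b ∷ l) (there i) = infix-++ˡ [ a ] (pairs-infix (b ∷ l) i)

  infix-pairs : ∀ {a b} l → Infix (a ∷ b ∷ []) l → (a , b) ∈ pairs l
  infix-pairs l ([] , b , refl) = here refl
  infix-pairs l (x ∷ [] , b , refl) = there (here refl)
  infix-pairs l (x ∷ y ∷ a , b , refl) = there (infix-pairs (y ∷ a ++ _) (y ∷ a , b , refl))

  unique-map-filter : ∀ {B : Set} {P : B → Set} (f : B → A) (P? : Decidable P) {bs} →
    Unique (map f bs) → Unique (map f (filter P? bs))
  unique-map-filter f P? {[]} u = []
  unique-map-filter f P? {b ∷ bs} u with P? b
  ... | no _ = unique-map-filter f P? {bs} (unique-tail u)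
  ... | yes _ = unique-∷ notin (unique-map-filter f P? {bs} (unique-tail u))
    where
    notin : f b ∉ map f (filter P? bs)
    notin i with ∈-map⁻ f i
    ... | c , j , e = unique-head u (subst (_∈ map f bs) (sym e) (∈-map⁺ f (proj₁ (∈-filter⁻ P? j))))

  pairs-fst : ∀ {a b} l → (a , b) ∈ pairs l → a ∈ l
  pairs-fst l i = infix-∈ (pairs-infix l i) (here refl)

  pairs-snd : ∀ {a b} x l → (a , b) ∈ pairs (x ∷ l) → b ∈ l
  pairs-snd x (y ∷ l) (here refl) = here refl
  pairs-snd x (y ∷ l) (there i) = there (pairs-snd y l i)

  unique-pairs₁ : ∀ l → Unique l → Unique (map proj₁ (pairs l))
  unique-pairs₁ [] u = []
  unique-pairs₁ (a ∷ []) u = []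
  unique-pairs₁ (a ∷ b ∷ l) u = unique-∷ notin (unique-pairs₁ (b ∷ l) (unique-tail u))
    where
    notin : a ∉ map proj₁ (pairs (b ∷ l))
    notin i with ∈-map⁻ proj₁ i
    ... | p , j , refl = unique-head u (pairs-fst (b ∷ l) j)

  unique-pairs₂ : ∀ l → Unique l → Unique (map proj₂ (pairs l))
  unique-pairs₂ [] u = []
  unique-pairs₂ (a ∷ []) u = []
  unique-pairs₂ (a ∷ b ∷ l) u = unique-∷ notin (unique-pairs₂ (b ∷ l) (unique-tail u))
    where
    notin : b ∉ map proj₂ (pairs (b ∷ l))
    notin i with ∈-map⁻ proj₂ i
    ... | p , j , refl = unique-head (unique-tail u) (pairs-snd b l j)

module Eq {A : Set} (_≟_ : (x y : A) → Dec (x ≡ y)) where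

  open import Data.List.Membership.DecPropositional _≟_ using (_∈?_) public

  abstract
    escape : ∀ {xs : List A} l → Unique xs → length l < length xs → ∃ λ y → y ∈ xs × y ∉ l
    escape {xs} l u lt with All.all? (_∈? l) xs
    ... | yes a = contradiction (unique-⊆⇒length≤ u (All.lookup a)) (ℕₚ.<⇒≱ lt)
    ... | no ¬a with seek xs ¬a
      where
      seek : ∀ xs → ¬ All (_∈ l) xs → ∃ λ y → y ∈ xs × y ∉ l
      seek [] n = ⊥-elim (n [])
      seek (x ∷ xs) n with x ∈? l
      ... | no q = x , here refl , q
      ... | yes q with seek xs (λ a → n (q ∷ a))
      ...   | y , i , j = y , there i , j
    ...   | r = r

  unique-⊇ : ∀ {xs ys : List A} → Unique xs → xs ⊆ ys → length ys ≤ length xs → ys ⊆ xs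
  unique-⊇ {xs} {ys} u s le {y} i with y ∈? xs
  ... | yes p = p
  ... | no p = contradiction (≤-trans (unique-⊆⇒length≤ (unique-∷ p u) (λ { (here refl) → i ; (there j) → s j })) le)
                 (ℕₚ.<-irrefl refl)

  disjoint? : ∀ (xs ys : List A) → Disjoint xs ys ⊎ (∃ λ v → v ∈ xs × v ∈ ys)
  disjoint? [] ys = inj₁ λ { (() , _) }
  disjoint? (x ∷ xs) ys with x ∈? ys
  ... | yes p = inj₂ (x , here refl , p)
  ... | no p with disjoint? xs ys
  ...   | inj₁ d = inj₁ λ { (here refl , j) → p j ; (there i , j) → d (i , j) }
  ...   | inj₂ (v , i , j) = inj₂ (v , there i , j)

  abstract
    -- Blocks without common vertices: each entry of `F` spoils at most one of them. All unspoilt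
    -- gaps, and all paths into which a vertex can be inserted, are found by this pigeonhole
    -- argument.
    disjoint-block : ∀ {B : Set} (f : B → List A) bs F → Unique (concatMap f bs) → length F < length bs →
      ∃ λ b → b ∈ bs × Disjoint (f b) F
    disjoint-block f (b ∷ bs) F u lt with disjoint? (f b) F
    ... | inj₁ d = b , here refl , d
    ... | inj₂ (w , i , j) with ∈-∃++ j
    ...   | F₁ , F₂ , refl with disjoint-block f bs (F₁ ++ F₂) (unique-++ʳ (f b) u)
                               (ℕₚ.≤-pred (≤-trans (s≤s (≤-reflexive (sym (length-remove F₁)))) lt))
    ...     | b′ , p , d = b′ , there p , λ (a , c) →
              d (a , ∈-remove F₁ c (λ { refl → unique-++-disjoint (f b) u (i , ∈-concatMap⁺′ f p a) }))

  -- Together with `precede` this lists the vertices next to `L` on `l`. A vertex in neither list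
  -- can be cut out of a path without exposing an end in `L`.
  follow : List A → List A → List A
  follow L l = map proj₂ (filter (λ p → proj₁ p ∈? L) (pairs l))

  precede : List A → List A → List A
  precede L l = map proj₁ (filter (λ p → proj₂ p ∈? L) (pairs l))

  ∈-follow : ∀ {L a b} l → Infix (a ∷ b ∷ []) l → a ∈ L → b ∈ follow L l
  ∈-follow l i m = ∈-map⁺ proj₂ (∈-filter⁺ (λ p → proj₁ p ∈? _) (infix-pairs l i) m)

  ∈-precede : ∀ {L a b} l → Infix (a ∷ b ∷ []) l → b ∈ L → a ∈ precede L l
  ∈-precede l i m = ∈-map⁺ proj₁ (∈-filter⁺ (λ p → proj₂ p ∈? _) (infix-pairs l i) m)

  length-follow : ∀ L {l} → Unique l → length (follow L l) ≤ length L
  length-follow L {l} u = ≤-trans (≤-reflexive (trans (Lₚ.length-map proj₂ ps) (sym (Lₚ.length-map proj₁ ps))))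
    (unique-⊆⇒length≤ (unique-map-filter proj₁ _ (unique-pairs₁ l u)) sub)
    where
    ps = filter (λ p → proj₁ p ∈? L) (pairs l)
    sub : map proj₁ ps ⊆ L
    sub i with ∈-map⁻ proj₁ i
    ... | p , j , refl = proj₂ (∈-filter⁻ (λ p → proj₁ p ∈? L) {xs = pairs l} j)

  length-precede : ∀ L {l} → Unique l → length (precede L l) ≤ length L
  length-precede L {l} u = ≤-trans (≤-reflexive (trans (Lₚ.length-map proj₁ ps) (sym (Lₚ.length-map proj₂ ps))))
    (unique-⊆⇒length≤ (unique-map-filter proj₂ _ (unique-pairs₂ l u)) sub)
    where
    ps = filter (λ p → proj₂ p ∈? L) (pairs l)
    sub : map proj₂ ps ⊆ L
    sub i with ∈-map⁻ proj₂ i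
    ... | p , j , refl = proj₂ (∈-filter⁻ (λ p → proj₂ p ∈? L) {xs = pairs l} j)

-- Paths in digraphs

infixr 5 _◅_

data Path {V : Set} (R : V → V → Set) : V → V → List V → Set where
  point : ∀ u → Path R u u (u ∷ [])
  _◅_ : ∀ {u w v l} → R u w → Path R w v l → Path R u v (u ∷ l)

module _ {V : Set} {R : V → V → Set} where

  path-map : ∀ {S : V → V → Set} {u v l} → (∀ {a b} → R a b → S a b) → Path R u v l → Path S u v l
  path-map f (point u) = point u
  path-map f (e ◅ p) = f e ◅ path-map f p

  start-∈ : ∀ {u v l} → Path R u v l → u ∈ l
  start-∈ (point u) = here refl
  start-∈ (e ◅ p) = here refl

  end-∈ : ∀ {u v l} → Path R u v l → v ∈ l
  end-∈ (point u) = here refl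
  end-∈ (e ◅ p) = there (end-∈ p)

  path-++ : ∀ {u v l w x l′} → Path R u v l → R v w → Path R w x l′ → Path R u x (l ++ l′)
  path-++ (point u) e q = e ◅ q
  path-++ (f ◅ p) e q = f ◅ path-++ p e q

  path-join : ∀ {u v l x l′} → Path R u v l → Path R v x l′ →
    ∃ λ l″ → Path R u x l″ × (∀ {z} → z ∈ l″ → z ∈ l ⊎ z ∈ l′)
  path-join (point u) q = _ , q , inj₂
  path-join (e ◅ p) q with path-join p q
  ... | l″ , r , s = _ , e ◅ r , λ { (here refl) → inj₁ (here refl)
                                   ; (there i) → [ inj₁ ∘ there , inj₂ ]′ (s i) }

  path-head : ∀ {u v l} → Path R u v l → ∃ λ l′ → l ≡ u ∷ l′
  path-head (point u) = [] , refl
  path-head (e ◅ p) = _ , refl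

  path-last : ∀ {u v l} → Path R u v l → ∃ λ l′ → l ≡ l′ ++ [ v ]
  path-last (point u) = [] , refl
  path-last (_◅_ {u} e p) with path-last p
  ... | l′ , eq = u ∷ l′ , cong (u ∷_) eq

  path-upto : ∀ {u v} l₁ {y l₂} → Path R u v (l₁ ++ y ∷ l₂) → Path R u y (l₁ ++ [ y ])
  path-upto [] (point u) = point u
  path-upto [] (e ◅ p) = point _
  path-upto (x ∷ []) (e ◅ p) = e ◅ path-upto [] p
  path-upto (x ∷ x′ ∷ l₁) (e ◅ p) = e ◅ path-upto (x′ ∷ l₁) p

  path-from : ∀ {u v} l₁ {y l₂} → Path R u v (l₁ ++ y ∷ l₂) → Path R y v (y ∷ l₂)
  path-from [] (point u) = point u
  path-from [] (e ◅ p) = e ◅ p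
  path-from (x ∷ []) (e ◅ p) = path-from [] p
  path-from (x ∷ x′ ∷ l₁) (e ◅ p) = path-from (x′ ∷ l₁) p

  path-before : ∀ {u v} l₁ {y l₂} → Path R u v (l₁ ++ y ∷ l₂) →
    (l₁ ≡ [] × u ≡ y) ⊎ (∃ λ w → Path R u w l₁ × R w y)
  path-before [] (point u) = inj₁ (refl , refl)
  path-before [] (e ◅ p) = inj₁ (refl , refl)
  path-before (x ∷ []) (e ◅ p) with path-head p
  ... | _ , refl = inj₂ (x , point x , e)
  path-before (x ∷ x′ ∷ l₁) (e ◅ p) with path-before (x′ ∷ l₁) p
  ... | inj₂ (w , q , f) = inj₂ (w , e ◅ q , f)

  path-after : ∀ {y v l₂} → Path R y v (y ∷ l₂) → (l₂ ≡ [] × y ≡ v) ⊎ (∃ λ w → Path R w v l₂ × R y w)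
  path-after (point u) = inj₁ (refl , refl)
  path-after (e ◅ p) = inj₂ (_ , p , e)

  path-pairs : ∀ {u v l} → Path R u v l → ∀ {a b} → (a , b) ∈ pairs l → R a b
  path-pairs (e ◅ point u) (here refl) = e
  path-pairs (e ◅ f ◅ p) (here refl) = e
  path-pairs (e ◅ f ◅ p) (there i) = path-pairs (f ◅ p) i

  pairs-path : ∀ {S : V → V → Set} {u v l} → Path S u v l → (∀ {a b} → (a , b) ∈ pairs l → R a b) → Path R u v l
  pairs-path (point u) f = point u
  pairs-path (e ◅ point u) f = f (here refl) ◅ point u
  pairs-path (e ◅ e′ ◅ p) f = f (here refl) ◅ pairs-path (e′ ◅ p) (f ∘ there)

  -- The last component serves the gluing in Menger's theorem: the shortened path meets the old end
  -- `w` only if nothing was cut off.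
  path-prefix : ∀ {u w l v} → Unique l → Path R u w l → v ∈ l →
    ∃ λ l′ → Path R u v l′ × l′ ⊆ l × (w ∈ l′ → v ≡ w)
  path-prefix uq (point u) (here refl) = _ , point u , id , λ _ → refl
  path-prefix {u} uq (e ◅ p) (here refl) = u ∷ [] , point u , (λ { (here refl) → here refl })
    , λ { (here refl) → refl }
  path-prefix {u} uq (e ◅ p) (there i) with path-prefix (unique-tail uq) p i
  ... | l′ , q , s , h = u ∷ l′ , e ◅ q , (λ { (here refl) → here refl ; (there j) → there (s j) })
    , λ { (here refl) → contradiction (end-∈ p) (unique-head uq) ; (there j) → h j }

  path-suffix : ∀ {u w l v} → Unique l → Path R u w l → v ∈ l →
    ∃ λ l′ → Path R v w l′ × l′ ⊆ l × Unique l′ × (u ∈ l′ → v ≡ u)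
  path-suffix uq (point u) (here refl) = _ , point u , id , uq , λ _ → refl
  path-suffix uq (e ◅ p) (here refl) = _ , e ◅ p , id , uq , λ _ → refl
  path-suffix uq (e ◅ p) (there i) with path-suffix (unique-tail uq) p i
  ... | l′ , q , s , uq′ , _ = l′ , q , there ∘ s , uq′ , λ j → contradiction (s j) (unique-head uq)

module _ {V : Set} {R : V → V → Set} where

  path-reverse : ∀ {u v l} → Path R u v l → Path (λ a b → R b a) v u (reverse l)
  path-reverse (point u) = point u
  path-reverse (_◅_ {u} {l = l} e p) =
    subst (Path _ _ _) (sym (Lₚ.unfold-reverse u l)) (path-++ (path-reverse p) e (point u))

module PathEq {V : Set} (_≟_ : (x y : V) → Dec (x ≡ y)) where
  open Eq _≟_

  path-simplify : ∀ {R : V → V → Set} {u v l} → Path R u v l → ∃ λ l′ → Path R u v l′ × Unique l′ × l′ ⊆ l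
  path-simplify (point u) = _ , point u , [] ∷ [] , id
  path-simplify {u = u} (e ◅ p) with path-simplify p
  ... | l′ , q , uq , s with u ∈? l′
  ...   | no n = u ∷ l′ , e ◅ q , unique-∷ n uq , λ { (here refl) → here refl ; (there i) → there (s i) }
  ...   | yes i with path-suffix uq q i
  ...     | l″ , q′ , s′ , uq′ , _ = l″ , q′ , uq′ , there ∘ s ∘ s′

-- Menger's theorem, by Göring's induction on the arcs

module Menger {V : Set} (_≟_ : (x y : V) → Dec (x ≡ y)) where
  open Eq _≟_
  open PathEq _≟_

  Arc : List (V × V) → V → V → Set
  Arc es u v = (u , v) ∈ es

  Separator : List (V × V) → List V → List V → List V → Set
  Separator es A B S = ∀ {u v l} → Path (Arc es) u v l → u ∈ A → v ∈ B → ∃ λ w → w ∈ l × w ∈ S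

  record ABPath (es : List (V × V)) (A B : List V) : Set where
    constructor abpath
    field
      {start end} : V
      {body} : List V
      path : Path (Arc es) start end body
      start∈ : start ∈ A
      end∈ : end ∈ B
      unique : Unique body

  open ABPath

  record Family (es : List (V × V)) (A B : List V) (k : ℕ) : Set where
    constructor family
    field
      member : Fin k → ABPath es A B
      disjoint : ∀ i j {v} → v ∈ body (member i) → v ∈ body (member j) → i ≡ j

  open Family

  path-without : ∀ {x y es u v l} → Path (Arc ((x , y) ∷ es)) u v l →
    Path (Arc es) u v l ⊎ (x ∈ l × y ∈ l)
  path-without (point u) = inj₁ (point u)
  path-without (here refl ◅ p) = inj₂ (here refl , there (start-∈ p))
  path-without (there e ◅ p) with path-without p
  ... | inj₁ q = inj₁ (e ◅ q)
  ... | inj₂ (i , j) = inj₂ (there i , there j)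

  -- As `x` belongs to `P`, a path stopped at its first vertex in `P` has not yet used the arc from
  -- `x` to `y`.
  first-hit : ∀ {x y es P u v l} → x ∈ P → Path (Arc ((x , y) ∷ es)) u v l → (∃ λ w → w ∈ l × w ∈ P) →
    ∃₂ λ z l′ → z ∈ P × Path (Arc es) u z l′ × l′ ⊆ l
  first-hit {P = P} {u} xP p (w , i , m) with u ∈? P
  ... | yes uP = u , u ∷ [] , uP , point u , λ { (here refl) → start-∈ p }
  first-hit xP (point u) (w , here refl , m) | no n = contradiction m n
  first-hit xP (here refl ◅ p) (w , i , m) | no n = contradiction xP n
  first-hit xP (there e ◅ p) (w , here refl , m) | no n = contradiction m n
  first-hit xP (there e ◅ p) (w , there i , m) | no n with first-hit xP p (w , i , m)
  ... | z , l′ , zP , q , s = z , _ , zP , e ◅ q , λ { (here refl) → here refl ; (there j) → there (s j) }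

  -- As `y` belongs to `Q`, a path begun at its last vertex in `Q` cannot use the arc from `x` to
  -- `y` any more.
  last-hit : ∀ {x y es Q u v l} → y ∈ Q → Path (Arc ((x , y) ∷ es)) u v l → (∃ λ w → w ∈ l × w ∈ Q) →
    ∃₂ λ z l′ → z ∈ Q × Path (Arc es) z v l′ × l′ ⊆ l
  last-hit yQ (point u) (w , here refl , m) = u , _ , m , point u , id
  last-hit {Q = Q} yQ (_◅_ {u} {l = l} e p) (w , i , m) with disjoint? l Q
  ... | inj₂ hit with last-hit yQ p hit
  ...   | z , l′ , zQ , q , s = z , l′ , zQ , q , there ∘ s
  last-hit yQ (e ◅ p) (w , there i , m) | inj₁ d = contradiction (i , m) d
  last-hit yQ (e ◅ p) (w , here refl , m) | inj₁ d with path-without p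
  ... | inj₂ (_ , j) = contradiction (j , yQ) d
  last-hit yQ (here refl ◅ p) (w , here refl , m) | inj₁ d | inj₁ q = contradiction (start-∈ p , yQ) d
  last-hit yQ (there e ◅ p) (w , here refl , m) | inj₁ d | inj₁ q = _ , _ , m , e ◅ q , id

  weaken : ∀ {e es A B k} → Family es A B k → Family (e ∷ es) A B k
  weaken (family m d) = family (λ i → abpath (path-map there (path (m i))) (start∈ (m i)) (end∈ (m i)) (unique (m i))) d

  end-injective : ∀ {es A B k} (F : Family es A B k) i j → end (member F i) ≡ end (member F j) → i ≡ j
  end-injective F i j e = disjoint F i j (subst (_∈ body (member F i)) e (end-∈ (path (member F i))))
    (end-∈ (path (member F j)))

  start-injective : ∀ {es A B k} (F : Family es A B k) i j → start (member F i) ≡ start (member F j) → i ≡ j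
  start-injective F i j e = disjoint F i j (subst (_∈ body (member F i)) e (start-∈ (path (member F i))))
    (start-∈ (path (member F j)))

  -- Ends of disjoint paths are distinct, and `k` distinct ends exhaust a list of length `k`.
  end-onto : ∀ {es A k} P → length P ≡ k → (F : Family es A P k) → ∀ {z} → z ∈ P → ∃ λ i → end (member F i) ≡ z
  end-onto {k = k} P eq F zP
    with ∈-map⁻ (λ i → end (member F i)) (unique-⊇ {map (λ i → end (member F i)) (allFin k)} uq sub len zP)
    where
    uq = Uₚ.map⁺ (end-injective F _ _) (Uₚ.allFin⁺ k)
    sub : map (λ i → end (member F i)) (allFin k) ⊆ P
    sub i with ∈-map⁻ (λ i → end (member F i)) i
    ... | j , _ , refl = end∈ (member F j)
    len : length P ≤ length (map (λ i → end (member F i)) (allFin k))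
    len = ≤-reflexive (trans eq (sym (trans (Lₚ.length-map _ (allFin k)) (Lₚ.length-tabulate {n = k} id))))
  ... | i , _ , e = i , sym e

  start-onto : ∀ {es B k} Q → length Q ≡ k → (F : Family es Q B k) → ∀ {z} → z ∈ Q → ∃ λ i → start (member F i) ≡ z
  start-onto {k = k} Q eq F zQ
    with ∈-map⁻ (λ i → start (member F i)) (unique-⊇ {map (λ i → start (member F i)) (allFin k)} uq sub len zQ)
    where
    uq = Uₚ.map⁺ (start-injective F _ _) (Uₚ.allFin⁺ k)
    sub : map (λ i → start (member F i)) (allFin k) ⊆ Q
    sub i with ∈-map⁻ (λ i → start (member F i)) i
    ... | j , _ , refl = start∈ (member F j)
    len : length Q ≤ length (map (λ i → start (member F i)) (allFin k))
    len = ≤-reflexive (trans eq (sym (trans (Lₚ.length-map _ (allFin k)) (Lₚ.length-tabulate {n = k} id))))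
  ... | i , _ , e = i , sym e

  -- Suppose that without the arc from `x` to `y` a set `S` of exactly `k` - 1 vertices separates.
  -- With the arc, both `x ∷ S` and `y ∷ S` separate, since a path using the arc visits `x` and `y`.
  -- A small separator between `A` and the first, or between the second and `B`, would separate `A`
  -- from `B` in the full digraph; otherwise there are two families of `k` paths, which are glued
  -- along `S` and along the arc.
  menger : ∀ es A B k → (∃ λ S → length S < k × Separator es A B S) ⊎ Family es A B k
  menger [] A B k = base (k ≤? length AB)
    where
    AB = deduplicate _≟_ (filter (_∈? B) A)
    uq : Unique AB
    uq = UDₚ.deduplicate-! _≟_ _
    mem : ∀ {v} → v ∈ AB → v ∈ A × v ∈ B
    mem i = ∈-filter⁻ (_∈? B) {xs = A} (∈-deduplicate⁻ _≟_ (filter (_∈? B) A) i)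
    base : Dec (k ≤ length AB) → (∃ λ S → length S < k × Separator [] A B S) ⊎ Family [] A B k
    base (no n) = inj₁ (AB , ℕₚ.≰⇒> n , sep)
      where
      sep : Separator [] A B AB
      sep (point u) a b = u , here refl , ∈-deduplicate⁺ _≟_ (∈-filter⁺ (_∈? B) a b)
    base (yes le) = inj₂ (family
      (λ i → let m = mem (∈-lookup {xs = AB} (Fin.inject≤ i le)) in
        abpath (point (lookup AB (Fin.inject≤ i le))) (proj₁ m) (proj₂ m) ([] ∷ []))
      disj)
      where
      disj : ∀ i j {v} → v ∈ [ lookup AB (Fin.inject≤ i le) ] → v ∈ [ lookup AB (Fin.inject≤ j le) ] → i ≡ j
      disj i j (here refl) (here e) = Finₚ.inject≤-injective le le i j (lookup-injective uq _ _ e)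
  menger ((x , y) ∷ es) A B k with menger es A B k
  ... | inj₂ F = inj₂ (weaken F)
  ... | inj₁ (S , lt , sep) with suc (length S) <? k
  ...   | yes lt′ = inj₁ (x ∷ S , lt′ , sep′)
    where
    sep′ : Separator ((x , y) ∷ es) A B (x ∷ S)
    sep′ p a b with path-without p
    ... | inj₂ (i , _) = x , i , here refl
    ... | inj₁ q with sep q a b
    ...   | w , i , j = w , i , there j
  ...   | no ge with menger es A (x ∷ S) k
  ...     | inj₁ (S′ , lt′ , sep′) = inj₁ (S′ , lt′ , sep″)
    where
    sep″ : Separator ((x , y) ∷ es) A B S′
    sep″ {l = l} p a b with first-hit (here refl) p hit
      where
      hit : ∃ λ w → w ∈ l × w ∈ x ∷ S
      hit with path-without p
      ... | inj₂ (i , _) = x , i , here refl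
      ... | inj₁ q with sep q a b
      ...   | w , i , j = w , i , there j
    ... | z , l′ , zP , q , s with sep′ q a zP
    ...   | w , i , j = w , s i , j
  ...     | inj₂ F with menger es (y ∷ S) B k
  ...       | inj₁ (S′ , lt′ , sep′) = inj₁ (S′ , lt′ , sep″)
    where
    sep″ : Separator ((x , y) ∷ es) A B S′
    sep″ {l = l} p a b with last-hit (here refl) p hit
      where
      hit : ∃ λ w → w ∈ l × w ∈ y ∷ S
      hit with path-without p
      ... | inj₂ (_ , i) = y , i , here refl
      ... | inj₁ q with sep q a b
      ...   | w , i , j = w , i , there j
    ... | z , l′ , zP , q , s with sep′ q zP b
    ...   | w , i , j = w , s i , j
  ...       | inj₂ G = inj₂ (family (λ i → proj₁ (new i)) disj)
    where
    eq : suc (length S) ≡ k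
    eq = ℕₚ.≤-antisym lt (ℕₚ.≮⇒≥ ge)

    gi : ∀ {z} → z ∈ y ∷ S → Fin k
    gi zQ = proj₁ (start-onto (y ∷ S) eq G zQ)
    gi-start : ∀ {z} (zQ : z ∈ y ∷ S) → start (member G (gi zQ)) ≡ z
    gi-start zQ = proj₂ (start-onto (y ∷ S) eq G zQ)

    f-S : ∀ i {w} → w ∈ S → w ∈ body (member F i) → w ≡ end (member F i)
    f-S i {w} wS m with end-onto (x ∷ S) eq F (there wS)
    ... | j , refl = cong (λ j → end (member F j)) (disjoint F j i (end-∈ (path (member F j))) m)
    g-S : ∀ i {w} → w ∈ S → w ∈ body (member G i) → w ≡ start (member G i)
    g-S i {w} wS m with start-onto (y ∷ S) eq G (there wS)
    ... | j , refl = cong (λ j → start (member G j)) (disjoint G j i (start-∈ (path (member G j))) m)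

    -- The part of the first path up to `v` and the part of the second from `v` on form a path from
    -- `A` to `B` without the new arc, so it meets `S`. Vertices of `S` occur on the given paths
    -- only as an end or a start respectively, and the shortened paths reach these only at `v`.
    cross : ∀ i j {v} → v ∈ body (member F i) → v ∈ body (member G j) → v ∈ S
    cross i j {v} m m′ with v ∈? S
    ... | yes vS = vS
    ... | no vS with path-prefix (unique (member F i)) (path (member F i)) m
                   | path-suffix (unique (member G j)) (path (member G j)) m′
    ...   | l , p , s , h | l′ , q , s′ , _ , h′ with path-join p q
    ...     | l″ , r , s″ with sep r (start∈ (member F i)) (end∈ (member G j))
    ...       | w , k , wS with s″ k
    ...         | inj₁ wl with f-S i wS (s wl)
    ...           | refl = subst (_∈ S) (sym (h wl)) wS
    cross i j {v} m m′ | no vS | l , p , s , h | l′ , q , s′ , _ , h′ | l″ , r , s″ | w , k , wS | inj₂ wl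
      with g-S j wS (s′ wl)
    ... | refl = subst (_∈ S) (sym (h′ wl)) wS

    -- Otherwise the `k` distinct starts of the second family would all lie in `S`, which has only
    -- `k` - 1 entries. It makes the continuation at `y` different from every continuation inside
    -- `S`.
    y∉S : y ∉ S
    y∉S yS = contradiction (unique-⊆⇒length≤ {ys = S} uq sub) (ℕₚ.<⇒≱ k>S)
      where
      starts = map (λ i → start (member G i)) (allFin k)
      uq : Unique starts
      uq = Uₚ.map⁺ (start-injective G _ _) (Uₚ.allFin⁺ k)
      sub : starts ⊆ S
      sub i with ∈-map⁻ (λ i → start (member G i)) i
      ... | j , _ , refl with start∈ (member G j)
      ...   | here e = subst (_∈ S) (sym e) yS
      ...   | there t = t
      k>S : length S < length starts
      k>S = ≤-reflexive (trans eq (sym (trans (Lₚ.length-map _ (allFin k)) (Lₚ.length-tabulate {n = k} id))))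

    -- The vertex at which the continuation of a path ending in z starts.
    next : ∀ {z} → z ∈ x ∷ S → ∃ λ z′ → z′ ∈ y ∷ S
    next (here _) = y , here refl
    next {z} (there i) = z , there i

    next-injective : ∀ {z w} (zP : z ∈ x ∷ S) (wP : w ∈ x ∷ S) → proj₁ (next zP) ≡ proj₁ (next wP) → z ≡ w
    next-injective (here refl) (here refl) e = refl
    next-injective (here refl) (there i) refl = contradiction i y∉S
    next-injective (there i) (here refl) refl = contradiction i y∉S
    next-injective (there i) (there j) e = e

    next-S : ∀ {z w} (zP : z ∈ x ∷ S) → w ∈ S → w ≡ proj₁ (next zP) → w ≡ z
    next-S (here _) wS refl = contradiction wS y∉S
    next-S (there _) wS e = e

    gᵢ : Fin k → Fin k
    gᵢ i = gi (proj₂ (next (end∈ (member F i))))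

    D′ = (x , y) ∷ es

    joined : ∀ i → ∃ λ l → Path (Arc D′) (start (member F i)) (end (member G (gᵢ i))) l ×
      (∀ {v} → v ∈ l → v ∈ body (member F i) ⊎ v ∈ body (member G (gᵢ i)))
    joined i = go (end∈ (member F i)) (path-map there (path (member F i)))
      where
      go : ∀ {z} (zP : z ∈ x ∷ S) → Path (Arc D′) (start (member F i)) z (body (member F i)) →
        ∃ λ l → Path (Arc D′) (start (member F i)) (end (member G (gi (proj₂ (next zP))))) l ×
          (∀ {v} → v ∈ l → v ∈ body (member F i) ⊎ v ∈ body (member G (gi (proj₂ (next zP)))))
      go (here refl) p = _ , path-++ p (here (cong (x ,_) (gi-start (here refl)))) (path-map there (path (member G _)))
        , ∈-++⁻ (body (member F i))
      go (there zS) p = path-join p (subst (λ w → Path (Arc D′) w (end (member G (gi (there zS)))) (body (member G (gi (there zS))))) (gi-start (there zS))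
          (path-map there (path (member G (gi (there zS))))))

    new : ∀ i → Σ (ABPath D′ A B) λ p → ∀ {v} → v ∈ body p → v ∈ body (member F i) ⊎ v ∈ body (member G (gᵢ i))
    new i with joined i
    ... | l , p , s with path-simplify p
    ...   | l′ , q , uq , t = abpath q (start∈ (member F i)) (end∈ (member G (gᵢ i))) uq , s ∘ t

    mixed : ∀ i j {v} → v ∈ body (member F i) → v ∈ body (member G (gᵢ j)) → i ≡ j
    mixed i j m m′ = end-injective F i j (trans (sym (f-S i vS m))
      (next-S (end∈ (member F j)) vS (trans (g-S (gᵢ j) vS m′) (gi-start _))))
      where vS = cross i (gᵢ j) m m′

    disj : ∀ i j {v} → v ∈ body (proj₁ (new i)) → v ∈ body (proj₁ (new j)) → i ≡ j
    disj i j a b with proj₂ (new i) a | proj₂ (new j) b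
    ... | inj₁ m | inj₁ m′ = disjoint F i j m m′
    ... | inj₁ m | inj₂ m′ = mixed i j m m′
    ... | inj₂ m | inj₁ m′ = sym (mixed j i m′ m)
    ... | inj₂ m | inj₂ m′ = end-injective F i j (next-injective (end∈ (member F i)) (end∈ (member F j))
      (trans (sym (gi-start _)) (trans (cong (λ j → start (member G j)) (disjoint G (gᵢ i) (gᵢ j) m m′)) (gi-start _))))

-- Systems of disjoint paths

module System {V : Set} (_≟_ : (x y : V) → Dec (x ≡ y)) (D : V → V → Set) where

  open Eq _≟_

  record Seg : Set where
    constructor seg
    field
      {start end} : V
      {body} : List V
      path : Path D start end body

  open Seg public

  verts : List Seg → List V
  verts = concatMap body

  In : List V → List Seg → Set
  In I ps = ∃ λ P → P ∈ ps × Infix I (body P)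

  verts-++ : ∀ ps qs → verts (ps ++ qs) ≡ verts ps ++ verts qs
  verts-++ = concatMap-++ body

  In-⊆ : ∀ {I ps qs} → ps ⊆ qs → In I ps → In I qs
  In-⊆ s (P , i , j) = P , s i , j

  infix-verts : ∀ {I ps P} → P ∈ ps → Infix I (body P) → Infix I (verts ps)
  infix-verts {ps = P ∷ ps} (here refl) j = infix-++ʳ (verts ps) j
  infix-verts {ps = P ∷ ps} (there i) j = infix-++ˡ (body P) (infix-verts i j)

  -- The pieces are lists of length at most one because either may be absent, which happens only if
  -- `z` is the corresponding end of `P`.
  record Pieces (P : Seg) (z : V) : Set where
    field
      before after : List Seg
      split : body P ≡ verts before ++ z ∷ verts after
      before≤1 : length before ≤ 1
      after≤1 : length after ≤ 1
      before-spec : All (λ Q → start Q ≡ start P × Infix (end Q ∷ z ∷ []) (body P)) before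
      after-spec : All (λ Q → end Q ≡ end P × Infix (z ∷ start Q ∷ []) (body P)) after
      before-[] : before ≡ [] → start P ≡ z
      after-[] : after ≡ [] → end P ≡ z
      keep : ∀ {I} → I ≢ [] → z ∉ I → Infix I (body P) → In I (before ++ after)

  private
    data Part (P : V → V → Set) (l : List V) : Set where
      none : l ≡ [] → Part P l
      some : (Q : Seg) → body Q ≡ l → P (start Q) (end Q) → Part P l

    segs : ∀ {P l} → Part P l → List Seg
    segs (none _) = []
    segs (some Q _ _) = Q ∷ []

    segs-verts : ∀ {P l} (p : Part P l) → verts (segs p) ≡ l
    segs-verts (none refl) = refl
    segs-verts (some Q refl _) = Lₚ.++-identityʳ (body Q)

    segs≤1 : ∀ {P l} (p : Part P l) → length (segs p) ≤ 1
    segs≤1 (none _) = z≤n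
    segs≤1 (some _ _ _) = s≤s z≤n

    segs-all : ∀ {P l} (p : Part P l) → All (λ Q → P (start Q) (end Q)) (segs p)
    segs-all (none _) = []
    segs-all (some _ _ x) = x ∷ []

    segs-[] : ∀ {P l} (p : Part P l) → segs p ≡ [] → l ≡ []
    segs-[] (none e) _ = e

    infix-segs : ∀ {P l I} (p : Part P l) → I ≢ [] → Infix I l → In I (segs p)
    infix-segs {I = []} (none refl) ne i = contradiction refl ne
    infix-segs {I = x ∷ I} (none refl) ne i with infix-∈ i (here refl)
    ... | ()
    infix-segs (some Q refl _) ne i = Q , here refl , i

  abstract
    cut : ∀ P {z} → z ∈ body P → Pieces P z
    cut P {z} i with ∈-∃++ i
    ... | l₁ , l₂ , refl = record
      { before = segs b ; after = segs a
      ; split = sym (cong₂ (λ x y → x ++ z ∷ y) (segs-verts b) (segs-verts a))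
      ; before≤1 = segs≤1 b ; after≤1 = segs≤1 a
      ; before-spec = segs-all b
      ; after-spec = segs-all a
      ; before-[] = λ e → start-is l₁ (segs-[] b e) (path P)
      ; after-[] = λ e → end-is (segs-[] a e) (path-from l₁ (path P))
      ; keep = keep′ }
      where
      b : Part (λ s e → s ≡ start P × Infix (e ∷ z ∷ []) (l₁ ++ z ∷ l₂)) l₁
      b with path-before l₁ (path P)
      ... | inj₁ (e , _) = none e
      ... | inj₂ (w , q , _) with path-last q
      ...   | l₀ , refl = some (seg q) refl (refl , l₀ , l₂ , Lₚ.++-assoc l₀ _ _)
      a : Part (λ s e → e ≡ end P × Infix (z ∷ s ∷ []) (l₁ ++ z ∷ l₂)) l₂
      a with path-after (path-from l₁ (path P))
      ... | inj₁ (e , _) = none e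
      ... | inj₂ (w , q , _) with path-head q
      ...   | l₀ , refl = some (seg q) refl (refl , l₁ , l₀ , refl)
      start-is : ∀ {u v} l₁ {l₂} → l₁ ≡ [] → Path D u v (l₁ ++ z ∷ l₂) → u ≡ z
      start-is [] refl (point _) = refl
      start-is [] refl (_ ◅ _) = refl
      end-is : ∀ {v l₂} → l₂ ≡ [] → Path D z v (z ∷ l₂) → v ≡ z
      end-is refl (point _) = refl
      end-is refl (_ ◅ ())
      keep′ : ∀ {I} → I ≢ [] → z ∉ I → Infix I (l₁ ++ z ∷ l₂) → In I (segs b ++ segs a)
      keep′ ne n i with infix-split l₁ i n
      ... | inj₁ j = In-⊆ ∈-++⁺ˡ (infix-segs b ne j)
      ... | inj₂ j = In-⊆ (∈-++⁺ʳ (segs b)) (infix-segs a ne j)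

  -- Repairing last vertices and repairing first vertices are mirror images; `key` is the end under
  -- repair. When a vertex is cut out of a path, the `kept` piece retains the old key end, whereas
  -- the key end of the `free` piece is newly exposed.
  record Side : Set₁ where
    field
      key other : Seg → V
      Adj : V → V → Set
      attach : ∀ Q {z} → Adj (key Q) z → Seg
      attach-key : ∀ Q {z} (e : Adj (key Q) z) → key (attach Q e) ≡ z
      attach-other : ∀ Q {z} (e : Adj (key Q) z) → other (attach Q e) ≡ other Q
      attach-body : ∀ Q {z} (e : Adj (key Q) z) → body (attach Q e) ↭ z ∷ body Q
      attach-infix : ∀ Q {z} (e : Adj (key Q) z) {I} → Infix I (body Q) → Infix I (body (attach Q e))
      kept free : ∀ {P z} → Pieces P z → List Seg
      kept-free : ∀ {P z} (c : Pieces P z) → kept c ++ free c ↭ Pieces.before c ++ Pieces.after c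
      kept≤1 : ∀ {P z} (c : Pieces P z) → length (kept c) ≤ 1
      free≤1 : ∀ {P z} (c : Pieces P z) → length (free c) ≤ 1
      kept-spec : ∀ {P z} (c : Pieces P z) → All (λ Q → key Q ≡ key P ×
        (Infix (z ∷ other Q ∷ []) (body P) ⊎ Infix (other Q ∷ z ∷ []) (body P))) (kept c)
      free-spec : ∀ {P z} (c : Pieces P z) → All (λ Q → other Q ≡ other P ×
        (Infix (z ∷ key Q ∷ []) (body P) ⊎ Infix (key Q ∷ z ∷ []) (body P))) (free c)
      kept-[] : ∀ {P z} (c : Pieces P z) → kept c ≡ [] → key P ≡ z

  ends : Side
  ends = record
    { key = end ; other = start ; Adj = D
    ; attach = λ Q {z} e → seg (path-++ (path Q) e (point z))
    ; attach-key = λ _ _ → refl ; attach-other = λ _ _ → refl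
    ; attach-body = λ Q {z} e → ↭-sym (Permₚ.∷↭∷ʳ z (body Q))
    ; attach-infix = λ Q e → infix-++ʳ _
    ; kept = Pieces.after ; free = Pieces.before
    ; kept-free = λ c → Permₚ.++-comm (Pieces.after c) (Pieces.before c)
    ; kept≤1 = Pieces.after≤1 ; free≤1 = Pieces.before≤1
    ; kept-spec = λ c → All.map (λ (e , i) → e , inj₁ i) (Pieces.after-spec c)
    ; free-spec = λ c → All.map (λ (e , i) → e , inj₂ i) (Pieces.before-spec c)
    ; kept-[] = Pieces.after-[] }

  starts : Side
  starts = record
    { key = start ; other = end ; Adj = λ u z → D z u
    ; attach = λ Q e → seg (e ◅ path Q)
    ; attach-key = λ _ _ → refl ; attach-other = λ _ _ → refl
    ; attach-body = λ Q e → ↭-refl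
    ; attach-infix = λ Q {z} e → infix-++ˡ [ z ]
    ; kept = Pieces.before ; free = Pieces.after
    ; kept-free = λ c → ↭-refl
    ; kept≤1 = Pieces.before≤1 ; free≤1 = Pieces.after≤1
    ; kept-spec = λ c → All.map (λ (e , i) → e , inj₂ i) (Pieces.before-spec c)
    ; free-spec = λ c → All.map (λ (e , i) → e , inj₁ i) (Pieces.after-spec c)
    ; kept-[] = Pieces.before-[] }

  -- `KeyOK` is what guarantees the degree used by `leave` at an end that is still bad; `OtherOK` is
  -- what earlier repairs have achieved at the opposite ends and must not be lost. The factor 3 in
  -- `leave` pays for `L` itself and for the vertices next to `L` on either side.
  record FixData : Set₁ where
    field
      S : Side
      L : List V
      KeyOK OtherOK : V → Set
      key-ok : ∀ {v} → v ∉ L → KeyOK v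
      other-ok : ∀ {v} → v ∉ L → OtherOK v
      leave : ∀ v → v ∈ L → KeyOK v → ∀ l → length l ≤ 3 * length L → ∃ λ z → Side.Adj S v z × z ∉ l

  module Fix (fixing : FixData) where

    open FixData fixing

    open Side S

    Ok : Seg → Set
    Ok Q = KeyOK (key Q) × OtherOK (other Q)

    record Fixed (bound : ℕ) (ps : List Seg) : Set where
      constructor fixed
      field
        out : List Seg
        size : length out ≤ bound
        uniq : Unique (verts out)
        cover : verts ps ⊆ verts out
        good : All (λ Q → key Q ∉ L × OtherOK (other Q)) out
        keep : ∀ {I} → I ≢ [] → I ⊆ L → In I ps → In I out

    Nbr : V → V → List V → Set
    Nbr z w l = Infix (z ∷ w ∷ []) l ⊎ Infix (w ∷ z ∷ []) l

    detach-ok : ∀ {P os z} (c : Pieces P z) → All Ok (P ∷ os) → (∀ {w} → Nbr z w (body P) → w ∉ L) →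
      All Ok (kept c ++ free c ++ os)
    detach-ok c ((k , o) ∷ oks) far = Allₚ.++⁺
      (All.map (λ (e , i) → subst KeyOK (sym e) k , other-ok (far i)) (kept-spec c))
      (Allₚ.++⁺ (All.map (λ (e , i) → key-ok (far i) , subst OtherOK (sym e) o) (free-spec c)) oks)

    detach-verts : ∀ {P os z} (c : Pieces P z) → verts (P ∷ os) ↭ z ∷ verts (kept c ++ free c ++ os)
    detach-verts {P} {os} {z} c = ↭-trans
      (Permₚ.++⁺ʳ (verts os) (↭-trans (↭-reflexive (Pieces.split c))
        (↭-trans (Permₚ.shift z (verts (Pieces.before c)) (verts (Pieces.after c)))
          (prep z (↭-trans (↭-reflexive (sym (verts-++ (Pieces.before c) (Pieces.after c))))
            (concatMap-↭ body (↭-sym (kept-free c))))))))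
      (prep z (↭-reflexive (trans (sym (verts-++ (kept c ++ free c) os)) (cong verts (Lₚ.++-assoc (kept c) (free c) os)))))

    detach-keep : ∀ {P os z I} (c : Pieces P z) → I ≢ [] → z ∉ I → In I (P ∷ os) → In I (kept c ++ free c ++ os)
    detach-keep {os = os} c ne n (Q , here refl , i) =
      subst (In _) (Lₚ.++-assoc (kept c) (free c) os)
        (In-⊆ ∈-++⁺ˡ (In-⊆ (↭-∈ (↭-sym (kept-free c))) (Pieces.keep c ne n i)))
    detach-keep c ne n (Q , there j , i) = Q , ∈-++⁺ʳ (kept c) (∈-++⁺ʳ (free c) j) , i

    -- One repair: z is cut out of its path, if it lies on one, and then attached to the bad end of Q.
    record Step (ps : List Seg) (z : V) : Set where
      constructor step
      field
        {Q} : Seg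
        {rest} : List Seg
        adj : Adj (key Q) z
        vs : (verts ps ↭ z ∷ verts (Q ∷ rest)) ⊎ (z ∉ verts ps × verts ps ↭ verts (Q ∷ rest))
        oks : All Ok (Q ∷ rest)
        keep : ∀ {I} → I ≢ [] → z ∉ I → In I ps → In I (Q ∷ rest)

      new : List Seg
      new = attach Q adj ∷ rest

      new-verts : verts new ↭ z ∷ verts (Q ∷ rest)
      new-verts = Permₚ.++⁺ʳ (verts rest) (attach-body Q adj)

      new-uniq : Unique (verts ps) → Unique (verts new)
      new-uniq u with vs
      ... | inj₁ p = Unique-resp-↭ (↭-trans p (↭-sym new-verts)) u
      ... | inj₂ (n , p) = Unique-resp-↭ (↭-sym new-verts) (unique-∷ (λ i → n (↭-∈ (↭-sym p) i)) (Unique-resp-↭ p u))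

      new-cover : verts ps ⊆ verts new
      new-cover i with vs
      ... | inj₁ p = ↭-∈ (↭-sym new-verts) (↭-∈ p i)
      ... | inj₂ (n , p) = ↭-∈ (↭-sym new-verts) (there (↭-∈ p i))

      new-oks : z ∉ L → All Ok new
      new-oks n = (subst KeyOK (sym (attach-key Q adj)) (key-ok n)
        , subst OtherOK (sym (attach-other Q adj)) (proj₂ (All.head oks))) ∷ All.tail oks

      new-keep : ∀ {I} → I ≢ [] → z ∉ I → In I ps → In I new
      new-keep ne n i with keep ne n i
      ... | _ , here refl , j = _ , here refl , attach-infix Q adj j
      ... | _ , there k , j = _ , there k , j

    step-size : ∀ g b d → d ≤ 2 → d + g + 2 * b ≤ g + 2 * suc b
    step-size g b d le = ≤-trans (ℕₚ.+-monoˡ-≤ (2 * b) (ℕₚ.+-monoˡ-≤ g le))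
      (≤-reflexive (solve 2 (λ g b → con 2 :+ g :+ con 2 :* b := g :+ con 2 :* (con 1 :+ b)) refl g b))
      where open +-*-Solver

    size-++ : ∀ {A : Set} (xs gs : List A) b → length xs ≤ 1 → suc (length (xs ++ gs)) + 2 * b ≤ length gs + 2 * suc b
    size-++ xs gs b le = ≤-trans (≤-reflexive (cong (λ a → suc a + 2 * b) (Lₚ.length-++ xs)))
      (step-size (length gs) b (suc (length xs)) (s≤s le))

    -- The paths in `gs` have good key ends, those in `bs` are still to be examined. A repair takes
    -- one path out of `bs` and enlarges `gs` by at most two: the attached vertex is a good key end,
    -- and so is the end that its removal exposes. Hence the length of `gs` plus twice that of `bs`
    -- never grows. Only vertices outside `L` are moved, so every contiguous piece inside `L`
    -- survives.
    fix : ∀ f bs gs → length bs ≤ f → Unique (verts (bs ++ gs)) → All Ok (bs ++ gs) →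
      All (λ Q → key Q ∉ L) gs → Fixed (length gs + 2 * length bs) (bs ++ gs)
    fix f [] gs le u ok far = fixed gs (ℕₚ.m≤m+n _ _) u id
      (All.zipWith (λ (a , b) → a , proj₂ b) (far , ok)) (λ _ _ i → i)
    fix (suc f) (Q ∷ bs) gs (s≤s le) u ok far with key Q ∈? L
    ... | no n with fix f bs (Q ∷ gs) le (Unique-resp-↭ (concatMap-↭ body perm) u) (Permₚ.All-resp-↭ perm ok) (n ∷ far)
      where
      perm : Q ∷ bs ++ gs ↭ bs ++ Q ∷ gs
      perm = ↭-sym (Permₚ.shift Q bs gs)
    ...   | fixed out size uniq cover good keep = fixed out (≤-trans size arith) uniq
              (cover ∘ ↭-∈ (concatMap-↭ body perm)) good (λ ne s i → keep ne s (In-⊆ (↭-∈ perm) i))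
      where
      perm : Q ∷ bs ++ gs ↭ bs ++ Q ∷ gs
      perm = ↭-sym (Permₚ.shift Q bs gs)
      arith : suc (length gs) + 2 * length bs ≤ length gs + 2 * suc (length bs)
      arith = step-size (length gs) (length bs) 1 (s≤s z≤n)
    fix (suc f) (Q ∷ bs) gs (s≤s le) u ok far | yes QL = go
      where
      ps = Q ∷ bs ++ gs
      W = verts ps
      -- Besides lying outside `L`, the vertex `z` must have no neighbour in `L` on its own path, so
      -- that both ends exposed by cutting it out are outside `L`.
      avoid = L ++ follow L W ++ precede L W
      avoid≤ : length avoid ≤ 3 * length L
      avoid≤ = ≤-trans (≤-reflexive (trans (Lₚ.length-++ L) (cong (length L +_) (Lₚ.length-++ (follow L W)))))
        (≤-trans (ℕₚ.+-monoʳ-≤ (length L) (ℕₚ.+-mono-≤ (length-follow L u) (length-precede L u)))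
          (≤-reflexive (solve 1 (λ l → l :+ (l :+ l) := con 3 :* l) refl (length L))))
        where open +-*-Solver
      choice = leave (key Q) QL (proj₁ (All.head ok)) avoid avoid≤
      z = proj₁ choice
      e : Adj (key Q) z
      e = proj₁ (proj₂ choice)
      z∉L : z ∉ L
      z∉L i = proj₂ (proj₂ choice) (∈-++⁺ˡ i)
      far′ : ∀ {P w} → P ∈ ps → Nbr z w (body P) → w ∉ L
      far′ i (inj₁ j) m = proj₂ (proj₂ choice) (∈-++⁺ʳ L (∈-++⁺ʳ (follow L W) (∈-precede W (infix-verts i j) m)))
      far′ i (inj₂ j) m = proj₂ (proj₂ choice) (∈-++⁺ʳ L (∈-++⁺ˡ (∈-follow W (infix-verts i j) m)))

      finish : (s : Step ps z) → ∀ bs′ gs′ → length bs′ ≤ f → Step.new s ↭ bs′ ++ gs′ → All (λ Q → key Q ∉ L) gs′ →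
        length gs′ + 2 * length bs′ ≤ length gs + 2 * suc (length bs) →
        Fixed (length gs + 2 * suc (length bs)) ps
      finish s bs′ gs′ le′ perm far″ arith
        with fix f bs′ gs′ le′ (Unique-resp-↭ (concatMap-↭ body perm) (Step.new-uniq s u))
               (Permₚ.All-resp-↭ perm (Step.new-oks s z∉L)) far″
      ... | fixed out size uniq cover good keep = fixed out (≤-trans size arith) uniq
              (λ i → cover (↭-∈ (concatMap-↭ body perm) (Step.new-cover s i))) good
              (λ ne sub i → keep ne sub (In-⊆ (↭-∈ perm) (Step.new-keep s ne (λ j → z∉L (sub j)) i)))

      z≢ : ∀ {P} → key P ∈ L → key P ≢ z
      z≢ i e = z∉L (subst (_∈ L) e i)

      one-or-none : ∀ {A : Set} (xs : List A) → length xs ≤ 1 → xs ≡ [] ⊎ (∃ λ x → xs ≡ x ∷ [])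
      one-or-none [] _ = inj₁ refl
      one-or-none (x ∷ []) _ = inj₂ (x , refl)
      one-or-none (_ ∷ _ ∷ _) (s≤s ())

      free-far : ∀ {P} → P ∈ ps → (c : Pieces P z) → All (λ Q → key Q ∉ L) (free c)
      free-far i c = All.map (λ (_ , n) → far′ i n) (free-spec c)

      elsewhere : ∀ {P X} → P ∈ ps → (c : Pieces P z) → ps ↭ P ∷ Q ∷ X → Step ps z
      elsewhere {P} {X} i c perm = record
        { Q = Q ; rest = kept c ++ free c ++ X ; adj = e
        ; vs = inj₁ (↭-trans (concatMap-↭ body perm) (↭-trans (detach-verts {os = Q ∷ X} c) (prep z (concatMap-↭ body shape))))
        ; oks = Permₚ.All-resp-↭ shape (detach-ok {os = Q ∷ X} c (Permₚ.All-resp-↭ perm ok) (far′ i))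
        ; keep = λ ne n j → In-⊆ (↭-∈ shape) (detach-keep {os = Q ∷ X} c ne n (In-⊆ (↭-∈ perm) j)) }
        where
        shape : kept c ++ free c ++ Q ∷ X ↭ Q ∷ kept c ++ free c ++ X
        shape = solve 4 (λ k f q x → k ⊕ f ⊕ q ⊕ x ⊜ q ⊕ k ⊕ f ⊕ x) ↭-refl (kept c) (free c) [ Q ] X
          where open ↭-Solver

      own : (c : Pieces Q z) → ∀ {K} → kept c ≡ K ∷ [] → Step ps z
      own c {K} eq = record
        { Q = K ; rest = free c ++ bs ++ gs
        ; adj = subst (λ v → Adj v z) (sym (proj₁ (All.head (subst (All _) eq (kept-spec c))))) e
        ; vs = inj₁ (subst (λ k → verts ps ↭ z ∷ verts (k ++ free c ++ bs ++ gs)) eq (detach-verts c))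
        ; oks = subst (λ k → All Ok (k ++ free c ++ bs ++ gs)) eq (detach-ok c ok (far′ (here refl)))
        ; keep = λ ne n j → subst (λ k → In _ (k ++ free c ++ bs ++ gs)) eq (detach-keep c ne n j) }

      key-new : (s : Step ps z) → key (attach (Step.Q s) (Step.adj s)) ∉ L
      key-new s = subst (_∉ L) (sym (attach-key (Step.Q s) (Step.adj s))) z∉L

      in-own : Pieces Q z → Fixed (length gs + 2 * suc (length bs)) ps
      in-own c with one-or-none (kept c) (kept≤1 c)
      -- Without a kept piece `z` would be the bad end itself, but that end lies in `L` and `z` does
      -- not.
      ... | inj₁ em = contradiction (kept-[] c em) (z≢ QL)
      ... | inj₂ (K , eq) = finish s bs (attach (Step.Q s) (Step.adj s) ∷ free c ++ gs) le
                (Permₚ.shifts (attach (Step.Q s) (Step.adj s) ∷ free c) bs)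
                (key-new s ∷ Allₚ.++⁺ (free-far (here refl) c) far)
                (size-++ (free c) gs (length bs) (free≤1 c))
        where
        s = own c eq

      in-bs : ∀ {P os} → P ∈ bs → bs ↭ P ∷ os → Pieces P z → Fixed (length gs + 2 * suc (length bs)) ps
      in-bs {P} {os} j perm c = finish s (kept c ++ os) (attach (Step.Q s) (Step.adj s) ∷ free c ++ gs) (≤-trans kept-len le)
                (solve 5 (λ a k f o g → a ⊕ k ⊕ f ⊕ o ⊕ g ⊜ (k ⊕ o) ⊕ a ⊕ f ⊕ g) ↭-refl
                  [ attach (Step.Q s) (Step.adj s) ] (kept c) (free c) os gs)
                (key-new s ∷ Allₚ.++⁺ (free-far P∈ c) far)
                (≤-trans (ℕₚ.+-monoʳ-≤ (suc (length (free c ++ gs))) (ℕₚ.*-monoʳ-≤ 2 kept-len))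
                  (size-++ (free c) gs (length bs) (free≤1 c)))
        where
        open ↭-Solver
        P∈ : P ∈ ps
        P∈ = there (∈-++⁺ˡ j)
        s = elsewhere P∈ c (↭-trans (prep Q (Permₚ.++⁺ʳ gs perm)) (swap Q P ↭-refl))
        kept-len : length (kept c ++ os) ≤ length bs
        kept-len = ≤-trans (≤-reflexive (Lₚ.length-++ (kept c)))
          (≤-trans (ℕₚ.+-monoˡ-≤ (length os) (kept≤1 c)) (≤-reflexive (sym (Permₚ.↭-length perm))))

      in-gs : ∀ {P os} → P ∈ gs → gs ↭ P ∷ os → Pieces P z → Fixed (length gs + 2 * suc (length bs)) ps
      in-gs {P} {os} j perm c = finish s bs (attach (Step.Q s) (Step.adj s) ∷ kept c ++ free c ++ os) le
                (solve 5 (λ a k f b o → a ⊕ k ⊕ f ⊕ b ⊕ o ⊜ b ⊕ a ⊕ k ⊕ f ⊕ o) ↭-refl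
                  [ attach (Step.Q s) (Step.adj s) ] (kept c) (free c) bs os)
                (key-new s ∷ Allₚ.++⁺ (All.map (λ (eq , _) → subst (_∉ L) (sym eq) (All.lookup far j)) (kept-spec c))
                  (Allₚ.++⁺ (free-far P∈ c) (All.tail (Permₚ.All-resp-↭ perm far))))
                (≤-trans (ℕₚ.+-monoˡ-≤ (2 * length bs) len) (step-size (length gs) (length bs) 2 ≤-refl))
        where
        open ↭-Solver
        P∈ : P ∈ ps
        P∈ = there (∈-++⁺ʳ bs j)
        s = elsewhere P∈ c (↭-trans (prep Q (↭-trans (Permₚ.++⁺ˡ bs perm) (Permₚ.shift P bs os))) (swap Q P ↭-refl))
        len : suc (length (kept c ++ free c ++ os)) ≤ 2 + length gs
        len = s≤s (≤-trans (≤-reflexive (trans (Lₚ.length-++ (kept c)) (cong (length (kept c) +_) (Lₚ.length-++ (free c)))))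
          (≤-trans (ℕₚ.+-mono-≤ (kept≤1 c) (ℕₚ.+-monoˡ-≤ (length os) (free≤1 c)))
            (≤-reflexive (cong suc (sym (Permₚ.↭-length perm))))))

      unused : z ∉ verts ps → Fixed (length gs + 2 * suc (length bs)) ps
      unused n = finish (record { Q = Q ; rest = bs ++ gs ; adj = e ; vs = inj₂ (n , ↭-refl) ; oks = ok ; keep = λ _ _ i → i })
          bs (attach Q e ∷ gs) le
          (↭-sym (Permₚ.shift (attach Q e) bs gs)) (subst (_∉ L) (sym (attach-key Q e)) z∉L ∷ far)
          (step-size (length gs) (length bs) 1 (s≤s z≤n))

      go : Fixed (length gs + 2 * suc (length bs)) ps
      go with z ∈? verts ps
      ... | no n = unused n
      ... | yes i with ∈-concatMap⁻′ body ps i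
      ...   | P , here refl , zP = in-own (cut P zP)
      ...   | P , there j , zP with ∈-++⁻ bs j
      ...     | inj₁ k = in-bs k (proj₂ (∈-↭∷ k)) (cut P zP)
      ...     | inj₂ k = in-gs k (proj₂ (∈-↭∷ k)) (cut P zP)

-- A gap is a piece of a path that can host a foreign path, entered from any suitable exit and left
-- towards any suitable entry; the vertices skipped in this way are absorbed by covers, that is, they
-- are put between the ends of a reserved arc.
record Gap (V : Set) : Set where
  constructor gap
  field
    exits middle entries : List V

  vertices : List V
  vertices = exits ++ middle ++ entries

record Cover (V : Set) : Set where
  constructor cover
  field
    {from at to} : V

  edge : List V
  edge = from ∷ to ∷ []

unique-blocks : ∀ {A B : Set} (f : B → List A) {bs b c v} → Unique (concatMap f bs) → b ∈ bs → c ∈ bs →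
  v ∈ f b → v ∈ f c → b ≡ c
unique-blocks f u (here refl) (here refl) i j = refl
unique-blocks f {b ∷ bs} u (here refl) (there q) i j =
  ⊥-elim (unique-++-disjoint (f b) u (i , ∈-concatMap⁺′ f q j))
unique-blocks f {b ∷ bs} u (there p) (here refl) i j =
  ⊥-elim (unique-++-disjoint (f b) u (j , ∈-concatMap⁺′ f p i))
unique-blocks f {b ∷ bs} u (there p) (there q) i j = unique-blocks f (unique-++ʳ (f b) u) p q i j

-- Covering a vertex set by few disjoint paths

module Covering {V : Set} (_≟_ : (x y : V) → Dec (x ≡ y)) (D : V → V → Set)
  (s : ℕ) (miss : V → List V) (miss≤ : ∀ v → length (miss v) ≤ s)
  (adjacent : ∀ u v → u ≢ v → v ∉ miss u → D u v ⊎ D v u) where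

  open Eq _≟_
  open System _≟_ D

  -- The insertion argument that gives Hamilton paths in tournaments, as `v` is adjacent to every
  -- vertex of `l`. The last component lets the recursion know which vertex the arc from `u` has to
  -- reach.
  insert : ∀ {u w l} v → Path D u w l → v ∉ l → Disjoint l (miss v) →
    ∃₂ λ u′ w′ → ∃ λ l′ → Path D u′ w′ l′ × l′ ↭ v ∷ l × (u′ ≡ v ⊎ u′ ≡ u)
  insert v (point u) n d with adjacent v u (λ e → n (here e)) (λ i → d (here refl , i))
  ... | inj₁ e = _ , _ , _ , e ◅ point u , ↭-refl , inj₁ refl
  ... | inj₂ e = _ , _ , _ , e ◅ point v , swap u v ↭-refl , inj₂ refl
  insert v (_◅_ {u} e p) n d with adjacent v u (λ e → n (here e)) (λ i → d (here refl , i))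
  ... | inj₁ f = _ , _ , _ , f ◅ e ◅ p , ↭-refl , inj₁ refl
  ... | inj₂ f with insert v p (n ∘ there) (λ (i , j) → d (there i , j))
  ...   | _ , _ , _ , q , perm , inj₁ refl = _ , _ , _ , f ◅ q , ↭-trans (prep u perm) (swap u v ↭-refl) , inj₂ refl
  ...   | _ , _ , _ , q , perm , inj₂ refl = _ , _ , _ , e ◅ q , ↭-trans (prep u perm) (swap u v ↭-refl) , inj₂ refl

  -- If there are more paths than vertices missed by `x`, some path contains none of the latter and
  -- takes `x` in. Otherwise there are at most `s` paths and `x` becomes a path of its own.
  cover-all : ∀ xs → Unique xs → ∃ λ ps → length ps ≤ suc s × verts ps ↭ xs
  cover-all [] u = [] , z≤n , ↭-refl
  cover-all (x ∷ xs) u with cover-all xs (unique-tail u)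
  ... | ps , le , perm with length (miss x) <? length ps
  ...   | no n = seg (point x) ∷ ps , s≤s (≤-trans (ℕₚ.≮⇒≥ n) (miss≤ x)) , prep x perm
  ...   | yes lt with disjoint-block body ps (miss x) (Unique-resp-↭ (↭-sym perm) (unique-tail u)) lt
  ...     | P , i , d with ∈-↭∷ i
  ...       | os , perm′ with insert x (path P) (λ j → unique-head u (↭-∈ perm (∈-concatMap⁺′ body i j))) d
  ...         | _ , _ , _ , q , perm″ , _ = seg q ∷ os , ≤-trans (≤-reflexive (sym (Permₚ.↭-length perm′))) le
    , ↭-trans (Permₚ.++⁺ʳ (verts os) perm″) (prep x (↭-trans (↭-sym (concatMap-↭ body perm′)) perm))

-- Merging disjoint paths into one cycle through the gaps

record MergeData : Set₁ where
  field
    V : Set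
    _≟_ : (x y : V) → Dec (x ≡ y)
    T D : V → V → Set
    Γ : List (Gap V)
    covs : List (Cover V)
    r : ℕ
    outMiss inMiss : V → List V
    outMiss≤ : ∀ v → length (outMiss v) ≤ r
    inMiss≤ : ∀ v → length (inMiss v) ≤ r
    out-arc : ∀ {u v} → T u v → v ∉ outMiss u → D u v
    in-arc : ∀ {u v} → T u v → u ∉ inMiss v → D u v
    cov-unique : Unique (concatMap Cover.edge covs)
    cov-gap : ∀ {c γ} → c ∈ covs → γ ∈ Γ → Disjoint (Gap.vertices γ) (Cover.edge c)
    cov-arcs : ∀ {c} → c ∈ covs → D (Cover.from c) (Cover.at c) × D (Cover.at c) (Cover.to c)
    gap-middle : ∀ {γ} → γ ∈ Γ → Gap.middle γ ≢ []
    covered : ∀ {γ v} → γ ∈ Γ → v ∈ Gap.vertices γ → ∃ λ c → c ∈ covs × Cover.at c ≡ v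

module Merging (merging : MergeData) where

  open MergeData merging

  open Eq _≟_
  open System _≟_ D
  open Gap
  open Cover

  -- Stated with arcs of `T`, so that being good does not depend on the cycles chosen before. The
  -- arcs that `D` lacks are dealt with separately, by using only gaps that avoid the `blockers` of
  -- a path.
  GoodOut GoodIn : V → Set
  GoodOut x = ∀ {γ} → γ ∈ Γ → ∃ λ a → a ∈ entries γ × T x a
  GoodIn z = ∀ {γ} → γ ∈ Γ → ∃ λ b → b ∈ exits γ × T b z

  Nice : Seg → Set
  Nice P = GoodIn (start P) × GoodOut (end P)

  blockers : Seg → List V
  blockers P = outMiss (end P) ++ inMiss (start P)

  length-blockers : ∀ P → length (blockers P) ≤ r + r
  length-blockers P = ≤-trans (≤-reflexive (Lₚ.length-++ (outMiss (end P)))) (ℕₚ.+-mono-≤ (outMiss≤ _) (inMiss≤ _))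

  leave-entry : ∀ {γ x F} → γ ∈ Γ → GoodOut x → Disjoint (vertices γ) F → outMiss x ⊆ F → ∃ λ a → a ∈ entries γ × D x a
  leave-entry {γ} i g d s with g i
  ... | a , j , t = a , j , out-arc t (λ k → d (∈-++⁺ʳ (exits γ) (∈-++⁺ʳ (middle γ) j) , s k))

  exit-enter : ∀ {γ z F} → γ ∈ Γ → GoodIn z → Disjoint (vertices γ) F → inMiss z ⊆ F → ∃ λ b → b ∈ exits γ × D b z
  exit-enter {γ} i g d s with g i
  ... | b , j , t = b , j , in-arc t (λ k → d (∈-++⁺ˡ j , s k))

  record Merged (γ : Gap V) (P Q : Seg) : Set where
    constructor merged
    field
      result : Seg
      start≡ : start result ≡ start P
      end≡ : end result ≡ end P
      left : List V
      left⊆ : left ⊆ vertices γ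
      bodies : body result ++ left ↭ body P ++ body Q
      keep : ∀ {I} → I ≢ [] → Disjoint (vertices γ) I → Infix I (body P) ⊎ Infix I (body Q) → Infix I (body result)

  -- The gap is opened between the exit `b` and the entry `a`, and `Q` takes the place of what lies
  -- between them; the vertices displaced in this way form `left`.
  merge : ∀ {γ} P Q → Infix (vertices γ) (body P) → (∃ λ b → b ∈ exits γ × D b (start Q)) →
    (∃ λ a → a ∈ entries γ × D (end Q) a) → Merged γ P Q
  merge P@(record { path = p }) Q (l₁ , l₂ , refl) (b , i , e) (a , j , f) with ∈-∃++ i | ∈-∃++ j
  merge {gap _ m _} P@(record { start = u ; end = v
      ; path = p }) Q (l₁ , l₂ , refl) (b , i , e) (a , j , f) | b₁ , b₂ , refl | a₁ , a₂ , refl = record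
    { result = seg (path-++ front e (path-++ (path Q) f back))
    ; start≡ = refl ; end≡ = refl
    ; left = b₂ ++ m ++ a₁
    ; left⊆ = left⊆′
    ; bodies = solve 10 (λ l₁ b₁ b b₂ m a₁ a a₂ l₂ q →
        (((l₁ ⊕ b₁) ⊕ b) ⊕ q ⊕ a ⊕ a₂ ⊕ l₂) ⊕ (b₂ ⊕ m ⊕ a₁) ⊜
        (l₁ ⊕ ((b₁ ⊕ b ⊕ b₂) ⊕ m ⊕ a₁ ⊕ a ⊕ a₂) ⊕ l₂) ⊕ q)
        ↭-refl l₁ b₁ [ b ] b₂ m a₁ [ a ] a₂ l₂ (body Q)
    ; keep = keep′ }
    where
    open ↭-Solver
    eq₁ : l₁ ++ ((b₁ ++ b ∷ b₂) ++ m ++ (a₁ ++ a ∷ a₂)) ++ l₂ ≡ (l₁ ++ b₁) ++ b ∷ (b₂ ++ m ++ a₁ ++ a ∷ a₂ ++ l₂)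
    eq₁ = S.solve 9 (λ l₁ b₁ b b₂ m a₁ a a₂ l₂ → l₁ S.⊕ ((b₁ S.⊕ b S.⊕ b₂) S.⊕ m S.⊕ a₁ S.⊕ a S.⊕ a₂) S.⊕ l₂ S.⊜
        (l₁ S.⊕ b₁) S.⊕ b S.⊕ b₂ S.⊕ m S.⊕ a₁ S.⊕ a S.⊕ a₂ S.⊕ l₂) refl l₁ b₁ [ b ] b₂ m a₁ [ a ] a₂ l₂
      where module S = ++-Solver
    eq₂ : l₁ ++ ((b₁ ++ b ∷ b₂) ++ m ++ (a₁ ++ a ∷ a₂)) ++ l₂ ≡ (l₁ ++ b₁ ++ b ∷ b₂ ++ m ++ a₁) ++ a ∷ (a₂ ++ l₂)
    eq₂ = S.solve 9 (λ l₁ b₁ b b₂ m a₁ a a₂ l₂ → l₁ S.⊕ ((b₁ S.⊕ b S.⊕ b₂) S.⊕ m S.⊕ a₁ S.⊕ a S.⊕ a₂) S.⊕ l₂ S.⊜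
        (l₁ S.⊕ b₁ S.⊕ b S.⊕ b₂ S.⊕ m S.⊕ a₁) S.⊕ a S.⊕ a₂ S.⊕ l₂) refl l₁ b₁ [ b ] b₂ m a₁ [ a ] a₂ l₂
      where module S = ++-Solver
    front : Path D u b ((l₁ ++ b₁) ++ [ b ])
    front = path-upto (l₁ ++ b₁) (subst (Path D u v) eq₁ p)
    back : Path D a v (a ∷ a₂ ++ l₂)
    back = path-from (l₁ ++ b₁ ++ b ∷ b₂ ++ m ++ a₁) (subst (Path D u v) eq₂ p)
    left⊆′ : b₂ ++ m ++ a₁ ⊆ (b₁ ++ b ∷ b₂) ++ m ++ (a₁ ++ a ∷ a₂)
    left⊆′ k with ∈-++⁻ b₂ k
    ... | inj₁ k₁ = ∈-++⁺ˡ (∈-++⁺ʳ b₁ (there k₁))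
    ... | inj₂ k₂ with ∈-++⁻ m k₂
    ...   | inj₁ k₃ = ∈-++⁺ʳ (b₁ ++ b ∷ b₂) (∈-++⁺ˡ k₃)
    ...   | inj₂ k₃ = ∈-++⁺ʳ (b₁ ++ b ∷ b₂) (∈-++⁺ʳ m (∈-++⁺ˡ k₃))
    nonempty : ∀ c → (c ++ b ∷ b₂) ++ m ++ (a₁ ++ a ∷ a₂) ≢ []
    nonempty [] ()
    nonempty (_ ∷ _) ()
    keep′ : ∀ {I} → I ≢ [] → Disjoint ((b₁ ++ b ∷ b₂) ++ m ++ (a₁ ++ a ∷ a₂)) I →
      Infix I (l₁ ++ ((b₁ ++ b ∷ b₂) ++ m ++ (a₁ ++ a ∷ a₂)) ++ l₂) ⊎ Infix I (body Q) →
      Infix I (((l₁ ++ b₁) ++ [ b ]) ++ body Q ++ (a ∷ a₂ ++ l₂))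
    keep′ ne d (inj₂ i) = infix-++ˡ ((l₁ ++ b₁) ++ [ b ]) (infix-++ʳ _ i)
    keep′ ne d (inj₁ i) with infix-splitG l₁ ((b₁ ++ b ∷ b₂) ++ m ++ (a₁ ++ a ∷ a₂)) i d ne (nonempty b₁)
    ... | inj₁ k = infix-++ʳ _ (infix-++ʳ [ b ] (infix-++ʳ b₁ k))
    ... | inj₂ k = infix-++ˡ ((l₁ ++ b₁) ++ [ b ]) (infix-++ˡ (body Q) (infix-++ˡ (a ∷ a₂) k))

  vertices-nonempty : ∀ {γ} → γ ∈ Γ → vertices γ ≢ []
  vertices-nonempty {γ} i e = gap-middle i (Lₚ.++-conicalˡ (middle γ) _ (Lₚ.++-conicalʳ (exits γ) _ e))

  -- `U` collects the gap vertices skipped so far, `Γ′` the gaps still intact. Intact gaps and the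
  -- arcs of covers share no vertex with a gap being used up, which is why both stay contiguous.
  record State (W : List V) (ps : List Seg) (U : List V) (Γ′ : List (Gap V)) : Set where
    field
      all : verts ps ++ U ↭ W
      left : ∀ {u} → u ∈ U → ∃ λ γ → γ ∈ Γ × u ∈ vertices γ
      nice : All Nice ps
      active : Γ′ ⊆ Γ
      active-unique : Unique (concatMap vertices Γ′)
      gaps : ∀ {γ} → γ ∈ Γ′ → In (vertices γ) ps
      edges : ∀ {c} → c ∈ covs → In (edge c) ps

  State-↭ : ∀ {W ps qs U Γ₁ Γ₂} → ps ↭ qs → Γ₁ ↭ Γ₂ → State W ps U Γ₁ → State W qs U Γ₂
  State-↭ p q s = record
    { all = ↭-trans (Permₚ.++⁺ʳ _ (concatMap-↭ body (↭-sym p))) all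
    ; left = left
    ; nice = Permₚ.All-resp-↭ p nice
    ; active = active ∘ ↭-∈ (↭-sym q)
    ; active-unique = Unique-resp-↭ (concatMap-↭ vertices q) active-unique
    ; gaps = λ i → In-⊆ (↭-∈ p) (gaps (↭-∈ (↭-sym q) i))
    ; edges = λ i → In-⊆ (↭-∈ p) (edges i) }
    where open State s

  merge-step : ∀ {W X Y os U γ Γ′} → State W (X ∷ Y ∷ os) U (γ ∷ Γ′) → Infix (vertices γ) (body X) →
    Disjoint (vertices γ) (blockers Y) → ∃₂ λ R U′ → State W (R ∷ os) U′ Γ′
  merge-step {W} {X} {Y} {os} {U} {γ} {Γ′} s i d with merge X Y i
      (exit-enter γ∈ (proj₁ niceY) d (∈-++⁺ʳ (outMiss (end Y))))
      (leave-entry γ∈ (proj₂ niceY) d ∈-++⁺ˡ)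
    where
    γ∈ = State.active s (here refl)
    niceY = All.head (All.tail (State.nice s))
  ... | merged R refl refl lo lo⊆ bodies keep = R , lo ++ U , record
    { all = ↭-trans (solve 4 (λ r o l u → (r ⊕ o) ⊕ l ⊕ u ⊜ (r ⊕ l) ⊕ o ⊕ u) ↭-refl (body R) (verts os) lo U)
        (↭-trans (Permₚ.++⁺ʳ _ bodies)
          (↭-trans (solve 4 (λ x y o u → (x ⊕ y) ⊕ o ⊕ u ⊜ (x ⊕ y ⊕ o) ⊕ u) ↭-refl (body X) (body Y) (verts os) U) all))
    ; left = λ j → [ (λ k → γ , active (here refl) , lo⊆ k) , left ]′ (∈-++⁻ lo j)
    ; nice = niceR ∷ All.tail (All.tail nice)
    ; active = active ∘ there
    ; active-unique = unique-++ʳ (vertices γ) active-unique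
    ; gaps = λ j → move (vertices-nonempty (active (there j)))
        (λ (a , b) → unique-++-disjoint (vertices γ) active-unique (a , ∈-concatMap⁺′ vertices j b)) (gaps (there j))
    ; edges = λ j → move (λ ()) (cov-gap j (active (here refl))) (edges j) }
    where
    open State s
    open ↭-Solver
    niceR : Nice R
    niceR = proj₁ (All.head nice) , proj₂ (All.head nice)
    move : ∀ {I} → I ≢ [] → Disjoint (vertices γ) I → In I (X ∷ Y ∷ os) → In I (R ∷ os)
    move ne d (_ , here refl , j) = R , here refl , keep ne d (inj₁ j)
    move ne d (_ , there (here refl) , j) = R , here refl , keep ne d (inj₂ j)
    move ne d (Z , there (there k) , j) = Z , there k , j

  length-blockers₂ : ∀ P Q {k} → suc (r + r + (r + r)) ≤ k → length (blockers P ++ blockers Q) < k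
  length-blockers₂ P Q le = ≤-trans (s≤s (≤-trans (≤-reflexive (Lₚ.length-++ (blockers P)))
    (ℕₚ.+-mono-≤ (length-blockers P) (length-blockers Q)))) le

  -- The gap is chosen unspoilt for both `P` and `Q`, since it is not known in advance which path
  -- contains it: one of the two is not the host and can be merged into it. Each merge uses up one
  -- gap, and 4`r` + 2 of them are saved for closing the cycle.
  merge-all : ∀ {W U Γ′} N P ps → State W (P ∷ ps) U Γ′ → length ps ≤ N → N + suc (suc (r + r + (r + r))) ≤ length Γ′ →
    ∃₂ λ R U′ → ∃ λ Γ″ → State W (R ∷ []) U′ Γ″ × suc (suc (r + r + (r + r))) ≤ length Γ″
  merge-all N P [] s le le′ = P , _ , _ , s , ≤-trans (ℕₚ.m≤n+m _ N) le′
  merge-all {W} {U} {Γ′} (suc N) P (Q ∷ ps) s (s≤s le) le′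
    with disjoint-block vertices Γ′ (blockers P ++ blockers Q) (State.active-unique s)
           (length-blockers₂ P Q (≤-trans (ℕₚ.m≤n+m _ (suc (suc N))) (≤-trans (≤-reflexive (cong suc (sym (ℕₚ.+-suc N _)))) le′)))
  ... | γ , i , d with ∈-↭∷ i
  ...   | Γ″ , perm = go (State.gaps s i)
    where
    room : N + suc (suc (r + r + (r + r))) ≤ length Γ″
    room = ℕₚ.≤-pred (≤-trans le′ (≤-reflexive (Permₚ.↭-length perm)))
    continue : ∀ {X Y os} → P ∷ Q ∷ ps ↭ X ∷ Y ∷ os → Infix (vertices γ) (body X) →
      Disjoint (vertices γ) (blockers Y) → length os ≤ N →
      ∃₂ λ R U′ → ∃ λ Γ″ → State W (R ∷ []) U′ Γ″ × suc (suc (r + r + (r + r))) ≤ length Γ″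
    continue perm′ j d′ le″ with merge-step (State-↭ perm′ perm s) j d′
    ... | R , _ , s′ = merge-all N R _ s′ le″ room
    go : In (vertices γ) (P ∷ Q ∷ ps) →
      ∃₂ λ R U′ → ∃ λ Γ″ → State W (R ∷ []) U′ Γ″ × suc (suc (r + r + (r + r))) ≤ length Γ″
    go (_ , here refl , j) = continue ↭-refl j (λ (a , b) → d (a , ∈-++⁺ʳ (blockers P) b)) le
    go (_ , there (here refl) , j) = continue (swap P Q ↭-refl) j (λ (a , b) → d (a , ∈-++⁺ˡ b)) le
    go (X , there (there k) , j) with ∈-↭∷ k
    ... | os , perm′ = continue
      (↭-trans (prep P (prep Q perm′)) (↭-trans (prep P (swap Q X ↭-refl)) (swap P X ↭-refl)))
      j (λ (a , b) → d (a , ∈-++⁺ˡ b)) (≤-trans (≤-reflexive (sym (Permₚ.↭-length perm′))) le)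

  record Cycle (W U : List V) : Set where
    constructor cycle
    field
      ring : Seg
      closing : D (end ring) (start ring)
      all : body ring ++ U ↭ W
      left : ∀ {u} → u ∈ U → ∃ λ γ → γ ∈ Γ × u ∈ vertices γ
      edges : ∀ {c} → c ∈ covs → Infix (edge c) (body ring)

  snoc : ∀ {m : List V} → m ≢ [] → ∃₂ λ m′ e → m ≡ m′ ++ [ e ]
  snoc {[]} ne = contradiction refl ne
  snoc {x ∷ []} ne = [] , x , refl
  snoc {x ∷ y ∷ m} ne with snoc {y ∷ m} (λ ())
  ... | m′ , e , eq = x ∷ m′ , e , cong (x ∷_) eq

  module _ (middle-good : ∀ {γ v} → γ ∈ Γ → v ∈ middle γ → GoodIn v × GoodOut v) where

    -- The arc from `x` to `a` closes the part of the path from `a` to `x` into a cycle, and the arc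
    -- from `b` to `z` closes the part from `z` to `b`. A second gap lies on one of these cycles,
    -- which then hosts the opposite part of the path, prolonged through the middle of `γ`. That
    -- part has one end in the middle, so middles have to be nonempty and consist of good vertices.
    close-core : ∀ {W U Γ″ z x} l₁ b₁ {b} b₂ m′ {e} a₁ {a} a₂ l₂ →
      let γ = gap (b₁ ++ b ∷ b₂) (m′ ++ [ e ]) (a₁ ++ a ∷ a₂) in
      (p : Path D z x (l₁ ++ vertices γ ++ l₂)) → State W (seg p ∷ []) U (γ ∷ Γ″) → D x a → D b z →
      suc (r + r + (r + r)) ≤ length Γ″ → ∃ λ U′ → Cycle W U′
    close-core {W} {U} {Γ″} {z} {x} l₁ b₁ {b} b₂ m′ {e} a₁ {a} a₂ l₂ p s x→a b→z le = go
      where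
      open State s
      open ↭-Solver
      module S = ++-Solver
      B = b₁ ++ b ∷ b₂
      m = m′ ++ [ e ]
      A = a₁ ++ a ∷ a₂
      γ = gap B m A
      γ∈ = active (here refl)

      C₁ Q₁ C₂ : Seg
      C₁ = seg (path-from (l₁ ++ B ++ m ++ a₁) {a} {a₂ ++ l₂} (subst (Path D z x)
        (S.solve 6 (λ l₁ b m a₁ a l₂ → l₁ S.⊕ (b S.⊕ m S.⊕ a₁ S.⊕ a) S.⊕ l₂ S.⊜ (l₁ S.⊕ b S.⊕ m S.⊕ a₁) S.⊕ a S.⊕ l₂)
          refl l₁ B m a₁ (a ∷ a₂) l₂) p))
      Q₁ = seg (path-upto (l₁ ++ B ++ m′) {e} {A ++ l₂} (subst (Path D z x)
        (S.solve 6 (λ l₁ b m e a l₂ → l₁ S.⊕ (b S.⊕ (m S.⊕ e) S.⊕ a) S.⊕ l₂ S.⊜ (l₁ S.⊕ b S.⊕ m) S.⊕ e S.⊕ a S.⊕ l₂)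
          refl l₁ B m′ [ e ] A l₂) p))
      C₂ = seg (path-upto (l₁ ++ b₁) {b} {b₂ ++ m ++ A ++ l₂} (subst (Path D z x)
        (S.solve 7 (λ l₁ b₁ b b₂ m a l₂ → l₁ S.⊕ ((b₁ S.⊕ b S.⊕ b₂) S.⊕ m S.⊕ a) S.⊕ l₂ S.⊜
          (l₁ S.⊕ b₁) S.⊕ b S.⊕ b₂ S.⊕ m S.⊕ a S.⊕ l₂) refl l₁ b₁ [ b ] b₂ m A l₂) p))

      head-of : ∀ m′ → ∃₂ λ h t → m′ ++ [ e ] ≡ h ∷ t
      head-of [] = e , [] , refl
      head-of (h ∷ t) = h , t ++ [ e ] , refl
      h = proj₁ (head-of m′)
      t = proj₁ (proj₂ (head-of m′))
      m≡ : m ≡ h ∷ t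
      m≡ = proj₂ (proj₂ (head-of m′))

      Q₂ : Seg
      Q₂ = seg (path-from (l₁ ++ B) {h} {t ++ A ++ l₂} (subst (Path D z x)
        (trans (S.solve 5 (λ l₁ b m a l₂ → l₁ S.⊕ (b S.⊕ m S.⊕ a) S.⊕ l₂ S.⊜ (l₁ S.⊕ b) S.⊕ m S.⊕ a S.⊕ l₂)
          refl l₁ B m A l₂) (cong (λ m → (l₁ ++ B) ++ m ++ A ++ l₂) m≡)) p))

      h∈ : h ∈ m
      h∈ = subst (h ∈_) (sym m≡) (here refl)
      e∈ : e ∈ m
      e∈ = ∈-++⁺ʳ m′ (here refl)

      whole : l₁ ++ vertices γ ++ l₂ ++ U ↭ W
      whole = ↭-trans (solve 4 (λ l g k u → l ⊕ g ⊕ k ⊕ u ⊜ ((l ⊕ g ⊕ k)) ⊕ u) ↭-refl l₁ (vertices γ) l₂ U)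
        (↭-trans (Permₚ.++⁺ʳ U (↭-reflexive (sym (Lₚ.++-identityʳ (l₁ ++ vertices γ ++ l₂))))) all)

      lefts : ∀ lo {γ′} xs → γ′ ∈ Γ → lo ⊆ vertices γ′ → xs ⊆ vertices γ →
        ∀ {u} → u ∈ lo ++ xs ++ U → ∃ λ γ → γ ∈ Γ × u ∈ vertices γ
      lefts lo xs γ′∈ lo⊆ xs⊆ i with ∈-++⁻ lo i
      ... | inj₁ j = _ , γ′∈ , lo⊆ j
      ... | inj₂ j with ∈-++⁻ xs j
      ...   | inj₁ k = γ , γ∈ , xs⊆ k
      ...   | inj₂ k = left k

      sides : ∀ {I} → I ≢ [] → Disjoint (vertices γ) I → In I (seg p ∷ []) → Infix I l₁ ⊎ Infix I l₂
      sides ne d (_ , here refl , i) = infix-splitG l₁ (vertices γ) i d ne (vertices-nonempty γ∈)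

      nice-p = All.head nice

      after : ∀ {γ′} → γ′ ∈ Γ″ → Disjoint (vertices γ′) (blockers Q₁) → Infix (vertices γ′) l₂ → ∃ λ U′ → Cycle W U′
      after {γ′} i d j with merge {γ′} C₁ Q₁ (infix-++ˡ (a ∷ a₂) j)
          (exit-enter (active (there i)) (proj₁ nice-p) d (∈-++⁺ʳ (outMiss e)))
          (leave-entry (active (there i)) (proj₂ (middle-good γ∈ e∈)) d ∈-++⁺ˡ)
      ... | merged R refl refl lo lo⊆ bodies keep = lo ++ a₁ ++ U , record
        { ring = R ; closing = x→a
        ; all = ↭-trans (solve 4 (λ r l a u → r ⊕ l ⊕ a ⊕ u ⊜ (r ⊕ l) ⊕ a ⊕ u) ↭-refl (body R) lo a₁ U)
            (↭-trans (Permₚ.++⁺ʳ (a₁ ++ U) bodies)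
              (↭-trans (solve 9 (λ a₁ a a₂ l₂ l₁ b m e u →
                 ((a ⊕ a₂ ⊕ l₂) ⊕ (l₁ ⊕ b ⊕ m) ⊕ e) ⊕ a₁ ⊕ u ⊜ l₁ ⊕ (b ⊕ (m ⊕ e) ⊕ a₁ ⊕ a ⊕ a₂) ⊕ l₂ ⊕ u) ↭-refl
                 a₁ [ a ] a₂ l₂ l₁ B m′ [ e ] U) whole))
        ; left = lefts lo a₁ (active (there i)) lo⊆ (∈-++⁺ʳ B ∘ ∈-++⁺ʳ m ∘ ∈-++⁺ˡ)
        ; edges = λ k → keep (λ ()) (cov-gap k (active (there i)))
            ([ inj₂ ∘ infix-++ʳ [ e ] ∘ infix-++ʳ (B ++ m′) , inj₁ ∘ infix-++ˡ (a ∷ a₂) ]′ (sides (λ ()) (cov-gap k γ∈) (edges k))) }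

      before : ∀ {γ′} → γ′ ∈ Γ″ → Disjoint (vertices γ′) (blockers Q₂) → Infix (vertices γ′) l₁ → ∃ λ U′ → Cycle W U′
      before {γ′} i d j with merge {γ′} C₂ Q₂ (infix-++ʳ [ b ] (infix-++ʳ b₁ j))
          (exit-enter (active (there i)) (proj₁ (middle-good γ∈ h∈)) d (∈-++⁺ʳ (outMiss x)))
          (leave-entry (active (there i)) (proj₂ nice-p) d ∈-++⁺ˡ)
      ... | merged R refl refl lo lo⊆ bodies keep = lo ++ b₂ ++ U , record
        { ring = R ; closing = b→z
        ; all = ↭-trans (solve 4 (λ r l a u → r ⊕ l ⊕ a ⊕ u ⊜ (r ⊕ l) ⊕ a ⊕ u) ↭-refl (body R) lo b₂ U)
            (↭-trans (Permₚ.++⁺ʳ (b₂ ++ U) bodies)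
              (↭-trans (Permₚ.++⁺ʳ (b₂ ++ U) (Permₚ.++⁺ˡ ((l₁ ++ b₁) ++ [ b ])
                (↭-reflexive (cong (_++ A ++ l₂) (sym m≡)))))
              (↭-trans (solve 8 (λ l₁ b₁ b b₂ m a l₂ u →
                 (((l₁ ⊕ b₁) ⊕ b) ⊕ m ⊕ a ⊕ l₂) ⊕ b₂ ⊕ u ⊜ l₁ ⊕ ((b₁ ⊕ b ⊕ b₂) ⊕ m ⊕ a) ⊕ l₂ ⊕ u) ↭-refl
                 l₁ b₁ [ b ] b₂ m A l₂ U) whole)))
        ; left = lefts lo b₂ (active (there i)) lo⊆ (λ q → ∈-++⁺ˡ (∈-++⁺ʳ b₁ (there q)))
        ; edges = λ k → keep (λ ()) (cov-gap k (active (there i)))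
            ([ inj₁ ∘ infix-++ʳ [ b ] ∘ infix-++ʳ b₁ , inj₂ ∘ infix-++ˡ (h ∷ t) ∘ infix-++ˡ A ]′
              (sides (λ ()) (cov-gap k γ∈) (edges k))) }

      go : ∃ λ U′ → Cycle W U′
      go with disjoint-block vertices Γ″ (blockers Q₁ ++ blockers Q₂) (unique-++ʳ (vertices γ) active-unique)
                (length-blockers₂ Q₁ Q₂ le)
      ... | γ′ , i , d with sides (vertices-nonempty (active (there i)))
                (λ (u , v) → unique-++-disjoint (vertices γ) active-unique (u , ∈-concatMap⁺′ vertices i v)) (gaps (there i))
      ...   | inj₁ j = before i (λ (u , v) → d (u , ∈-++⁺ʳ (blockers Q₁) v)) j
      ...   | inj₂ j = after i (λ (u , v) → d (u , ∈-++⁺ˡ v)) j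

    close : ∀ {W P U Γ′} → State W (P ∷ []) U Γ′ → suc (suc (r + r + (r + r))) ≤ length Γ′ → ∃ λ U′ → Cycle W U′
    close {W} {P@(seg p)} {U} {Γ′} s le
      with disjoint-block vertices Γ′ (blockers P) (State.active-unique s)
             (≤-trans (s≤s (length-blockers P)) (≤-trans (s≤s (ℕₚ.m≤n⇒m≤1+n (ℕₚ.m≤m+n (r + r) (r + r)))) le))
    ... | gap B m A , i , d with ∈-↭∷ i | State.gaps s i
    ...   | Γ″ , perm | _ , here refl , (l₁ , l₂ , refl)
      with leave-entry (State.active s i) (proj₂ (All.head (State.nice s))) d ∈-++⁺ˡ
         | exit-enter (State.active s i) (proj₁ (All.head (State.nice s))) d (∈-++⁺ʳ (outMiss (end P)))
         | snoc (gap-middle (State.active s i))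
    ... | a , a∈ , x→a | b , b∈ , b→z | m′ , e , refl with ∈-∃++ a∈ | ∈-∃++ b∈
    ...   | a₁ , a₂ , refl | b₁ , b₂ , refl = close-core l₁ b₁ b₂ m′ a₁ a₂ l₂ p (State-↭ ↭-refl perm s) x→a b→z
      (ℕₚ.≤-pred (≤-trans le (≤-reflexive (Permₚ.↭-length perm))))

  -- Arcs of different covers have no common vertex, so subdividing one of them leaves the others
  -- available.
  absorb-one : ∀ {c} (P : Seg) → c ∈ covs → Infix (edge c) (body P) →
    ∃ λ R → start R ≡ start P × end R ≡ end P × body R ↭ at c ∷ body P ×
      (∀ {c′} → c′ ∈ covs → at c′ ≢ at c → Infix (edge c′) (body P) → Infix (edge c′) (body R))
  absorb-one {cover {x} {v} {y}} P@(seg {u} {w} p) c∈ (l₁ , l₂ , refl) =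
    seg (path-++ (path-upto l₁ p) (proj₁ (cov-arcs c∈)) (proj₂ (cov-arcs c∈) ◅ back)) , refl , refl
    , solve 5 (λ l₁ x v y l₂ → (l₁ ⊕ x) ⊕ v ⊕ y ⊕ l₂ ⊜ v ⊕ l₁ ⊕ x ⊕ y ⊕ l₂) ↭-refl l₁ [ x ] [ v ] [ y ] l₂
    , λ {c′} c′∈ ne i → [ infix-++ʳ (v ∷ y ∷ l₂) ∘ infix-++ʳ [ x ] , infix-++ˡ (l₁ ++ [ x ]) ∘ infix-++ˡ (v ∷ y ∷ []) ]′
        (infix-splitG l₁ (x ∷ y ∷ []) i
          (λ (a , b) → ne (cong at (unique-blocks edge cov-unique c′∈ c∈ b a))) (λ ()) (λ ()))
    where
    open ↭-Solver
    back : Path D y w (y ∷ l₂)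
    back = path-from (l₁ ++ [ x ]) (subst (Path D u w) (sym (Lₚ.++-assoc l₁ [ x ] (y ∷ l₂))) p)

  absorb : ∀ U (P : Seg) → Unique U → (∀ {u} → u ∈ U → ∃ λ c → c ∈ covs × at c ≡ u) →
    (∀ {c} → c ∈ covs → at c ∈ U → Infix (edge c) (body P)) →
    ∃ λ R → start R ≡ start P × end R ≡ end P × body R ↭ body P ++ U
  absorb [] P uq cov inf = P , refl , refl , ↭-reflexive (sym (Lₚ.++-identityʳ (body P)))
  absorb (u ∷ U) P uq cov inf with cov (here refl)
  ... | c , c∈ , refl with absorb-one P c∈ (inf c∈ (here refl))
  ...   | R , refl , refl , perm , keep with absorb U R (unique-tail uq) (cov ∘ there)
            (λ c′∈ i → keep c′∈ (λ e → unique-head uq (subst (_∈ U) e i)) (inf c′∈ (there i)))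
  ...     | R′ , s≡ , e≡ , perm′ = R′ , s≡ , e≡
              , ↭-trans perm′ (↭-trans (Permₚ.++⁺ʳ U perm) (↭-sym (Permₚ.shift (at c) (body P) U)))

  finish : ∀ {W U} → Unique W → Cycle W U → ∃ λ (P : Seg) → D (end P) (start P) × body P ↭ W
  finish {W} {U} uq c with absorb U ring (unique-++ʳ (body ring) (Unique-resp-↭ (↭-sym all) uq))
      (λ i → let γ , γ∈ , j = left i in covered γ∈ j) (λ c∈ _ → edges c∈)
    where open Cycle c
  ... | R , s≡ , e≡ , perm = R , subst₂ D (sym e≡) (sym s≡) (Cycle.closing c) , ↭-trans perm (Cycle.all c)

unique⊆⊇⇒↭ : ∀ {A : Set} {xs ys : List A} → Unique xs → Unique ys → xs ⊆ ys → ys ⊆ xs → xs ↭ ys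
unique⊆⊇⇒↭ {xs = []} {[]} u w s t = ↭-refl
unique⊆⊇⇒↭ {xs = []} {y ∷ ys} u w s t with t (here refl)
... | ()
unique⊆⊇⇒↭ {xs = x ∷ xs} {ys} u w s t with ∈-↭∷ (s (here refl))
... | zs , perm = ↭-trans (prep x (unique⊆⊇⇒↭ (unique-tail u) (unique-tail w′)
    (λ i → other (↭-∈ perm (s (there i))) (λ { refl → unique-head u i }))
    (λ i → other (t (↭-∈ (↭-sym perm) (there i))) (λ { refl → unique-head w′ i })))) (↭-sym perm)
  where
  w′ : Unique (x ∷ zs)
  w′ = Unique-resp-↭ perm w
  other : ∀ {v l} → v ∈ x ∷ l → v ≢ x → v ∈ l
  other (here e) ne = contradiction e ne
  other (there i) ne = i

pick : ∀ {A : Set} (xs : List A) → 0 < length xs → ∃ λ x → x ∈ xs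
pick (x ∷ xs) _ = x , here refl

module PartCount where

  -- The number of paths left once every vertex is covered and all ends are good: every covering
  -- adds at most s + 1 paths, and every repair of ends at most doubles their number.
  abstract
    partCount : ℕ → ℕ
    partCount s = 2 * (2 * (2 * (2 * (1 + suc s)) + suc s)) + suc s

    ≤-partCount : ∀ s {a} → a ≤ 2 * (2 * (2 * (2 * (1 + suc s)) + suc s)) + suc s → a ≤ partCount s
    ≤-partCount s le = le

    partCount≡ : ∀ s → partCount s ≡ 21 * s + 37
    partCount≡ s = solve 1 (λ s → con 2 :* (con 2 :* (con 2 :* (con 2 :* (con 1 :+ (con 1 :+ s))) :+ (con 1 :+ s)))
      :+ (con 1 :+ s) := con 21 :* s :+ con 37) refl s
      where open +-*-Solver

open PartCount public

-- One Hamilton cycle from one track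

record StepData : Set₁ where
  field
    V : Set
    _≟_ : (x y : V) → Dec (x ≡ y)
    T D : V → V → Set
    W : List V
    W-unique : Unique W
    W-all : ∀ v → v ∈ W
    s : ℕ
    miss : V → List V
    miss≤ : ∀ v → length (miss v) ≤ s
    adjacent : ∀ u v → u ≢ v → v ∉ miss u → D u v ⊎ D v u
    Γ : List (Gap V)
    covs : List (Cover V)
    r : ℕ
    outMiss inMiss : V → List V
    outMiss≤ : ∀ v → length (outMiss v) ≤ r
    inMiss≤ : ∀ v → length (inMiss v) ≤ r
    out-arc : ∀ {u v} → T u v → v ∉ outMiss u → D u v
    in-arc : ∀ {u v} → T u v → u ∉ inMiss v → D u v
    gap-unique : Unique (concatMap Gap.vertices Γ)
    cov-unique : Unique (concatMap Cover.edge covs)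
    cov-gap : ∀ {c γ} → c ∈ covs → γ ∈ Γ → Disjoint (Gap.vertices γ) (Cover.edge c)
    cov-arcs : ∀ {c} → c ∈ covs → D (Cover.from c) (Cover.at c) × D (Cover.at c) (Cover.to c)
    gap-middle : ∀ {γ} → γ ∈ Γ → Gap.middle γ ≢ []
    covered : ∀ {γ v} → γ ∈ Γ → v ∈ Gap.vertices γ → ∃ λ c → c ∈ covs × Cover.at c ≡ v
    X EA EB : List V
    gap⊆X : ∀ {γ} → γ ∈ Γ → Gap.vertices γ ⊆ X
    cov⊆X : ∀ {c} → c ∈ covs → Cover.edge c ⊆ X
    leave : ∀ v l → length l ≤ 3 * length X → ∃ λ z → D v z × z ∉ l
    enter : ∀ v l → length l ≤ 3 * length X → ∃ λ z → D z v × z ∉ l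
    leave′ : ∀ v l → v ∉ X → length l ≤ 3 * length (X ++ EA) → ∃ λ z → D v z × z ∉ l
    enter′ : ∀ v l → v ∉ X → length l ≤ 3 * length (X ++ EA ++ EB) → ∃ λ z → D z v × z ∉ l

module Step (stepping : StepData) where

  open StepData stepping

  open Eq _≟_
  open System _≟_ D
  open Covering _≟_ D s miss miss≤ adjacent

  merging : MergeData
  merging = record { V = V ; _≟_ = _≟_ ; T = T ; D = D ; Γ = Γ ; covs = covs ; r = r ; outMiss = outMiss
      ; inMiss = inMiss ; outMiss≤ = outMiss≤ ; inMiss≤ = inMiss≤ ; out-arc = out-arc ; in-arc = in-arc
      ; cov-unique = cov-unique ; cov-gap = cov-gap ; cov-arcs = cov-arcs ; gap-middle = gap-middle
      ; covered = covered }

  open Merging merging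

  -- Applied to growing sets: once a set is covered, all paths added later avoid it altogether, in
  -- particular with their ends. Goodness gained by a repair is therefore never spoilt by a later
  -- covering.
  extend : ∀ ps Y → Unique (verts ps) → ∃ λ qs → length qs ≤ suc s × Unique (verts (ps ++ qs)) ×
    Y ⊆ verts (ps ++ qs) × (∀ {v} → v ∈ verts qs → v ∉ verts ps)
  extend ps Y u with cover-all new new-unique
    where
    new = deduplicate _≟_ (filter (λ v → ¬? (v ∈? verts ps)) Y)
    new-unique : Unique new
    new-unique = UDₚ.deduplicate-! _≟_ _
  ... | qs , le , perm = qs , le , uniq , sub , fresh
    where
    new = deduplicate _≟_ (filter (λ v → ¬? (v ∈? verts ps)) Y)
    fresh : ∀ {v} → v ∈ verts qs → v ∉ verts ps
    fresh i = proj₂ (∈-filter⁻ (λ v → ¬? (v ∈? verts ps)) {xs = Y} (∈-deduplicate⁻ _≟_ _ (↭-∈ perm i)))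
    uniq : Unique (verts (ps ++ qs))
    uniq = subst Unique (sym (verts-++ ps qs))
      (Uₚ.++⁺ u (Unique-resp-↭ (↭-sym perm) (UDₚ.deduplicate-! _≟_ _)) (λ (a , b) → fresh b a))
    sub : Y ⊆ verts (ps ++ qs)
    sub {v} i with v ∈? verts ps
    ... | yes j = subst (v ∈_) (sym (verts-++ ps qs)) (∈-++⁺ˡ j)
    ... | no n = subst (v ∈_) (sym (verts-++ ps qs)) (∈-++⁺ʳ (verts ps)
      (↭-∈ (↭-sym perm) (∈-deduplicate⁺ _≟_ (∈-filter⁺ (λ v → ¬? (v ∈? verts ps)) i n))))

  hamiltonian : ∀ {z x l} (R : Path D z x l) → Unique l →
    (∀ {γ} → γ ∈ Γ → Infix (Gap.vertices γ) l) → (∀ {c} → c ∈ covs → Infix (Cover.edge c) l) →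
    (∀ {v} → v ∉ X ++ EA → GoodOut v) → (∀ {v} → v ∉ X ++ EB → GoodIn v) →
    (∀ {γ v} → γ ∈ Γ → v ∈ Gap.middle γ → GoodIn v × GoodOut v) →
    partCount s + suc (suc (r + r + (r + r))) ≤ length Γ →
    ∃ λ (P : Seg) → D (end P) (start P) × body P ↭ W
  hamiltonian {l = l} R uR gaps edges good-out good-in good-middle room =
    stage₁ (extend (seg R ∷ []) X (subst Unique (sym (Lₚ.++-identityʳ l)) uR))
    where
    -- Four rounds: last and first vertices are moved out of `X`, where only the connectivity bounds
    -- the degrees, and then out of the exceptional sets, where the larger degrees of vertices
    -- outside `X` can be used. In each round `OtherOK` protects the result of the round before.
    fixing₁ : FixData
    fixing₁ = record { S = ends ; L = X ; KeyOK = λ _ → ⊤ ; OtherOK = λ _ → ⊤ ; key-ok = λ _ → tt ; other-ok = λ _ → tt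
      ; leave = λ v _ _ → leave v }
    fixing₂ : FixData
    fixing₂ = record { S = starts ; L = X ; KeyOK = λ _ → ⊤ ; OtherOK = _∉ X ; key-ok = λ _ → tt ; other-ok = id
      ; leave = λ v _ _ → enter v }
    fixing₃ : FixData
    fixing₃ = record { S = ends ; L = X ++ EA ; KeyOK = _∉ X ; OtherOK = _∉ X ; key-ok = λ n → n ∘ ∈-++⁺ˡ
        ; other-ok = λ n → n ∘ ∈-++⁺ˡ
      ; leave = λ v _ n l → leave′ v l n }
    -- `EA` is part of `L` although first vertices are under repair: cutting exposes new last
    -- vertices as well, and these must stay outside `EA`.
    fixing₄ : FixData
    fixing₄ = record { S = starts ; L = X ++ EA ++ EB ; KeyOK = _∉ X ; OtherOK = _∉ X ++ EA
        ; key-ok = λ n → n ∘ ∈-++⁺ˡ ; other-ok = λ n i → n ([ ∈-++⁺ˡ , ∈-++⁺ʳ X ∘ ∈-++⁺ˡ ]′ (∈-++⁻ X i))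
      ; leave = λ v _ n l → enter′ v l n }
    module F₁ = Fix fixing₁
    module F₂ = Fix fixing₂
    module F₃ = Fix fixing₃
    module F₄ = Fix fixing₄

    drop-EA : ∀ {v} → v ∈ X ++ EB → v ∈ X ++ EA ++ EB
    drop-EA i = [ ∈-++⁺ˡ , ∈-++⁺ʳ X ∘ ∈-++⁺ʳ EA ]′ (∈-++⁻ X i)
    keep-EA : ∀ {v} → v ∈ X ++ EA → v ∈ X ++ EA ++ EB
    keep-EA i = [ ∈-++⁺ˡ , ∈-++⁺ʳ X ∘ ∈-++⁺ˡ ]′ (∈-++⁻ X i)

    widen : ∀ ps {v} → v ∈ verts ps → v ∈ verts (ps ++ [])
    widen ps i = subst (λ ps → _ ∈ verts ps) (sym (Lₚ.++-identityʳ ps)) i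

    fresh-all₂ : ∀ qs {Z} → (∀ {v} → v ∈ verts qs → v ∉ Z) → All (λ Q → start Q ∉ Z × end Q ∉ Z) qs
    fresh-all₂ [] f = []
    fresh-all₂ (Q ∷ qs) f = (f (∈-++⁺ˡ (start-∈ (path Q))) , f (∈-++⁺ˡ (end-∈ (path Q)))) ∷ fresh-all₂ qs (f ∘ ∈-++⁺ʳ (body Q))

    fresh-all : ∀ qs {Z} → (∀ {v} → v ∈ verts qs → v ∉ Z) → All (λ Q → end Q ∉ Z × start Q ∉ Z) qs
    fresh-all qs f = All.map (λ (a , b) → b , a) (fresh-all₂ qs f)

    Goal : Set
    Goal = ∃ λ (P : Seg) → D (end P) (start P) × body P ↭ W

    Keeps : List Seg → Set
    Keeps ps = ∀ {I} → I ≢ [] → I ⊆ X → Infix I l → In I ps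

    assemble : ∀ ps → Unique (verts ps) → W ⊆ verts ps → length ps ≤ partCount s → All Nice ps →
      (∀ {γ} → γ ∈ Γ → In (Gap.vertices γ) ps) → (∀ {c} → c ∈ covs → In (Cover.edge c) ps) →
      ∃ λ (P : Seg) → D (end P) (start P) × body P ↭ W
    assemble [] u sub le nice gs es with pick Γ (≤-trans (s≤s z≤n) (≤-trans (ℕₚ.m≤n+m _ (partCount s)) room))
    ... | _ , i with gs i
    ...   | _ , () , _
    assemble (P ∷ ps) u sub le nice gs es =
      let R , U , Γ′ , st , room′ = merge-all (partCount s) P ps state (≤-trans (ℕₚ.n≤1+n _) le) room
          U′ , c = close good-middle st room′
      in finish W-unique c
      where
      state : State W (P ∷ ps) [] Γ
      state = record
        { all = ↭-trans (↭-reflexive (Lₚ.++-identityʳ _)) (unique⊆⊇⇒↭ u W-unique (λ _ → W-all _) sub)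
        ; left = λ { () }
        ; nice = nice ; active = id ; active-unique = gap-unique ; gaps = gs ; edges = es }

    narrow : ∀ {A : Set} {P : A → Set} ps → All P ps → All P (ps ++ [])
    narrow ps a = Allₚ.++⁺ a []

    unique-[] : ∀ ps → Unique (verts ps) → Unique (verts (ps ++ []))
    unique-[] ps u = subst (Unique ∘ verts) (sym (Lₚ.++-identityʳ ps)) u

    Extended : List Seg → List V → Set
    Extended ps Y = ∃ λ qs → length qs ≤ suc s × Unique (verts (ps ++ qs)) × Y ⊆ verts (ps ++ qs) ×
      (∀ {v} → v ∈ verts qs → v ∉ verts ps)

    size-++ : ∀ {ps qs a} → length ps ≤ a → length qs ≤ suc s → length (ps ++ qs) ≤ a + suc s
    size-++ {ps} le le′ = ≤-trans (≤-reflexive (Lₚ.length-++ ps)) (ℕₚ.+-mono-≤ le le′)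

    nice-of : ∀ Q → start Q ∉ X ++ EA ++ EB → end Q ∉ X ++ EA → Nice Q
    nice-of Q a b = good-in (a ∘ drop-EA) , good-out b

    -- All of `X`, `EA` and `EB` is covered by now, so the paths through the remaining vertices have
    -- good ends and call for no further repair.
    stage₇ : ∀ {ps} → length ps ≤ 2 * (2 * (2 * (2 * (1 + suc s)) + suc s)) → X ++ EA ++ EB ⊆ verts ps →
      All (λ Q → start Q ∉ X ++ EA ++ EB × end Q ∉ X ++ EA) ps → Keeps ps → Extended ps W → Goal
    stage₇ {ps} le sub nice keep (qs , le′ , u , all , fresh) = assemble (ps ++ qs) u all (≤-partCount s (size-++ {ps} {qs} le le′))
      (Allₚ.++⁺ (All.map (λ {Q} (a , b) → nice-of Q a b) nice)
        (All.map (λ {Q} (a , b) → nice-of Q a (b ∘ keep-EA)) (fresh-all₂ qs (λ i j → fresh i (sub j)))))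
      (λ i → In-⊆ ∈-++⁺ˡ (keep (vertices-nonempty i) (gap⊆X i) (gaps i)))
      (λ i → In-⊆ ∈-++⁺ˡ (keep (λ ()) (cov⊆X i) (edges i)))

    stage₆ : ∀ {ps b} → b ≤ 2 * (2 * (2 * (1 + suc s)) + suc s) → X ++ EA ++ EB ⊆ verts ps → Keeps ps →
      F₄.Fixed (2 * b) (ps ++ []) → Goal
    stage₆ {ps} le sub keep (F₄.fixed ps′ le′ u cov good keep′) = stage₇ (≤-trans le′ (ℕₚ.*-monoʳ-≤ 2 le))
      (λ i → cov (widen ps (sub i))) good (λ ne s i → keep′ ne (∈-++⁺ˡ ∘ s) (In-⊆ ∈-++⁺ˡ (keep ne s i)))
      (extend ps′ W u)

    stage₅ : ∀ {ps b} → b ≤ 2 * (2 * (1 + suc s)) + suc s → X ++ EA ++ EB ⊆ verts ps → Keeps ps →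
      F₃.Fixed (2 * b) (ps ++ []) → Goal
    stage₅ {ps} le sub keep (F₃.fixed ps′ le′ u cov good keep′) = stage₆ {b = length ps′} (≤-trans le′ (ℕₚ.*-monoʳ-≤ 2 le))
      (λ i → cov (widen ps (sub i))) (λ ne s i → keep′ ne (∈-++⁺ˡ ∘ s) (In-⊆ ∈-++⁺ˡ (keep ne s i)))
      (F₄.fix (length ps′) ps′ [] ≤-refl (unique-[] ps′ u) (narrow ps′ (All.map (λ (a , b) → b , a) good)) [])

    stage₄ : ∀ {ps} → length ps ≤ 2 * (2 * (1 + suc s)) → X ⊆ verts ps → All (λ Q → start Q ∉ X × end Q ∉ X) ps →
      Keeps ps → Extended ps (EA ++ EB) → Goal
    stage₄ {ps} le sub good keep (qs , le′ , u , E⊆ , fresh) = stage₅ {b = length (ps ++ qs)} (size-++ {ps} {qs} le le′)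
      (λ {v} i → [ (λ j → subst (v ∈_) (sym (verts-++ ps qs)) (∈-++⁺ˡ (sub j))) , E⊆ ]′ (∈-++⁻ X i))
      (λ ne s i → In-⊆ ∈-++⁺ˡ (keep ne s i))
      (F₃.fix (length (ps ++ qs)) (ps ++ qs) [] ≤-refl (unique-[] (ps ++ qs) u)
        (narrow (ps ++ qs) (Allₚ.++⁺ (All.map (λ (a , b) → b , a) good) (fresh-all qs (λ i j → fresh i (sub j))))) [])

    stage₃ : ∀ {ps b} → b ≤ 2 * (1 + suc s) → X ⊆ verts ps → Keeps ps → F₂.Fixed (2 * b) (ps ++ []) → Goal
    stage₃ {ps} le sub keep (F₂.fixed ps′ le′ u cov good keep′) = stage₄ (≤-trans le′ (ℕₚ.*-monoʳ-≤ 2 le))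
      (λ i → cov (widen ps (sub i))) good (λ ne s i → keep′ ne s (In-⊆ ∈-++⁺ˡ (keep ne s i))) (extend ps′ (EA ++ EB) u)

    stage₂ : ∀ {ps b} → b ≤ 1 + suc s → X ⊆ verts ps → Keeps ps → F₁.Fixed (2 * b) (ps ++ []) → Goal
    stage₂ {ps} le sub keep (F₁.fixed ps′ le′ u cov good keep′) = stage₃ {b = length ps′} (≤-trans le′ (ℕₚ.*-monoʳ-≤ 2 le))
      (λ i → cov (widen ps (sub i))) (λ ne s i → keep′ ne s (In-⊆ ∈-++⁺ˡ (keep ne s i)))
      (F₂.fix (length ps′) ps′ [] ≤-refl (unique-[] ps′ u) (narrow ps′ (All.map (λ (a , _) → tt , a) good)) [])

    stage₁ : Extended (seg R ∷ []) X → Goal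
    stage₁ (qs , le , u , X⊆ , _) = stage₂ {b = length (seg R ∷ qs)} (s≤s le) X⊆
      (λ ne s i → seg R , here refl , i)
      (F₁.fix (length (seg R ∷ qs)) (seg R ∷ qs) [] ≤-refl (unique-[] (seg R ∷ qs) u)
        (All.universal (λ _ → tt , tt) _) [])

  abstract
    hamilton-cycle : ∀ {z x l} → Path D z x l → Unique l →
      (∀ {γ} → γ ∈ Γ → Infix (Gap.vertices γ) l) → (∀ {c} → c ∈ covs → Infix (Cover.edge c) l) →
      (∀ {v} → v ∉ X ++ EA → ∀ γ → γ ∈ Γ → ∃ λ a → a ∈ Gap.entries γ × T v a) →
      (∀ {v} → v ∉ X ++ EB → ∀ γ → γ ∈ Γ → ∃ λ b → b ∈ Gap.exits γ × T b v) →
      (∀ {γ v} → γ ∈ Γ → v ∈ Gap.middle γ →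
        (∀ γ → γ ∈ Γ → ∃ λ b → b ∈ Gap.exits γ × T b v) × (∀ γ → γ ∈ Γ → ∃ λ a → a ∈ Gap.entries γ × T v a)) →
      partCount s + suc (suc (r + r + (r + r))) ≤ length Γ →
      ∃₂ λ u v → ∃ λ l → Path D u v l × D v u × l ↭ W
    hamilton-cycle R uR gaps edges into outOf middle room =
      unpack (hamiltonian R uR gaps edges (λ n {γ} → into n γ) (λ n {γ} → outOf n γ)
        (λ i j → (λ {γ} → proj₁ (middle i j) γ) , (λ {γ} → proj₂ (middle i j) γ)) room)
      where
      unpack : (∃ λ (P : Seg) → D (end P) (start P) × body P ↭ W) → ∃₂ λ u v → ∃ λ l → Path D u v l × D v u × l ↭ W
      unpack (P , d , perm) = _ , _ , _ , path P , d , perm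

-- A matching between tails and heads: no vertex is the tail of two arcs or the head of two arcs.
-- Cycles and paths are of this kind, and each takes at most one out-arc and one in-arc from a
-- vertex.
Matching : {V : Set} → List (V × V) → Set
Matching M = Unique (map proj₁ M) × Unique (map proj₂ M)

pairs-init : ∀ {A : Set} (l : List A) x → map proj₁ (pairs (l ++ [ x ])) ≡ l
pairs-init [] x = refl
pairs-init (a ∷ []) x = refl
pairs-init (a ∷ b ∷ l) x = cong (a ∷_) (pairs-init (b ∷ l) x)

pairs-tail : ∀ {A : Set} x (l : List A) → map proj₂ (pairs (x ∷ l)) ≡ l
pairs-tail x [] = refl
pairs-tail x (y ∷ l) = cong (y ∷_) (pairs-tail y l)

matching-functional : ∀ {V : Set} {M : List (V × V)} {a b c} → Unique (map proj₁ M) → (a , b) ∈ M → (a , c) ∈ M → b ≡ c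
matching-functional u (here refl) (here refl) = refl
matching-functional u (here refl) (there j) = contradiction (∈-map⁺ proj₁ j) (unique-head u)
matching-functional u (there i) (here refl) = contradiction (∈-map⁺ proj₁ i) (unique-head u)
matching-functional u (there i) (there j) = matching-functional (unique-tail u) i j

-- Packing edge-disjoint Hamilton cycles

module Fibres {V : Set} (_≟_ : (x y : V) → Dec (x ≡ y)) where

  fibre : {B : Set} (f : B → V) → V → List B → List B
  fibre f v = filter (λ p → f p ≟ v)

  length-fibre : ∀ {B : Set} (f : B → V) v {M} → Unique (map f M) → length (fibre f v M) ≤ 1
  length-fibre f v {M} u = ≤-trans (≤-reflexive (sym (Lₚ.length-map f (fibre f v M))))
    (unique-⊆⇒length≤ (unique-map-filter f (λ p → f p ≟ v) {M} u) sub)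
    where
    sub : map f (fibre f v M) ⊆ [ v ]
    sub i with ∈-map⁻ f i
    ... | p , j , refl = here (proj₂ (∈-filter⁻ (λ p → f p ≟ v) {xs = M} j))

  length-fibre-concat : ∀ {B : Set} (f : B → V) v Ms → All (λ M → Unique (map f M)) Ms →
    length (fibre f v (concat Ms)) ≤ length Ms
  length-fibre-concat f v [] [] = z≤n
  length-fibre-concat f v (M ∷ Ms) (u ∷ us) = ≤-trans
    (≤-reflexive (trans (cong length (Lₚ.filter-++ (λ p → f p ≟ v) M (concat Ms))) (Lₚ.length-++ (fibre f v M))))
    (ℕₚ.+-mono-≤ (length-fibre f v u) (length-fibre-concat f v Ms us))

module Cycles {n : ℕ} (T : Digraph n) where

  Arcs : Fin n → Fin n → Set
  Arcs u v = T u v ≡ true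

  record Cyc : Set where
    constructor cyc
    field
      {first final} : Fin n
      {list} : List (Fin n)
      cpath : Path Arcs first final list
      back : T final first ≡ true
      perm : list ↭ allFin n

    arcs : List (Fin n × Fin n)
    arcs = (final , first) ∷ pairs list

    unique-list : Unique list
    unique-list = Unique-resp-↭ (↭-sym perm) (Uₚ.allFin⁺ n)

    firsts-↭ : map proj₁ arcs ↭ list
    firsts-↭ with path-last cpath
    ... | l₀ , eq = ↭-trans (↭-reflexive (cong (final ∷_) (trans (cong (map proj₁ ∘ pairs) eq) (pairs-init l₀ final))))
      (↭-trans (Permₚ.∷↭∷ʳ final l₀) (↭-reflexive (sym eq)))

    seconds-↭ : map proj₂ arcs ↭ list
    seconds-↭ with path-head cpath
    ... | l₁ , eq = ↭-reflexive (trans (cong (first ∷_) (trans (cong (map proj₂ ∘ pairs) eq) (pairs-tail first l₁))) (sym eq))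

    arcs-matching : Matching arcs
    arcs-matching = Unique-resp-↭ (↭-sym firsts-↭) unique-list , Unique-resp-↭ (↭-sym seconds-↭) unique-list

    arcs-T : ∀ {a b} → (a , b) ∈ arcs → T a b ≡ true
    arcs-T (here refl) = back
    arcs-T (there i) = path-pairs cpath i

    firsts : ∀ v → v ∈ map proj₁ arcs
    firsts v = ↭-∈ (↭-sym (↭-trans firsts-↭ perm)) (∈-allFin v)

    successor : ∀ v → ∃ λ w → (v , w) ∈ arcs
    successor v with ∈-map⁻ proj₁ (firsts v)
    ... | (_ , w) , i , refl = w , i

    next : Fin n → Fin n
    next v = proj₁ (successor v)

    next-arc : ∀ {a b} → (a , b) ∈ arcs → next a ≡ b
    next-arc {a} i = matching-functional (proj₁ arcs-matching) (proj₂ (successor a)) i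

    Reach : Fin n → Fin n → Set
    Reach a b = ∃ λ m → iterate next m a ≡ b

    reach-trans : ∀ {a b c} → Reach a b → Reach b c → Reach a c
    reach-trans (m , refl) (k , refl) = k + m , iterate-+ k
      where
      iterate-+ : ∀ k → iterate next (k + m) _ ≡ iterate next k (iterate next m _)
      iterate-+ zero = refl
      iterate-+ (suc k) = cong next (iterate-+ k)

    reach-path : ∀ {R : Fin n → Fin n → Set} {u v l w} → Path R u v l → (∀ {a b} → (a , b) ∈ pairs l → next a ≡ b) →
      w ∈ l → Reach u w × Reach w v
    reach-path (point u) f (here refl) = (0 , refl) , (0 , refl)
    reach-path (e ◅ point w) f (here refl) = (0 , refl) , (1 , f (here refl))
    reach-path (e ◅ point w) f (there (here refl)) = (1 , f (here refl)) , (0 , refl)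
    reach-path (e ◅ e′ ◅ p) f (here refl) =
      (0 , refl) , reach-trans (1 , f (here refl)) (proj₂ (reach-path (e′ ◅ p) (f ∘ there) (here refl)))
    reach-path (e ◅ e′ ◅ p) f (there i) with reach-path (e′ ◅ p) (f ∘ there) i
    ... | r , t = reach-trans (1 , f (here refl)) r , t

    hamilton : IsHamiltonCycle T next
    hamilton = (λ v → arcs-T (proj₂ (successor v))) , λ v w →
      -- From `v` on to `final`, over the closing arc to `first`, and on to `w`.
      reach-trans (proj₂ (visit v)) (reach-trans (1 , next-arc (here refl)) (proj₁ (visit w)))
      where
      visit : ∀ w → Reach first w × Reach w final
      visit w = reach-path cpath (next-arc ∘ there) (↭-∈ (↭-sym perm) (∈-allFin w))

  open Cyc public

  Apart : Cyc → Cyc → Set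
  Apart c c′ = Disjoint (arcs c) (arcs c′)

  Packing : ℕ → Set
  Packing k = ∃ λ cs → length cs ≡ k × AllPairs Apart cs

  packing⇒disjoint-cycles : ∀ {k} → Packing k → ∃ λ (H : Fin k → Fin n → Fin n) → EdgeDisjointHamiltonCycles T k H
  packing⇒disjoint-cycles (cs , refl , ap) = (λ i → next (lookup cs i)) , (λ i → hamilton (lookup cs i)) , λ i j ne v e →
    apart cs ap i j ne (proj₂ (successor (lookup cs i) v)
      , subst (λ w → (v , w) ∈ arcs (lookup cs j)) (sym e) (proj₂ (successor (lookup cs j) v)))
    where
    apart : ∀ cs → AllPairs Apart cs → ∀ i j → i ≢ j → Apart (lookup cs i) (lookup cs j)
    apart (c ∷ cs) (a ∷ as) Fin.zero Fin.zero ne = contradiction refl ne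
    apart (c ∷ cs) (a ∷ as) Fin.zero (Fin.suc j) ne = All.lookup a (∈-lookup j)
    apart (c ∷ cs) (a ∷ as) (Fin.suc i) Fin.zero ne (x , y) = All.lookup a (∈-lookup i) (y , x)
    apart (c ∷ cs) (a ∷ as) (Fin.suc i) (Fin.suc j) ne = apart cs as i j (ne ∘ cong Fin.suc)

transpose : ∀ {n} → Digraph n → Digraph n
transpose T u v = T v u

module _ {n : ℕ} (T : Digraph n) where

  module C = Cycles T
  module Cᵗ = Cycles (transpose T)

  infix-reverse : ∀ {A : Set} {a b : A} l → Infix (a ∷ b ∷ []) (reverse l) → Infix (b ∷ a ∷ []) l
  infix-reverse {a = a} {b} l (x , y , eq) = reverse y , reverse x , trans (sym (Lₚ.reverse-involutive l)) (trans (cong reverse eq)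
    (trans (Lₚ.reverse-++ x (a ∷ b ∷ y)) (trans (cong (_++ reverse x) (Lₚ.reverse-++ (a ∷ b ∷ []) y))
      (Lₚ.++-assoc (reverse y) (b ∷ a ∷ []) (reverse x)))))

  reverse-cyc : Cᵗ.Cyc → C.Cyc
  reverse-cyc (Cᵗ.cyc p b perm) = C.cyc (path-reverse p) b (↭-trans (Permₚ.↭-reverse _) perm)

  reverse-arcs : ∀ c {a b} → (a , b) ∈ C.arcs (reverse-cyc c) → (b , a) ∈ Cᵗ.arcs c
  reverse-arcs c (here refl) = here refl
  reverse-arcs c (there i) = there (infix-pairs _ (infix-reverse _ (pairs-infix _ i)))

  -- Needed for assuming, up to reversal of all arcs, that the least out-degrees are the smaller
  -- ones.
  transpose-packing : ∀ {k} → Cᵗ.Packing k → C.Packing k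
  transpose-packing (cs , eq , ap) = map reverse-cyc cs , trans (Lₚ.length-map reverse-cyc cs) eq ,
    APₚ.map⁺ (AP.map (λ {c} {c′} → apart c c′) ap)
    where
    apart : ∀ c c′ → Cᵗ.Apart c c′ → C.Apart (reverse-cyc c) (reverse-cyc c′)
    apart c c′ d (x , y) = d (reverse-arcs c x , reverse-arcs c′ y)

-- From disjoint tracks to edge-disjoint Hamilton cycles

record PackData : Set where
  field
    n : ℕ
    T : Digraph n
    tournament : IsTournament T
    X EA EB : List (Fin n)
    r : ℕ
    leave : ∀ v l → length l ≤ 3 * length X + r → ∃ λ z → T v z ≡ true × z ∉ l
    enter : ∀ v l → length l ≤ 3 * length X + r → ∃ λ z → T z v ≡ true × z ∉ l
    leave′ : ∀ v l → v ∉ X → length l ≤ 3 * length (X ++ EA) + r → ∃ λ z → T v z ≡ true × z ∉ l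
    enter′ : ∀ v l → v ∉ X → length l ≤ 3 * length (X ++ EA ++ EB) + r → ∃ λ z → T z v ≡ true × z ∉ l

module PackingOf (packing-data : PackData) where

  open PackData packing-data

  open Cycles T
  open Fibres (Fin._≟_ {n})

  V : Set
  V = Fin n

  gapsNeeded : ℕ
  gapsNeeded = partCount (r + r) + suc (suc (r + r + (r + r)))

  Into OutOf : List (Gap V) → V → Set
  Into Γ v = ∀ γ → γ ∈ Γ → ∃ λ a → a ∈ Gap.entries γ × T v a ≡ true
  OutOf Γ v = ∀ γ → γ ∈ Γ → ∃ λ b → b ∈ Gap.exits γ × T b v ≡ true

  record Struct : Set where
    field
      {source target} : V
      {track} : List V
      spine : Path Arcs source target track
      track-unique : Unique track
      Γ : List (Gap V)
      covs : List (Cover V)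
      gap-unique : Unique (concatMap Gap.vertices Γ)
      cov-unique : Unique (concatMap Cover.edge covs)
      at-unique : Unique (map Cover.at covs)
      cov-gap : ∀ {c γ} → c ∈ covs → γ ∈ Γ → Disjoint (Gap.vertices γ) (Cover.edge c)
      cov-arcs : ∀ {c} → c ∈ covs → Arcs (Cover.from c) (Cover.at c) × Arcs (Cover.at c) (Cover.to c)
      gap-middle : ∀ {γ} → γ ∈ Γ → Gap.middle γ ≢ []
      covered : ∀ {γ v} → γ ∈ Γ → v ∈ Gap.vertices γ → ∃ λ c → c ∈ covs × Cover.at c ≡ v
      at∈ : ∀ {c} → c ∈ covs → Cover.at c ∈ track
      gap⊆X : ∀ {γ} → γ ∈ Γ → Gap.vertices γ ⊆ X
      cov⊆X : ∀ {c} → c ∈ covs → Cover.edge c ⊆ X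
      gaps-in : ∀ {γ} → γ ∈ Γ → Infix (Gap.vertices γ) track
      edges-in : ∀ {c} → c ∈ covs → Infix (Cover.edge c) track
      into : ∀ {v} → v ∉ X ++ EA → Into Γ v
      outOf : ∀ {v} → v ∉ X ++ EB → OutOf Γ v
      middle-good : ∀ {γ v} → γ ∈ Γ → v ∈ Gap.middle γ → OutOf Γ v × Into Γ v
      enough : gapsNeeded ≤ length Γ

    inward outward : List (V × V)
    inward = map (λ c → Cover.from c , Cover.at c) covs
    outward = map (λ c → Cover.at c , Cover.to c) covs

    -- Three matchings: the arcs of the track, and the arcs into and out of the vertices that may
    -- have to be inserted. This is the source of the bound 3`k` on the arcs forbidden at a vertex
    -- in either direction.
    reserved : List (List (V × V))
    reserved = pairs track ∷ inward ∷ outward ∷ []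

    from-unique : Unique (map Cover.from covs)
    from-unique = go covs cov-unique
      where
      go : ∀ cs → Unique (concatMap Cover.edge cs) → Unique (map Cover.from cs)
      go [] u = []
      go (c ∷ cs) u = unique-∷ notin (go cs (unique-tail (unique-tail u)))
        where
        notin : Cover.from c ∉ map Cover.from cs
        notin i with ∈-map⁻ Cover.from i
        ... | c′ , j , e = unique-head u (there (∈-concatMap⁺′ Cover.edge j (here e)))

    to-unique : Unique (map Cover.to covs)
    to-unique = go covs cov-unique
      where
      go : ∀ cs → Unique (concatMap Cover.edge cs) → Unique (map Cover.to cs)
      go [] u = []
      go (c ∷ cs) u = unique-∷ notin (go cs (unique-tail (unique-tail u)))
        where
        notin : Cover.to c ∉ map Cover.to cs
        notin i with ∈-map⁻ Cover.to i
        ... | c′ , j , e = unique-head (unique-tail u) (∈-concatMap⁺′ Cover.edge j (there (here e)))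

    reserved-matching : All Matching reserved
    reserved-matching = (unique-pairs₁ track track-unique , unique-pairs₂ track track-unique)
      ∷ (subst Unique (Lₚ.map-∘ covs) from-unique , subst Unique (Lₚ.map-∘ covs) at-unique)
      ∷ (subst Unique (Lₚ.map-∘ covs) at-unique , subst Unique (Lₚ.map-∘ covs) to-unique) ∷ []

    inward-reserved : ∀ {c} → c ∈ covs → (Cover.from c , Cover.at c) ∈ concat reserved
    inward-reserved i = ∈-++⁺ʳ (pairs track) (∈-++⁺ˡ (∈-map⁺ _ i))

    outward-reserved : ∀ {c} → c ∈ covs → (Cover.at c , Cover.to c) ∈ concat reserved
    outward-reserved i = ∈-++⁺ʳ (pairs track) (∈-++⁺ʳ inward (∈-++⁺ˡ (∈-map⁺ _ i)))

    -- Tracks are pairwise disjoint, so arcs reserved for different cycles already differ in their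
    -- tails.
    reserved-tail : ∀ {a b} → (a , b) ∈ concat reserved → a ∈ track
    reserved-tail i with ∈-++⁻ (pairs track) i
    ... | inj₁ j = pairs-fst track j
    ... | inj₂ j with ∈-++⁻ inward j
    ...   | inj₁ k with ∈-map⁻ _ k
    ...     | c , c∈ , refl = infix-∈ (edges-in c∈) (here refl)
    reserved-tail i | inj₂ j | inj₂ k with ∈-map⁻ _ (subst (_ ∈_) (Lₚ.++-identityʳ outward) k)
    ... | c , c∈ , refl = at∈ c∈

  open Struct

  module Avoiding (Ms : List (List (V × V))) (matchings : All Matching Ms) (few : length Ms ≤ r) where

    D : V → V → Set
    D u v = T u v ≡ true × (u , v) ∉ concat Ms

    outMiss inMiss miss : V → List V
    outMiss v = map proj₂ (fibre proj₁ v (concat Ms))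
    inMiss v = map proj₁ (fibre proj₂ v (concat Ms))
    miss v = outMiss v ++ inMiss v

    outMiss≤ : ∀ v → length (outMiss v) ≤ r
    outMiss≤ v = ≤-trans (≤-reflexive (Lₚ.length-map proj₂ (fibre proj₁ v (concat Ms))))
      (≤-trans (length-fibre-concat proj₁ v Ms (All.map proj₁ matchings)) few)

    inMiss≤ : ∀ v → length (inMiss v) ≤ r
    inMiss≤ v = ≤-trans (≤-reflexive (Lₚ.length-map proj₁ (fibre proj₂ v (concat Ms))))
      (≤-trans (length-fibre-concat proj₂ v Ms (All.map proj₂ matchings)) few)

    miss≤ : ∀ v → length (miss v) ≤ r + r
    miss≤ v = ≤-trans (≤-reflexive (Lₚ.length-++ (outMiss v))) (ℕₚ.+-mono-≤ (outMiss≤ v) (inMiss≤ v))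

    ∈-outMiss : ∀ {u v} → (u , v) ∈ concat Ms → v ∈ outMiss u
    ∈-outMiss {u} i = ∈-map⁺ proj₂ (∈-filter⁺ (λ p → proj₁ p Fin.≟ u) i refl)

    ∈-inMiss : ∀ {u v} → (u , v) ∈ concat Ms → u ∈ inMiss v
    ∈-inMiss {v = v} i = ∈-map⁺ proj₁ (∈-filter⁺ (λ p → proj₂ p Fin.≟ v) i refl)

    out-arc : ∀ {u v} → Arcs u v → v ∉ outMiss u → D u v
    out-arc t n = t , n ∘ ∈-outMiss

    in-arc : ∀ {u v} → Arcs u v → u ∉ inMiss v → D u v
    in-arc t n = t , n ∘ ∈-inMiss

    adjacent : ∀ u v → u ≢ v → v ∉ miss u → D u v ⊎ D v u
    adjacent u v ne n with proj₂ tournament u v ne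
    ... | inj₁ (t , _) = inj₁ (out-arc t (n ∘ ∈-++⁺ˡ))
    ... | inj₂ (_ , t) = inj₂ (in-arc t (n ∘ ∈-++⁺ʳ (outMiss u)))

    go-out : ∀ {k} v → (∀ l → length l ≤ k + r → ∃ λ z → T v z ≡ true × z ∉ l) →
      ∀ l → length l ≤ k → ∃ λ z → D v z × z ∉ l
    go-out v f l le with f (l ++ outMiss v) (≤-trans (≤-reflexive (Lₚ.length-++ l)) (ℕₚ.+-mono-≤ le (outMiss≤ v)))
    ... | z , t , n = z , out-arc t (n ∘ ∈-++⁺ʳ l) , n ∘ ∈-++⁺ˡ

    go-in : ∀ {k} v → (∀ l → length l ≤ k + r → ∃ λ z → T z v ≡ true × z ∉ l) →
      ∀ l → length l ≤ k → ∃ λ z → D z v × z ∉ l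
    go-in v f l le with f (l ++ inMiss v) (≤-trans (≤-reflexive (Lₚ.length-++ l)) (ℕₚ.+-mono-≤ le (inMiss≤ v)))
    ... | z , t , n = z , in-arc t (n ∘ ∈-++⁺ʳ l) , n ∘ ∈-++⁺ˡ

    from-path : (∃₂ λ u v → ∃ λ l → Path D u v l × D v u × l ↭ allFin n) → ∃ λ c → Disjoint (arcs c) (concat Ms)
    from-path (_ , _ , _ , p , d , perm) = cyc (path-map proj₁ p) (proj₁ d) perm
      , λ { (here refl , j) → proj₂ d j ; (there i , j) → proj₂ (path-pairs p i) j }

    abstract
      one-cycle : (S : Struct) → Disjoint (concat (reserved S)) (concat Ms) →
        ∃ λ c → Disjoint (arcs c) (concat Ms)
      one-cycle S free =
        from-path (Step.hamilton-cycle (record { V = Fin n ; _≟_ = Fin._≟_ {n} ; T = Arcs ; D = D ; W = allFin n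
            ; W-unique = Uₚ.allFin⁺ n ; W-all = ∈-allFin ; s = r + r ; miss = miss ; miss≤ = miss≤
            ; adjacent = adjacent ; Γ = Γ S ; covs = covs S ; r = r ; outMiss = outMiss ; inMiss = inMiss
            ; outMiss≤ = outMiss≤ ; inMiss≤ = inMiss≤ ; out-arc = out-arc ; in-arc = in-arc
            ; gap-unique = gap-unique S ; cov-unique = cov-unique S ; cov-gap = cov-gap S ; cov-arcs = cov-arcs′
            ; gap-middle = gap-middle S ; covered = covered S ; X = X ; EA = EA ; EB = EB ; gap⊆X = gap⊆X S
            ; cov⊆X = cov⊆X S ; leave = leaveD ; enter = enterD ; leave′ = leaveD′ ; enter′ = enterD′ })
          spine′ (track-unique S) (gaps-in S) (edges-in S) (into S) (outOf S) (middle-good S) (enough S))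
        where
        cov-arcs′ : ∀ {c} → c ∈ covs S → D (Cover.from c) (Cover.at c) × D (Cover.at c) (Cover.to c)
        cov-arcs′ i = (proj₁ (cov-arcs S i) , λ j → free (inward-reserved S i , j))
                    , (proj₂ (cov-arcs S i) , λ j → free (outward-reserved S i , j))
        leaveD : ∀ v l → length l ≤ 3 * length X → ∃ λ z → D v z × z ∉ l
        leaveD v = go-out v (leave v)
        enterD : ∀ v l → length l ≤ 3 * length X → ∃ λ z → D z v × z ∉ l
        enterD v = go-in v (enter v)
        leaveD′ : ∀ v l → v ∉ X → length l ≤ 3 * length (X ++ EA) → ∃ λ z → D v z × z ∉ l
        leaveD′ v l n = go-out v (λ l → leave′ v l n) l
        enterD′ : ∀ v l → v ∉ X → length l ≤ 3 * length (X ++ EA ++ EB) → ∃ λ z → D z v × z ∉ l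
        enterD′ v l n = go-in v (λ l → enter′ v l n) l
        spine′ : Path D (source S) (target S) (track S)
        spine′ = pairs-path (spine S) (λ i → path-pairs (spine S) i , λ j → free (∈-++⁺ˡ i , j))

  concatMap-reserved : ∀ {S Ss e} → S ∈ Ss → e ∈ concat (reserved S) → e ∈ concat (concatMap reserved Ss)
  concatMap-reserved {S} {_ ∷ Ss} (here refl) j =
    subst (_ ∈_) (Lₚ.concat-++ (reserved S) (concatMap reserved Ss)) (∈-++⁺ˡ j)
  concatMap-reserved {S} {S′ ∷ Ss} (there i) j =
    subst (_ ∈_) (Lₚ.concat-++ (reserved S′) (concatMap reserved Ss))
      (∈-++⁺ʳ (concat (reserved S′)) (concatMap-reserved i j))

  concatMap-reserved⁻ : ∀ Ss {e} → e ∈ concat (concatMap reserved Ss) → ∃ λ S → S ∈ Ss × e ∈ concat (reserved S)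
  concatMap-reserved⁻ (S ∷ Ss) i
    with ∈-++⁻ (concat (reserved S)) (subst (_ ∈_) (sym (Lₚ.concat-++ (reserved S) (concatMap reserved Ss))) i)
  ... | inj₁ j = S , here refl , j
  ... | inj₂ j with concatMap-reserved⁻ Ss j
  ...   | S′ , k , l = S′ , there k , l

  length-reserved : ∀ Ss → length (concatMap reserved Ss) ≡ 3 * length Ss
  length-reserved [] = refl
  length-reserved (S ∷ Ss) = trans (cong (3 +_) (length-reserved Ss)) (sym (ℕₚ.*-suc 3 (length Ss)))

  matching-reserved : ∀ Ss → All Matching (concatMap reserved Ss)
  matching-reserved [] = []
  matching-reserved (S ∷ Ss) = Allₚ.++⁺ (reserved-matching S) (matching-reserved Ss)

  -- `Ms` holds the arcs of the cycles found so far. A finished cycle replaces three reserved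
  -- matchings by a single one, so the number of forbidden matchings stays within `r`. The invariant
  -- that no finished cycle uses a reserved arc keeps every later track usable.
  packing : ∀ Ms (Ss : List Struct) → All Matching Ms → length Ms + 3 * length Ss ≤ r → Unique (concatMap track Ss) →
    (∀ {S} → S ∈ Ss → Disjoint (concat (reserved S)) (concat Ms)) →
    ∃ λ cs → length cs ≡ length Ss × AllPairs Apart cs × All (λ c → Disjoint (arcs c) (concat Ms)) cs
  packing Ms [] _ _ _ _ = [] , refl , [] , []
  packing Ms (S ∷ Ss) mat le uq free
    with Avoiding.one-cycle (Ms ++ concatMap reserved Ss) (Allₚ.++⁺ mat (matching-reserved Ss)) few S free′
    where
    few : length (Ms ++ concatMap reserved Ss) ≤ r
    few = ≤-trans (≤-reflexive (trans (Lₚ.length-++ Ms) (cong (length Ms +_) (length-reserved Ss))))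
      (≤-trans (ℕₚ.+-monoʳ-≤ (length Ms) (ℕₚ.*-monoʳ-≤ 3 (ℕₚ.n≤1+n (length Ss)))) le)
    free′ : Disjoint (concat (reserved S)) (concat (Ms ++ concatMap reserved Ss))
    free′ (i , j) with ∈-++⁻ (concat Ms) (subst (_ ∈_) (sym (Lₚ.concat-++ Ms (concatMap reserved Ss))) j)
    ... | inj₁ k = free (here refl) (i , k)
    ... | inj₂ k with concatMap-reserved⁻ Ss k
    ...   | S′ , m , i′ = unique-++-disjoint (track S) uq (reserved-tail S i , ∈-concatMap⁺′ track m (reserved-tail S′ i′))
  ... | c , apart = result (packing (arcs c ∷ Ms) Ss (arcs-matching c ∷ mat)
          (≤-trans (≤-trans (ℕₚ.m≤n+m _ 2) (≤-reflexive eq)) le)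
          (unique-++ʳ (track S) uq) free″)
    where
    eq : 2 + (suc (length Ms) + 3 * length Ss) ≡ length Ms + 3 * suc (length Ss)
    eq = solve 2 (λ m s → con 2 :+ (con 1 :+ m :+ con 3 :* s) := m :+ con 3 :* (con 1 :+ s)) refl (length Ms) (length Ss)
      where open +-*-Solver
    in-Ms : ∀ {e} → e ∈ concat Ms → e ∈ concat (Ms ++ concatMap reserved Ss)
    in-Ms i = subst (_ ∈_) (Lₚ.concat-++ Ms (concatMap reserved Ss)) (∈-++⁺ˡ i)
    free″ : ∀ {S′} → S′ ∈ Ss → Disjoint (concat (reserved S′)) (arcs c ++ concat Ms)
    free″ i (j , k) with ∈-++⁻ (arcs c) k
    ... | inj₁ a = apart (a , subst (_ ∈_) (Lₚ.concat-++ Ms (concatMap reserved Ss)) (∈-++⁺ʳ (concat Ms) (concatMap-reserved i j)))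
    ... | inj₂ b = free (there i) (j , b)
    result : (∃ λ cs → length cs ≡ length Ss × AllPairs Apart cs × All (λ c′ → Disjoint (arcs c′) (arcs c ++ concat Ms)) cs) →
      ∃ λ cs → length cs ≡ suc (length Ss) × AllPairs Apart cs × All (λ c → Disjoint (arcs c) (concat Ms)) cs
    result (cs , e , ap , al) = c ∷ cs , cong suc e
      , seps al ∷ ap
      , (λ (i , j) → apart (i , in-Ms j)) ∷ laters al
      where
      seps : ∀ {cs} → All (λ c′ → Disjoint (arcs c′) (arcs c ++ concat Ms)) cs → All (Apart c) cs
      seps [] = []
      seps (d ∷ ds) = (λ (i , j) → d (j , ∈-++⁺ˡ i)) ∷ seps ds
      laters : ∀ {cs} → All (λ c′ → Disjoint (arcs c′) (arcs c ++ concat Ms)) cs →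
        All (λ c′ → Disjoint (arcs c′) (concat Ms)) cs
      laters [] = []
      laters (d ∷ ds) = (λ (i , j) → d (i , ∈-++⁺ʳ (arcs c) j)) ∷ laters ds

  pack : ∀ (Ss : List Struct) → 3 * length Ss ≤ r → Unique (concatMap track Ss) → Packing (length Ss)
  pack Ss le uq with packing [] Ss [] le uq (λ _ ())
  ... | cs , e , ap , _ = cs , e , ap

-- Vertex lists as subsets

module _ {n : ℕ} where

  subset : List (Fin n) → Subset n
  subset [] = Sub.⊥
  subset (x ∷ l) = subset l Vec.[ x ]≔ inside

  size-insert : ∀ {k} (p : Subset k) x → ∣ p Vec.[ x ]≔ inside ∣ ≤ suc ∣ p ∣
  size-insert (inside Vec.∷ p) Fin.zero = ℕₚ.n≤1+n _
  size-insert (outside Vec.∷ p) Fin.zero = ≤-refl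
  size-insert (inside Vec.∷ p) (Fin.suc x) = s≤s (size-insert p x)
  size-insert (outside Vec.∷ p) (Fin.suc x) = size-insert p x

  size-subset : ∀ l → ∣ subset l ∣ ≤ length l
  size-subset [] = ≤-reflexive (Subₚ.∣⊥∣≡0 n)
  size-subset (x ∷ l) = ≤-trans (size-insert (subset l) x) (s≤s (size-subset l))

  ∈-subset : ∀ {v} l → v ∈ l → v Sub.∈ subset l
  ∈-subset (x ∷ l) (here refl) = Vecₚ.[]≔-updates (subset l) x
  ∈-subset {v} (x ∷ l) (there i) with v Fin.≟ x
  ... | yes refl = Vecₚ.[]≔-updates (subset l) x
  ... | no ne = Vecₚ.[]≔-minimal (subset l) v x ne (∈-subset l i)

  ∈-subset⁻ : ∀ {v} l → v Sub.∈ subset l → v ∈ l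
  ∈-subset⁻ [] i = contradiction i Subₚ.∉⊥
  ∈-subset⁻ {v} (x ∷ l) i with v Fin.≟ x
  ... | yes refl = here refl
  ... | no ne = there (∈-subset⁻ l (Vecₚ.lookup⇒[]= v (subset l)
    (trans (sym (Vecₚ.lookup∘updateAt′ v x ne (subset l))) (Vecₚ.[]=⇒lookup i))))

-- Dominating paths in tournaments

module Tournament {n : ℕ} (T : Digraph n) where

  open Cycles T using (Arcs) public
  open Eq (Fin._≟_ {n})

  arc? : ∀ u v → Dec (T u v ≡ true)
  arc? u v = T u v Boolₚ.≟ true

  outN : Fin n → List (Fin n)
  outN v = filter (arc? v) (allFin n)

  outN-unique : ∀ v → Unique (outN v)
  outN-unique v = Uₚ.filter⁺ (arc? v) (Uₚ.allFin⁺ n)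

  ∈-outN⁺ : ∀ {u v} → T u v ≡ true → v ∈ outN u
  ∈-outN⁺ {u} {v} e = ∈-filter⁺ (arc? u) (∈-allFin v) e

  ∈-outN⁻ : ∀ {u v} → v ∈ outN u → T u v ≡ true
  ∈-outN⁻ {u} i = proj₂ (∈-filter⁻ (arc? u) {xs = allFin n} i)

  out-escape : ∀ v l → length l < length (outN v) → ∃ λ z → T v z ≡ true × z ∉ l
  out-escape v l lt with escape l (outN-unique v) lt
  ... | z , i , n = z , ∈-outN⁻ i , n

  Connected : ℕ → Set
  Connected K = ∀ l → length l < K → ∀ {u v} → u ∉ l → v ∉ l → ∃ λ p → Path Arcs u v p × Disjoint p l

  connected : ∀ {K} → StronglyConnected K T → Connected K
  connected (_ , sc) l lt {u} {v} nu nv =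
    go (sc (subset l) (≤-trans (s≤s (size-subset l)) lt) u v (nu ∘ ∈-subset⁻ l) (nv ∘ ∈-subset⁻ l))
    where
    go : ∀ {u v} → PathAvoiding T (subset l) u v → ∃ λ p → Path Arcs u v p × Disjoint p l
    go (here n) = _ , point _ , λ { (here refl , j) → n (∈-subset l j) }
    go (step n e p) with go p
    ... | q , r , d = _ , e ◅ r , λ { (here refl , j) → n (∈-subset l j) ; (there i , j) → d (i , j) }

  -- There is a vertex outside `v ∷ l`; the first arc of a path leading to it and avoiding the other
  -- vertices of `l` is as required. Thus connectivity bounds all degrees from below.
  connected⇒out : IsTournament T → ∀ {K} → K < n → Connected K → ∀ v l → length l < K → ∃ λ z → T v z ≡ true × z ∉ l
  connected⇒out tour {K} K<n conn v l lt
    with escape (v ∷ l) (Uₚ.allFin⁺ n)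
           (≤-trans (s≤s lt) (≤-trans K<n (≤-reflexive (sym (Lₚ.length-tabulate {n = n} id)))))
  ... | w , _ , w∉ = go (conn l′ (≤-trans (s≤s (Lₚ.length-filter (λ x → ¬? (x Fin.≟ v)) l)) lt) v∉ w∉′)
    where
    l′ = filter (λ x → ¬? (x Fin.≟ v)) l
    v∉ : v ∉ l′
    v∉ i = proj₂ (∈-filter⁻ (λ x → ¬? (x Fin.≟ v)) {xs = l} i) refl
    w∉′ : w ∉ l′
    w∉′ i = w∉ (there (proj₁ (∈-filter⁻ (λ x → ¬? (x Fin.≟ v)) {xs = l} i)))
    go : (∃ λ p → Path Arcs v w p × Disjoint p l′) → ∃ λ z → T v z ≡ true × z ∉ l
    go (_ , point _ , _) = contradiction (here refl) w∉
    go (_ , _◅_ {w = z} e p , d) = z , e , λ i → d (there (start-∈ p) , ∈-filter⁺ (λ x → ¬? (x Fin.≟ v)) i z≢v)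
      where
      z≢v : z ≢ v
      z≢v refl with trans (sym e) (proj₁ tour v)
      ... | ()

  degrees : IsTournament T → ∀ v → n ≤ suc (length (outN v) + length (filter (λ w → arc? w v) (allFin n)))
  degrees tour v = ≤-trans (≤-reflexive (sym (Lₚ.length-tabulate {n = n} id)))
    (≤-trans (unique-⊆⇒length≤ (Uₚ.allFin⁺ n) sub) (≤-reflexive (cong suc (Lₚ.length-++ (outN v)))))
    where
    sub : allFin n ⊆ v ∷ outN v ++ filter (λ w → arc? w v) (allFin n)
    sub {w} _ with w Fin.≟ v
    ... | yes refl = here refl
    ... | no ne with proj₂ tour v w (ne ∘ sym)
    ...   | inj₁ (e , _) = there (∈-++⁺ˡ (∈-outN⁺ e))
    ...   | inj₂ (_ , e) = there (∈-++⁺ʳ (outN v) (∈-filter⁺ (λ w → arc? w v) (∈-allFin w) e))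

transpose-tournament : ∀ {n} {T : Digraph n} → IsTournament T → IsTournament (transpose T)
transpose-tournament (irr , tot) = irr , λ u v ne → [ (λ (a , b) → inj₂ (b , a)) , (λ (a , b) → inj₁ (b , a)) ]′ (tot u v ne)

transpose-connected : ∀ {n} {T : Digraph n} {K} → Tournament.Connected T K → Tournament.Connected (transpose T) K
transpose-connected conn l lt nu nv with conn l lt nv nu
... | p , q , d = reverse p , path-reverse q , λ (i , j) → d (↭-∈ (Permₚ.↭-reverse p) i , j)

-- Vertices of least degree and double counting

module _ {V : Set} where

  argmin : (f : V → ℕ) (x : V) (xs : List V) → ∃ λ y → y ∈ x ∷ xs × (∀ {z} → z ∈ x ∷ xs → f y ≤ f z)
  argmin f x [] = x , here refl , λ { (here refl) → ≤-refl }
  argmin f x (x′ ∷ xs) with argmin f x′ xs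
  ... | y , i , min with ℕₚ.≤-total (f x) (f y)
  ...   | inj₁ le = x , here refl , λ { (here refl) → ≤-refl ; (there j) → ≤-trans le (min j) }
  ...   | inj₂ le = y , there i , λ { (here refl) → le ; (there j) → min j }

  record Least (f : V → ℕ) (K M : ℕ) (avail : List V) : Set where
    constructor least
    field
      chosen rest : List V
      threshold : ℕ
      split : avail ↭ chosen ++ rest
      size : length chosen ≡ M
      above : K ≤ threshold
      low : ∀ {v} → v ∈ chosen → f v ≤ threshold
      high : ∀ {v} → v ∈ rest → threshold ≤ f v

  abstract
    choose-least : ∀ f K M avail → M ≤ length avail → (∀ v → K ≤ f v) → Least f K M avail
    choose-least f K zero avail le all = least [] avail K ↭-refl refl ≤-refl (λ ()) (λ _ → all _)
    choose-least f K (suc M) avail le all with choose-least f K M avail (ℕₚ.<⇒≤ le) all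
    ... | least chosen [] t split size above low high =
      contradiction (≤-trans le (≤-reflexive (trans (Permₚ.↭-length split) (trans (Lₚ.length-++ chosen) (trans (ℕₚ.+-identityʳ _) size)))))
        (ℕₚ.<-irrefl refl)
    ... | least chosen (x ∷ xs) t split size above low high with argmin f x xs
    ...   | y , i , min with ∈-↭∷ i
    ...     | rest , perm = least (y ∷ chosen) rest (f y)
      (↭-trans split (↭-trans (Permₚ.++⁺ˡ chosen perm) (Permₚ.shift y chosen rest))) (cong suc size)
      (≤-trans above (high i)) (λ { (here refl) → ≤-refl ; (there j) → ≤-trans (low j) (high i) })
      (λ j → min (↭-∈ (↭-sym perm) (there j)))

  Σ[_]_ : List V → (V → ℕ) → ℕ
  Σ[ xs ] f = sum (map f xs)

  Σ-mono : ∀ xs {f g} → (∀ {x} → x ∈ xs → f x ≤ g x) → Σ[ xs ] f ≤ Σ[ xs ] g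
  Σ-mono [] le = z≤n
  Σ-mono (x ∷ xs) le = ℕₚ.+-mono-≤ (le (here refl)) (Σ-mono xs (le ∘ there))

  Σ-const : ∀ xs c → Σ[ xs ] (λ _ → c) ≡ length xs * c
  Σ-const [] c = refl
  Σ-const (x ∷ xs) c = cong (c +_) (Σ-const xs c)

  interchange : ∀ a b c d → (a + b) + (c + d) ≡ (a + c) + (b + d)
  interchange = solve 4 (λ a b c d → (a :+ b) :+ (c :+ d) := (a :+ c) :+ (b :+ d)) refl
    where open +-*-Solver

  Σ-+ : ∀ xs f g → Σ[ xs ] (λ x → f x + g x) ≡ Σ[ xs ] f + Σ[ xs ] g
  Σ-+ [] f g = refl
  Σ-+ (x ∷ xs) f g = trans (cong (f x + g x +_) (Σ-+ xs f g)) (interchange (f x) (g x) (Σ[ xs ] f) (Σ[ xs ] g))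

  Σ-swap : ∀ xs ys (c : V → V → ℕ) → Σ[ xs ] (λ x → Σ[ ys ] c x) ≡ Σ[ ys ] (λ y → Σ[ xs ] (λ x → c x y))
  Σ-swap [] ys c = sym (trans (Σ-const ys 0) (ℕₚ.*-zeroʳ (length ys)))
  Σ-swap (x ∷ xs) ys c = trans (cong (Σ[ ys ] c x +_) (Σ-swap xs ys c)) (sym (Σ-+ ys (c x) (λ y → Σ[ xs ] (λ x → c x y))))

module Halving {n : ℕ} (T : Digraph n) (tour : IsTournament T) where

  open Tournament T

  bit : Fin n → Fin n → ℕ
  bit u v with arc? u v
  ... | yes _ = 1
  ... | no _ = 0

  length-filter-bit : ∀ u N → length (filter (arc? u) N) ≡ Σ[ N ] bit u
  length-filter-bit u [] = refl
  length-filter-bit u (v ∷ N) with arc? u v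
  ... | yes _ = cong suc (length-filter-bit u N)
  ... | no _ = length-filter-bit u N

  bits : ∀ u v → bit u v + bit v u ≤ 1
  bits u v with arc? u v | arc? v u
  ... | no _ | no _ = z≤n
  ... | no _ | yes _ = s≤s z≤n
  ... | yes _ | no _ = s≤s z≤n
  ... | yes e | yes e′ with u Fin.≟ v
  ...   | yes refl with trans (sym e) (proj₁ tour u)
  ...     | ()
  bits u v | yes e | yes e′ | no ne with proj₂ tour u v ne
  ... | inj₁ (_ , f) with trans (sym e′) f
  ...   | ()
  bits u v | yes e | yes e′ | no ne | inj₂ (f , _) with trans (sym e) f
  ...   | ()

  -- Adding the double sum over ordered pairs to its transpose counts every pair at most once, as
  -- two vertices are joined by at most one arc.
  twice-arcs : ∀ N → Σ[ N ] (λ u → 2 * length (filter (arc? u) N)) ≤ length N * length N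
  twice-arcs N = begin
    Σ[ N ] (λ u → 2 * length (filter (arc? u) N))
      ≤⟨ Σ-mono N (λ {u} _ → ≤-reflexive (cong (2 *_) (length-filter-bit u N))) ⟩
    Σ[ N ] (λ u → 2 * (Σ[ N ] bit u))
      ≤⟨ Σ-mono N (λ {u} _ → ≤-reflexive (cong ((Σ[ N ] bit u) +_) (ℕₚ.+-identityʳ _))) ⟩
    Σ[ N ] (λ u → Σ[ N ] bit u + Σ[ N ] bit u)
      ≡⟨ Σ-+ N (λ u → Σ[ N ] bit u) (λ u → Σ[ N ] bit u) ⟩
    Σ[ N ] (λ u → Σ[ N ] bit u) + Σ[ N ] (λ u → Σ[ N ] bit u)
      ≡⟨ cong ((Σ[ N ] (λ u → Σ[ N ] bit u)) +_) (Σ-swap N N bit) ⟩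
    Σ[ N ] (λ u → Σ[ N ] bit u) + Σ[ N ] (λ u → Σ[ N ] (λ v → bit v u))
      ≡⟨ sym (Σ-+ N (λ u → Σ[ N ] bit u) (λ u → Σ[ N ] (λ v → bit v u))) ⟩
    Σ[ N ] (λ u → Σ[ N ] bit u + Σ[ N ] (λ v → bit v u))
      ≤⟨ Σ-mono N (λ {u} _ → ≤-trans (≤-reflexive (sym (Σ-+ N (bit u) (λ v → bit v u))))
           (Σ-mono N (λ {v} _ → bits u v))) ⟩
    Σ[ N ] (λ u → Σ[ N ] (λ v → 1))
      ≡⟨ Σ-const N _ ⟩
    length N * (Σ[ N ] (λ v → 1))
      ≡⟨ cong (length N *_) (trans (Σ-const N 1) (ℕₚ.*-identityʳ _)) ⟩
    length N * length N ∎
    where open ≤-Reasoning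

  abstract
    -- A vertex of least out-degree inside `N` will do, since the average out-degree is at most half
    -- of the size of `N`.
    halving : ∀ x xs → let N = x ∷ xs in ∃ λ v → v ∈ N × 2 * length (filter (arc? v) N) ≤ length N
    halving x xs with argmin (λ v → length (filter (arc? v) (x ∷ xs))) x xs
    ... | v , i , min = v , i , ℕₚ.*-cancelˡ-≤ (suc (length xs))
      (≤-trans (≤-trans (≤-reflexive (sym (Σ-const (x ∷ xs) _))) (Σ-mono (x ∷ xs) (λ j → ℕₚ.*-monoʳ-≤ 2 (min j)))) (twice-arcs (x ∷ xs)))

  record Dominating (c : ℕ) (v : Fin n) (N : List (Fin n)) : Set where
    constructor dominating
    field
      {end} : Fin n
      {tail} : List (Fin n)
      missed : List (Fin n)
      dpath : Path Arcs v end (v ∷ tail)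
      tail⊆ : tail ⊆ N
      tail-unique : Unique tail
      short : length tail ≤ c
      small : 2 ^ c * length missed ≤ length N
      dominates : ∀ {x} → x ∈ N → x ∈ missed ⊎ x ∈ tail ⊎ (∃ λ a → a ∈ tail × T x a ≡ true)

  abstract
    -- A vertex of `N` other than `w` that is not an out-neighbour of `w` sends an arc to `w`. Only
    -- the out-neighbours of `w` in `N` remain, at most half of `N`, and since `w` sends arcs to all
    -- of them the path can go on there.
    dominate : ∀ c v N → Unique N → (∀ {x} → x ∈ N → T v x ≡ true) → Dominating c v N
    dominate zero v N u arcs = dominating N (point v) (λ ()) [] z≤n (≤-reflexive (ℕₚ.+-identityʳ _)) inj₁
    dominate (suc c) v [] u arcs = dominating [] (point v) (λ ()) [] z≤n (≤-reflexive (ℕₚ.*-zeroʳ (2 ^ suc c))) (λ ())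
    dominate (suc c) v N@(x ∷ xs) u arcs with halving x xs
    ... | w , w∈ , half with dominate c w (filter (arc? w) N) (Uₚ.filter⁺ (arc? w) u)
                              (λ i → proj₂ (∈-filter⁻ (arc? w) {xs = N} i))
    ...   | dominating {tail = tail} missed p tail⊆ tail-unique short small dominates = dominating missed (arcs w∈ ◅ p)
      (λ { (here refl) → w∈ ; (there i) → proj₁ (∈-filter⁻ (arc? w) {xs = N} (tail⊆ i)) })
      (unique-∷ w∉ tail-unique) (s≤s short)
      (≤-trans (≤-reflexive (ℕₚ.*-assoc 2 (2 ^ c) (length missed))) (≤-trans (ℕₚ.*-monoʳ-≤ 2 small) half))
      dom
      where
      w∉ : w ∉ tail
      w∉ i with trans (sym (proj₂ (∈-filter⁻ (arc? w) {xs = N} (tail⊆ i)))) (proj₁ tour w)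
      ... | ()
      dom : ∀ {y} → y ∈ N → y ∈ missed ⊎ y ∈ w ∷ tail ⊎ (∃ λ a → a ∈ w ∷ tail × T y a ≡ true)
      dom {y} i with y Fin.≟ w
      ... | yes refl = inj₂ (inj₁ (here refl))
      ... | no ne with proj₂ tour y w ne
      ...   | inj₁ (e , _) = inj₂ (inj₂ (w , here refl , e))
      ...   | inj₂ (_ , e) with dominates (∈-filter⁺ (arc? w) i e)
      ...     | inj₁ j = inj₁ j
      ...     | inj₂ (inj₁ j) = inj₂ (inj₁ (there j))
      ...     | inj₂ (inj₂ (a , j , f)) = inj₂ (inj₂ (a , there j , f))

-- Disjoint choices one after the other, each avoiding all earlier ones, as long as everything
-- together has at most `B` vertices. The property `Q` may refer to the vertices in use; it has to
-- be monotone because that set grows with every later choice.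
module Greedy {V A O : Set} (key : O → A) (vs : O → List V) (Q : O → List V → Set)
  (mono : ∀ {o U U′} → U ⊆ U′ → Q o U → Q o U′) (P : A → Set) (s B : ℕ)
  (choose : ∀ a U → P a → length U ≤ B → ∃ λ o → key o ≡ a × Unique (vs o) × Disjoint (vs o) U ×
    length (vs o) ≤ s × Q o (vs o ++ U)) where

  record Chosen (xs : List A) (U : List V) : Set where
    constructor picked
    field
      os : List O
      keys : map key os ≡ xs
      uniq : Unique (concatMap vs os)
      fresh : Disjoint (concatMap vs os) U
      size : length (concatMap vs os) ≤ length xs * s
      props : ∀ {o} → o ∈ os → Q o (concatMap vs os ++ U)

  abstract
    greedy : ∀ xs U → All P xs → length U + length xs * s ≤ B → Chosen xs U
    greedy [] U ps le = picked [] refl [] (λ ()) z≤n (λ ())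
    greedy (x ∷ xs) U (p ∷ ps) le with choose x U p (≤-trans (ℕₚ.m≤m+n _ _) le)
    ... | o , refl , u , d , sz , q with greedy xs (vs o ++ U) ps
          (≤-trans (≤-trans (≤-reflexive (trans (cong (_+ length xs * s) (trans (Lₚ.length-++ (vs o)) (ℕₚ.+-comm (length (vs o)) (length U))))
              (ℕₚ.+-assoc (length U) (length (vs o)) (length xs * s))))
            (ℕₚ.+-monoʳ-≤ (length U) (ℕₚ.+-monoˡ-≤ (length xs * s) sz))) le)
    ...   | picked os keys uniq fresh size props = picked (o ∷ os) (cong (key o ∷_) keys)
      (Uₚ.++⁺ u uniq (λ (i , j) → fresh (j , ∈-++⁺ˡ i)))
      (λ (i , j) → [ (λ a → d (a , j)) , (λ b → fresh (b , ∈-++⁺ʳ (vs o) j)) ]′ (∈-++⁻ (vs o) i))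
      (≤-trans (≤-reflexive (Lₚ.length-++ (vs o))) (ℕₚ.+-mono-≤ sz size))
      λ { (here refl) → mono (sub₁ (concatMap vs os)) q ; (there i) → mono (sub₂ (concatMap vs os)) (props i) }
      where
      sub₁ : ∀ W → vs o ++ U ⊆ (vs o ++ W) ++ U
      sub₁ W i = [ (λ j → ∈-++⁺ˡ (∈-++⁺ˡ j)) , ∈-++⁺ʳ (vs o ++ W) ]′ (∈-++⁻ (vs o) i)
      sub₂ : ∀ W → W ++ vs o ++ U ⊆ (vs o ++ W) ++ U
      sub₂ W i with ∈-++⁻ W i
      ... | inj₁ j = ∈-++⁺ˡ (∈-++⁺ʳ (vs o) j)
      ... | inj₂ j = sub₁ W j

split-list : ∀ {A : Set} a b (xs : List A) → length xs ≡ a + b →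
  ∃₂ λ ys zs → xs ≡ ys ++ zs × length ys ≡ a × length zs ≡ b
split-list zero b xs e = [] , xs , refl , refl , e
split-list (suc a) b (x ∷ xs) e with split-list a b xs (ℕₚ.suc-injective e)
... | ys , zs , refl , e₁ , e₂ = x ∷ ys , zs , refl , cong suc e₁ , e₂

chunks : ∀ {A : Set} k m (xs : List A) → length xs ≡ k * m →
  ∃ λ xss → concat xss ≡ xs × length xss ≡ k × All (λ ys → length ys ≡ m) xss
chunks zero m [] e = [] , refl , refl , []
chunks (suc k) m xs e with split-list m (k * m) xs e
... | ys , zs , refl , e₁ , e₂ with chunks k m zs e₂
...   | xss , refl , e₃ , al = ys ∷ xss , refl , cong suc e₃ , e₁ ∷ al

zipped : ∀ {A : Set} (xs ys : List A) → length xs ≡ length ys →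
  ∃ λ ps → length ps ≡ length xs × concatMap (λ p → proj₁ p ∷ proj₂ p ∷ []) ps ↭ xs ++ ys ×
    All (λ p → proj₁ p ∈ xs × proj₂ p ∈ ys) ps
zipped [] [] e = [] , refl , ↭-refl , []
zipped (x ∷ xs) (y ∷ ys) e with zipped xs ys (ℕₚ.suc-injective e)
... | ps , l , perm , al = (x , y) ∷ ps , cong suc l
  , prep x (↭-trans (prep y perm) (↭-sym (Permₚ.shift y xs ys)))
  , (here refl , here refl) ∷ All.map (λ (i , j) → there i , there j) al

concatMap-split : ∀ {A B : Set} (f g h : B → List A) → (∀ b → f b ↭ g b ++ h b) → ∀ bs →
  concatMap f bs ↭ concatMap g bs ++ concatMap h bs
concatMap-split f g h p [] = ↭-refl
concatMap-split f g h p (b ∷ bs) = ↭-trans (Permₚ.++⁺ (p b) (concatMap-split f g h p bs))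
  (solve 4 (λ g h g′ h′ → (g ⊕ h) ⊕ g′ ⊕ h′ ⊜ (g ⊕ g′) ⊕ h ⊕ h′) ↭-refl (g b) (h b) (concatMap g bs) (concatMap h bs))
  where open ↭-Solver

concatMap-map′ : ∀ {A B C : Set} (f : B → List A) (g : C → B) cs → concatMap f (map g cs) ≡ concatMap (f ∘ g) cs
concatMap-map′ f g [] = refl
concatMap-map′ f g (c ∷ cs) = cong (f (g c) ++_) (concatMap-map′ f g cs)

concatMap-length≤ : ∀ {A B : Set} (f : B → List A) s bs → (∀ {b} → b ∈ bs → length (f b) ≤ s) → length (concatMap f bs) ≤ length bs * s
concatMap-length≤ f s [] le = z≤n
concatMap-length≤ f s (b ∷ bs) le = ≤-trans (≤-reflexive (Lₚ.length-++ (f b)))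
  (ℕₚ.+-mono-≤ (le (here refl)) (concatMap-length≤ f s bs (le ∘ there)))

-- Vertices of extreme degree and their dominating paths

record Extremal {n : ℕ} (T : Digraph n) (M K : ℕ) : Set where
  open Tournament
  field
    S⁺ S⁻ : List (Fin n)
    D⁺ D⁻ : ℕ
    len⁺ : length S⁺ ≡ M
    len⁻ : length S⁻ ≡ M
    uniq : Unique (S⁺ ++ S⁻)
    low⁺ : ∀ {v} → v ∈ S⁺ → length (outN T v) ≤ D⁺
    low⁻ : ∀ {v} → v ∈ S⁻ → length (outN (transpose T) v) ≤ D⁻
    high⁺ : ∀ {v} → v ∉ S⁺ ++ S⁻ → D⁺ ≤ length (outN T v)
    high⁻ : ∀ {v} → v ∉ S⁺ ++ S⁻ → D⁻ ≤ length (outN (transpose T) v)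
    K≤D⁺ : K ≤ D⁺
    K≤D⁻ : K ≤ D⁻

++-swap-∉ : ∀ {A : Set} {v : A} xs {ys} → v ∉ ys ++ xs → v ∉ xs ++ ys
++-swap-∉ xs {ys} n i = n ([ ∈-++⁺ʳ ys , ∈-++⁺ˡ ]′ (∈-++⁻ xs i))

transpose-extremal : ∀ {n} {T : Digraph n} {M K} → Extremal T M K → Extremal (transpose T) M K
transpose-extremal E = record
  { S⁺ = S⁻ ; S⁻ = S⁺ ; D⁺ = D⁻ ; D⁻ = D⁺ ; len⁺ = len⁻ ; len⁻ = len⁺
  ; uniq = Unique-resp-↭ (Permₚ.++-comm S⁺ S⁻) uniq
  ; low⁺ = low⁻ ; low⁻ = low⁺
  ; high⁺ = λ n → high⁻ (++-swap-∉ S⁺ n) ; high⁻ = λ n → high⁺ (++-swap-∉ S⁺ n)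
  ; K≤D⁺ = K≤D⁻ ; K≤D⁻ = K≤D⁺ }
  where open Extremal E

-- To keep the two sets disjoint, `S⁻` consists of the vertices of least in-degree among those left
-- over by `S⁺`; accordingly the lower bounds on degrees are claimed only outside both.
extremal : ∀ {n} (T : Digraph n) M K → M + M ≤ n →
  (∀ v → K ≤ length (Tournament.outN T v)) → (∀ v → K ≤ length (Tournament.outN (transpose T) v)) → Extremal T M K
extremal {n} T M K le out-K in-K = record
  { S⁺ = L₁.chosen ; S⁻ = L₂.chosen ; D⁺ = L₁.threshold ; D⁻ = L₂.threshold
  ; len⁺ = L₁.size ; len⁻ = L₂.size
  ; uniq = unique-++ˡ (L₁.chosen ++ L₂.chosen) (Unique-resp-↭ all (Uₚ.allFin⁺ n))
  ; low⁺ = L₁.low ; low⁻ = L₂.low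
  ; high⁺ = λ {v} ne → L₁.high (outside₁ ne)
  ; high⁻ = λ {v} ne → L₂.high (outside₂ ne)
  ; K≤D⁺ = L₁.above ; K≤D⁻ = L₂.above }
  where
  open Tournament
  l₁ : Least (λ v → length (outN T v)) K M (allFin n)
  l₁ = choose-least _ K M (allFin n) (≤-trans (ℕₚ.m≤m+n M M) (≤-trans le (≤-reflexive (sym (Lₚ.length-tabulate {n = n} id))))) out-K
  module L₁ = Least l₁
  room : M ≤ length L₁.rest
  room = ℕₚ.+-cancelˡ-≤ M _ _ (≤-trans le (≤-reflexive (trans (sym (Lₚ.length-tabulate {n = n} id))
    (trans (Permₚ.↭-length L₁.split) (trans (Lₚ.length-++ L₁.chosen) (cong (_+ length L₁.rest) L₁.size))))))
  l₂ : Least (λ v → length (outN (transpose T) v)) K M L₁.rest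
  l₂ = choose-least _ K M L₁.rest room in-K
  module L₂ = Least l₂
  all : allFin n ↭ (L₁.chosen ++ L₂.chosen) ++ L₂.rest
  all = ↭-trans L₁.split (↭-trans (Permₚ.++⁺ˡ L₁.chosen L₂.split) (↭-reflexive (sym (Lₚ.++-assoc L₁.chosen L₂.chosen L₂.rest))))
  outside₂ : ∀ {v} → v ∉ L₁.chosen ++ L₂.chosen → v ∈ L₂.rest
  outside₂ {v} ne with ∈-++⁻ (L₁.chosen ++ L₂.chosen) (↭-∈ all (∈-allFin v))
  ... | inj₁ i = contradiction i ne
  ... | inj₂ i = i
  outside₁ : ∀ {v} → v ∉ L₁.chosen ++ L₂.chosen → v ∈ L₁.rest
  outside₁ ne = ↭-∈ (↭-sym L₂.split) (∈-++⁺ʳ L₂.chosen (outside₂ ne))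

module Pairs {n : ℕ} (T : Digraph n) (tour : IsTournament T) (M K c : ℕ) (E : Extremal T M K) where

  open Extremal E
  open Eq (Fin._≟_ {n})
  module O = Tournament T
  module I = Tournament (transpose T)
  module HO = Halving T tour
  module HI = Halving (transpose T) (transpose-tournament tour)

  V : Set
  V = Fin n

  record Pair : Set where
    constructor pair
    field
      entry₀ exit₀ sink source : V
      tailA tailB missA missB : List V
      pathA : Path O.Arcs entry₀ sink (entry₀ ∷ tailA)
      pathB : Path I.Arcs exit₀ source (exit₀ ∷ tailB)
      entry₀∈ : entry₀ ∈ S⁺
      exit₀∈ : exit₀ ∈ S⁻
      missA≤ : 2 ^ c * length missA ≤ D⁺
      missB≤ : 2 ^ c * length missB ≤ D⁻
      tails≤ : length (tailA ++ tailB) ≤ c + c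

    listA listB : List V
    listA = entry₀ ∷ tailA
    listB = exit₀ ∷ tailB

    tails vertices : List V
    tails = tailA ++ tailB
    vertices = listA ++ listB

    heads : V × V
    heads = entry₀ , exit₀

  open Pair

  -- Vertices of `U` are exempt because they are removed from a neighbourhood before it is halved,
  -- which is what keeps the paths disjoint.
  Dominates : Pair → List V → Set
  Dominates p U = (∀ {x} → x ∉ U → x ≢ entry₀ p → x ∉ missA p → ∃ λ a → a ∈ listA p × T x a ≡ true) ×
                  (∀ {x} → x ∉ U → x ≢ exit₀ p → x ∉ missB p → ∃ λ b → b ∈ listB p × T b x ≡ true)

  -- A vertex that does not send an arc to `a` is an out-neighbour of `a`, and those outside `U` are
  -- exactly the vertices to which the halving is applied. The second path is obtained in the same
  -- way in the transposed tournament, avoiding the first one too.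
  choose-pair : ∀ h U → proj₁ h ∈ S⁺ × proj₂ h ∈ S⁻ → length U ≤ length U → ∃ λ p → heads p ≡ h × Unique (tails p) ×
    Disjoint (tails p) U × length (tails p) ≤ c + c × Dominates p (tails p ++ U)
  choose-pair (a , b) U (a∈ , b∈) _ = build (HO.dominate c a NA (Uₚ.filter⁺ _ (O.outN-unique a)) (λ i → O.∈-outN⁻ (proj₁ (∈-filter⁻ _ {xs = O.outN a} i))))
    where
    NA = filter (λ x → ¬? (x ∈? U)) (O.outN a)
    build : HO.Dominating c a NA → ∃ λ p → heads p ≡ (a , b) × Unique (tails p) ×
      Disjoint (tails p) U × length (tails p) ≤ c + c × Dominates p (tails p ++ U)
    build (HO.dominating {tail = tA} mA pA tA⊆ tA-u tA≤ mA≤ domA) =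
      build′ (HI.dominate c b NB (Uₚ.filter⁺ _ (I.outN-unique b)) (λ i → I.∈-outN⁻ (proj₁ (∈-filter⁻ _ {xs = I.outN b} i))))
      where
      NB = filter (λ x → ¬? (x ∈? tA ++ U)) (I.outN b)
      build′ : HI.Dominating c b NB → ∃ λ p → heads p ≡ (a , b) × Unique (tails p) ×
        Disjoint (tails p) U × length (tails p) ≤ c + c × Dominates p (tails p ++ U)
      build′ (HI.dominating {tail = tB} mB pB tB⊆ tB-u tB≤ mB≤ domB) = record
        { entry₀ = a ; exit₀ = b ; tailA = tA ; tailB = tB ; missA = mA ; missB = mB ; pathA = pA ; pathB = pB
        ; entry₀∈ = a∈ ; exit₀∈ = b∈
        -- This is where least degrees pay off: the halved set consists of out-neighbours of a
        -- vertex of `S⁺`, so it has at most `D⁺` elements.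
        ; missA≤ = ≤-trans mA≤ (≤-trans (Lₚ.length-filter _ (O.outN a)) (low⁺ a∈))
        ; missB≤ = ≤-trans mB≤ (≤-trans (Lₚ.length-filter _ (I.outN b)) (low⁻ b∈))
        ; tails≤ = ≤-trans (≤-reflexive (Lₚ.length-++ tA)) (ℕₚ.+-mono-≤ tA≤ tB≤) }
        , refl
        , Uₚ.++⁺ tA-u tB-u (λ (i , j) → tB∉ j (∈-++⁺ˡ i))
        , (λ (i , j) → [ (λ i → tA∉ i j) , (λ i → tB∉ i (∈-++⁺ʳ tA j)) ]′ (∈-++⁻ tA i))
        , ≤-trans (≤-reflexive (Lₚ.length-++ tA)) (ℕₚ.+-mono-≤ tA≤ tB≤)
        , domA′ , domB′
        where
        tA∉ : ∀ {x} → x ∈ tA → x ∉ U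
        tA∉ i = proj₂ (∈-filter⁻ (λ x → ¬? (x ∈? U)) {xs = O.outN a} (tA⊆ i))
        tB∉ : ∀ {x} → x ∈ tB → x ∉ tA ++ U
        tB∉ i = proj₂ (∈-filter⁻ (λ x → ¬? (x ∈? tA ++ U)) {xs = I.outN b} (tB⊆ i))
        domA′ : ∀ {x} → x ∉ (tA ++ tB) ++ U → x ≢ a → x ∉ mA → ∃ λ y → y ∈ a ∷ tA × T x y ≡ true
        domA′ {x} x∉ ne x∉m with proj₂ tour x a ne
        ... | inj₁ (e , _) = a , here refl , e
        ... | inj₂ (_ , e) with domA (∈-filter⁺ (λ x → ¬? (x ∈? U)) (O.∈-outN⁺ e) (x∉ ∘ ∈-++⁺ʳ (tA ++ tB)))
        ...   | inj₁ i = contradiction i x∉m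
        ...   | inj₂ (inj₁ i) = contradiction (∈-++⁺ˡ (∈-++⁺ˡ i)) x∉
        ...   | inj₂ (inj₂ (y , i , f)) = y , there i , f
        domB′ : ∀ {x} → x ∉ (tA ++ tB) ++ U → x ≢ b → x ∉ mB → ∃ λ y → y ∈ b ∷ tB × T y x ≡ true
        domB′ {x} x∉ ne x∉m with proj₂ tour b x (ne ∘ sym)
        ... | inj₁ (e , _) = b , here refl , e
        ... | inj₂ (_ , e) with domB (∈-filter⁺ (λ x → ¬? (x ∈? tA ++ U)) (I.∈-outN⁺ e)
                (λ i → x∉ ([ ∈-++⁺ˡ ∘ ∈-++⁺ˡ , ∈-++⁺ʳ (tA ++ tB) ]′ (∈-++⁻ tA i))))
        ...   | inj₁ i = contradiction i x∉m
        ...   | inj₂ (inj₁ i) = contradiction (∈-++⁺ˡ (∈-++⁺ʳ tA i)) x∉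
        ...   | inj₂ (inj₂ (y , i , f)) = y , there i , f

  record Selection : Set where
    field
      pairs⁰ : List Pair
      count : length pairs⁰ ≡ M
      unique⁰ : Unique (concatMap vertices pairs⁰)
      extremes : S⁺ ++ S⁻ ⊆ concatMap vertices pairs⁰
      size⁰ : length (concatMap vertices pairs⁰) ≤ M * (2 + (c + c))
      dominatesA : ∀ {p x} → p ∈ pairs⁰ → x ∉ concatMap vertices pairs⁰ → x ∉ concatMap missA pairs⁰ →
        ∃ λ a → a ∈ listA p × T x a ≡ true
      dominatesB : ∀ {p x} → p ∈ pairs⁰ → x ∉ concatMap vertices pairs⁰ → x ∉ concatMap missB pairs⁰ →
        ∃ λ b → b ∈ listB p × T b x ≡ true

    EA EB : List V
    EA = concatMap missA pairs⁰
    EB = concatMap missB pairs⁰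

  abstract
    select : Selection
    select = build (zipped S⁺ S⁻ (trans len⁺ (sym len⁻)))
      where
      module G (B : ℕ) = Greedy {V} heads tails Dominates
        (λ s (f , g) → (λ n → f (n ∘ s)) , (λ n → g (n ∘ s)))
        (λ h → proj₁ h ∈ S⁺ × proj₂ h ∈ S⁻) (c + c) B (λ h U p _ → choose-pair h U p ≤-refl)
      build : (∃ λ ps → length ps ≡ length S⁺ × concatMap (λ p → proj₁ p ∷ proj₂ p ∷ []) ps ↭ S⁺ ++ S⁻ ×
        All (λ p → proj₁ p ∈ S⁺ × proj₂ p ∈ S⁻) ps) → Selection
      build (hs , len , perm , al) = finish (G.greedy room hs (S⁺ ++ S⁻) al ≤-refl)
        where
        room : ℕ
        room = length (S⁺ ++ S⁻) + length hs * (c + c)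
        finish : G.Chosen room hs (S⁺ ++ S⁻) → Selection
        finish (G.picked os keys uniq′ fresh size props) = record
          { pairs⁰ = os
          ; count = count′
          ; unique⁰ = Unique-resp-↭ (↭-sym parts) (Uₚ.++⁺ uniq uniq′ (λ (i , j) → fresh (j , i)))
          ; extremes = λ i → ↭-∈ (↭-sym parts) (∈-++⁺ˡ i)
          ; size⁰ = total
          ; dominatesA = λ {p} i n m → proj₁ (props i) (n ∘ used)
              (λ { refl → n (∈-concatMap⁺′ vertices i (here refl)) }) (λ j → m (∈-concatMap⁺′ missA i j))
          ; dominatesB = λ {p} i n m → proj₂ (props i) (n ∘ used)
              (λ { refl → n (∈-concatMap⁺′ vertices i (∈-++⁺ʳ (listA p) (here refl))) }) (λ j → m (∈-concatMap⁺′ missB i j)) }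
          where
          count′ : length os ≡ M
          count′ = trans (sym (Lₚ.length-map heads os)) (trans (cong length keys) (trans len len⁺))
          pv : Pair → List V
          pv p = entry₀ p ∷ exit₀ p ∷ []
          parts : concatMap vertices os ↭ (S⁺ ++ S⁻) ++ concatMap tails os
          parts = ↭-trans (concatMap-split vertices pv tails
              (λ p → prep (entry₀ p) (Permₚ.shift (exit₀ p) (tailA p) (tailB p))) os)
            (Permₚ.++⁺ʳ (concatMap tails os) (↭-trans
              (↭-reflexive (trans (sym (concatMap-map′ (λ p → proj₁ p ∷ proj₂ p ∷ []) heads os))
                (cong (concatMap (λ p → proj₁ p ∷ proj₂ p ∷ [])) keys))) perm))
          used : ∀ {x} → x ∈ concatMap tails os ++ S⁺ ++ S⁻ → x ∈ concatMap vertices os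
          used i = ↭-∈ (↭-sym parts) ([ ∈-++⁺ʳ (S⁺ ++ S⁻) , ∈-++⁺ˡ ]′ (∈-++⁻ (concatMap tails os) i))
          total : length (concatMap vertices os) ≤ M * (2 + (c + c))
          total = begin
            length (concatMap vertices os)              ≡⟨ Permₚ.↭-length parts ⟩
            length ((S⁺ ++ S⁻) ++ concatMap tails os)   ≡⟨ Lₚ.length-++ (S⁺ ++ S⁻) ⟩
            length (S⁺ ++ S⁻) + length (concatMap tails os)
              ≤⟨ ℕₚ.+-mono-≤ (≤-reflexive (trans (Lₚ.length-++ S⁺) (cong₂ _+_ len⁺ len⁻)))
                   (≤-trans size (≤-reflexive (cong (_* (c + c)) (trans len len⁺)))) ⟩
            (M + M) + M * (c + c)                       ≡⟨ solve 2 (λ m d → (m :+ m) :+ m :* d := m :* (con 2 :+ d)) refl M (c + c) ⟩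
            M * (2 + (c + c))                           ∎
            where
            open ≤-Reasoning
            open +-*-Solver

module Estimates where

  abstract
    below : ∀ h {a D} j → h * a ≤ j * D → j < h → 0 < D → a < D
    below h {a} {D} j le j< D>0 with suc a ≤? D
    ... | yes p = p
    ... | no n = contradiction (≤-trans (ℕₚ.*-monoʳ-≤ h (ℕₚ.≮⇒≥ n)) le) (ℕₚ.<⇒≱ (ℕₚ.*-monoˡ-< D {{>-nonZero D>0}} j<))

  abstract
    -- The origin of 28: of the quantity multiplied by `h`, the constant and the `M` term take 2`n`
    -- each, and six times `f` takes 24`n`.
    mid-arith : ∀ h n M f i → 28 < h → n ≤ 2 + 2 * M + 2 * i → h * M ≤ n → h ≤ n → h * f ≤ 4 * n → 3 * f < i
    mid-arith h n M f i h> le hM h1 hf with suc (3 * f) ≤? i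
    ... | yes p = p
    ... | no np = contradiction chain (ℕₚ.<⇒≱ (ℕₚ.*-monoˡ-< n {{>-nonZero (≤-trans (≤-trans (s≤s z≤n) h>) h1)}} h>))
      where
      open +-*-Solver
      chain : h * n ≤ 28 * n
      chain = begin
        h * n                                     ≤⟨ ℕₚ.*-monoʳ-≤ h (≤-trans le (ℕₚ.+-monoʳ-≤ (2 + 2 * M) (ℕₚ.*-monoʳ-≤ 2 (ℕₚ.≮⇒≥ np)))) ⟩
        h * (2 + 2 * M + 2 * (3 * f))             ≡⟨ solve 3 (λ h m f → h :* (con 2 :+ con 2 :* m :+ con 2 :* (con 3 :* f)) :=
                                                       con 2 :* h :+ con 2 :* (h :* m) :+ con 6 :* (h :* f)) refl h M f ⟩
        2 * h + 2 * (h * M) + 6 * (h * f)         ≤⟨ ℕₚ.+-mono-≤ (ℕₚ.+-mono-≤ (ℕₚ.*-monoʳ-≤ 2 h1) (ℕₚ.*-monoʳ-≤ 2 hM)) (ℕₚ.*-monoʳ-≤ 6 hf) ⟩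
        2 * n + 2 * n + 6 * (4 * n)               ≡⟨ solve 1 (λ n → con 2 :* n :+ con 2 :* n :+ con 6 :* (con 4 :* n) := con 28 :* n) refl n ⟩
        28 * n                                    ∎
        where open ≤-Reasoning

  abstract
    weigh : ∀ h x a b r D → h * x ≤ D → h * a ≤ D → h * b ≤ D → h * r ≤ D → h * (3 * (x + (a + b)) + r) ≤ 10 * D
    weigh h x a b r D hx ha hb hr = begin
      h * (3 * (x + (a + b)) + r)                            ≡⟨ solve 5 (λ h x a b r → h :* (con 3 :* (x :+ (a :+ b)) :+ r) :=
                                                                 con 3 :* (h :* x :+ (h :* a :+ h :* b)) :+ h :* r) refl h x a b r ⟩
      3 * (h * x + (h * a + h * b)) + h * r                  ≤⟨ ℕₚ.+-mono-≤ (ℕₚ.*-monoʳ-≤ 3 (ℕₚ.+-mono-≤ hx (ℕₚ.+-mono-≤ ha hb))) hr ⟩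
      3 * (D + (D + D)) + D                                  ≡⟨ solve 1 (λ d → con 3 :* (d :+ (d :+ d)) :+ d := con 10 :* d) refl D ⟩
      10 * D                                                 ∎
      where
      open ≤-Reasoning
      open +-*-Solver

open Estimates

-- Vertices chosen for one track with `m` gaps: two per bridge, two for the cover arc of each of the
-- at most `m * (4 + (c + c))` gap vertices, and four at the ends of every gap and every cover arc.
protoSize : ℕ → ℕ → ℕ
protoSize m c = m * 2 + (m * (4 + (c + c)) * 2 + (m + m * (4 + (c + c))) * 4)

module _ {V : Set} {R : V → V → Set} where

  walk-from : ∀ {u w l v} → Path R u w l → v ∈ l → ∃ λ l′ → Path R v w l′ × l′ ⊆ l
  walk-from (point u) (here refl) = _ , point u , id
  walk-from (e ◅ p) (here refl) = _ , e ◅ p , id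
  walk-from (e ◅ p) (there i) with walk-from p i
  ... | l′ , q , s = l′ , q , there ∘ s

  walk-to : ∀ {u w l v} → Path R u w l → v ∈ l → ∃ λ l′ → Path R u v l′ × l′ ⊆ l
  walk-to (point u) (here refl) = _ , point u , id
  walk-to {u} (e ◅ p) (here refl) = u ∷ [] , point u , λ { (here refl) → here refl }
  walk-to {u} (e ◅ p) (there i) with walk-to p i
  ... | l′ , q , s = u ∷ l′ , e ◅ q , λ { (here refl) → here refl ; (there j) → there (s j) }

concatMap-concatMap : ∀ {A B C : Set} (f : B → List A) (g : C → List B) cs →
  concatMap (λ c → concatMap f (g c)) cs ≡ concatMap f (concat (map g cs))
concatMap-concatMap f g [] = refl
concatMap-concatMap f g (c ∷ cs) = trans (cong (concatMap f (g c) ++_) (concatMap-concatMap f g cs))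
  (sym (concatMap-++ f (g c) (concat (map g cs))))

unique-map-blocks : ∀ {A B : Set} (f : B → List A) (g : B → A) bs → (∀ b → g b ∈ f b) → Unique (concatMap f bs) →
  Unique (map g bs)
unique-map-blocks f g [] i u = []
unique-map-blocks f g (b ∷ bs) i u = unique-∷ notin (unique-map-blocks f g bs i (unique-++ʳ (f b) u))
  where
  notin : g b ∉ map g bs
  notin j with ∈-map⁻ g j
  ... | b′ , k , e = unique-++-disjoint (f b) u (i b , ∈-concatMap⁺′ f k (subst (_∈ f b′) (sym e) (i b′)))

-- Construction of the reserved structures

record Setting : Set where
  field
    n : ℕ
    T : Digraph n
    tour : IsTournament T
    M K c : ℕ
    E : Extremal T M K
    sel : Pairs.Selection T tour M K c E
    K<n : K < n
    conn : Tournament.Connected T K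
    D≤ : Extremal.D⁺ E ≤ Extremal.D⁻ E
    h : ℕ
    h> : 28 < h
    B : ℕ
    B>0 : 0 < B
    B≤ : h * B ≤ K
    M+M≤B : M + M ≤ B
    PV≤ : length (concatMap (Pairs.Pair.vertices {T = T} {tour} {M} {K} {c} {E}) (Pairs.Selection.pairs⁰ sel)) ≤ B
    EA≤ : h * length (Pairs.Selection.EA sel) ≤ Extremal.D⁺ E
    EB≤ : h * length (Pairs.Selection.EB sel) ≤ Extremal.D⁻ E
    m B′ : ℕ
    B′≤ : B′ + protoSize m c ≤ B
    k q : ℕ
    M≡ : M ≡ k * m + q
    q≤B : q ≤ B
    room : length (concatMap (Pairs.Pair.vertices {T = T} {tour} {M} {K} {c} {E}) (Pairs.Selection.pairs⁰ sel)) + k * protoSize m c ≤ B′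
    m>0 : 0 < m
    ℓ : ℕ
    q≡ : q ≡ k * ℓ
    ℓ≥ : m + m * (4 + (c + c)) ≤ ℓ
    3k≤B : 3 * k ≤ B
    gaps≤ : partCount (3 * k + 3 * k) + suc (suc (3 * k + 3 * k + (3 * k + 3 * k))) ≤ m

module Construction (setting : Setting) where

  open Setting setting

  open Extremal E
  open Pairs T tour M K c E
  open Pair
  open Selection sel
  open Eq (Fin._≟_ {n})
  open PathEq (Fin._≟_ {n})
  open O using (Arcs)
  open System (Fin._≟_ {n}) Arcs using (Seg; seg; start; end; body; path)

  module Choices where

    PV : List V
    PV = concatMap vertices pairs⁰

    S : List V
    S = S⁺ ++ S⁻

    asym : ∀ {u v} → T u v ≡ true → T v u ≡ true → ⊥
    asym {u} {v} e f with u Fin.≟ v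
    ... | yes refl with trans (sym e) (proj₁ tour u)
    ...   | ()
    asym {u} {v} e f | no ne with proj₂ tour u v ne
    ... | inj₁ (_ , g) with trans (sym f) g
    ...   | ()
    asym {u} {v} e f | no ne | inj₂ (g , _) with trans (sym e) g
    ... | ()

    loopless : ∀ {u v} → T u v ≡ true → u ≢ v
    loopless e refl = asym e e

    abstract
      out-K : ∀ v l → length l < K → ∃ λ z → T v z ≡ true × z ∉ l
      out-K = O.connected⇒out tour K<n conn

      in-K : ∀ v l → length l < K → ∃ λ z → T z v ≡ true × z ∉ l
      in-K = I.connected⇒out (transpose-tournament tour) K<n (transpose-connected {T = T} conn)

    K>0 : 0 < K
    K>0 = ≤-trans (≤-trans (≤-trans (s≤s z≤n) (≤-trans h> (≤-reflexive (sym (ℕₚ.*-identityʳ h))))) (ℕₚ.*-monoʳ-≤ h B>0)) B≤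

    abstract
      small-K : ∀ {a} j → a ≤ j * B → j ≤ 28 → a < K
      small-K {a} j le j< = below h j (≤-trans (ℕₚ.*-monoʳ-≤ h le) (≤-trans
        (≤-reflexive (solve 3 (λ h j b → h :* (j :* b) := j :* (h :* b)) refl h j B)) (ℕₚ.*-monoʳ-≤ j B≤))) (≤-trans (s≤s j<) h>) K>0
        where open +-*-Solver

    abstract
      out-D : ∀ v l → v ∉ PV → length l < D⁺ → ∃ λ z → T v z ≡ true × z ∉ l
      out-D v l n lt = O.out-escape v l (≤-trans lt (high⁺ (n ∘ extremes)))

      in-D : ∀ v l → v ∉ PV → length l < D⁻ → ∃ λ z → T z v ≡ true × z ∉ l
      in-D v l n lt = I.out-escape v l (≤-trans lt (high⁻ (n ∘ extremes)))

    abstract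
      small-D⁺ : ∀ {a} → a ≤ 9 * B + length EA → a < D⁺
      small-D⁺ {a} le = below h 10 (begin
          h * a                            ≤⟨ ℕₚ.*-monoʳ-≤ h le ⟩
          h * (9 * B + length EA)          ≡⟨ solve 3 (λ h b e → h :* (con 9 :* b :+ e) := con 9 :* (h :* b) :+ h :* e) refl h B (length EA) ⟩
          9 * (h * B) + h * length EA   ≤⟨ ℕₚ.+-mono-≤ (ℕₚ.*-monoʳ-≤ 9 (≤-trans B≤ K≤D⁺)) EA≤ ⟩
          9 * D⁺ + D⁺                         ≡⟨ solve 1 (λ d → con 9 :* d :+ d := con 10 :* d) refl D⁺ ⟩
          10 * D⁺                             ∎) (≤-trans (ℕₚ.m≤m+n 11 18) h>) (≤-trans K>0 K≤D⁺)
        where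
        open ≤-Reasoning
        open +-*-Solver

      small-D⁻ : ∀ {a} → a ≤ 9 * B + length EB → a < D⁻
      small-D⁻ {a} le = below h 10 (begin
          h * a                            ≤⟨ ℕₚ.*-monoʳ-≤ h le ⟩
          h * (9 * B + length EB)          ≡⟨ solve 3 (λ h b e → h :* (con 9 :* b :+ e) := con 9 :* (h :* b) :+ h :* e) refl h B (length EB) ⟩
          9 * (h * B) + h * length EB   ≤⟨ ℕₚ.+-mono-≤ (ℕₚ.*-monoʳ-≤ 9 (≤-trans B≤ K≤D⁻)) EB≤ ⟩
          9 * D⁻ + D⁻                         ≡⟨ solve 1 (λ d → con 9 :* d :+ d := con 10 :* d) refl D⁻ ⟩
          10 * D⁻                             ∎) (≤-trans (ℕₚ.m≤m+n 11 18) h>) (≤-trans K>0 K≤D⁻)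
        where
        open ≤-Reasoning
        open +-*-Solver

    length-allFin : length (allFin n) ≡ n
    length-allFin = Lₚ.length-tabulate {n = n} id

    record Typical : Set where
      constructor typical
      field
        D⁻≤n : D⁻ ≤ n
        D⁺-half : 2 * D⁺ ≤ n + 2 * (M + M)

    abstract
      -- By halving, some vertex outside `S` has at most half of the vertices outside `S` as
      -- out-neighbours, so `D⁺` hardly exceeds half of `n`. Consequently the vertices of `S⁺` have
      -- in-degree at least about half of `n`, which is the room needed to find bridges.
      is-typical : Typical
      is-typical = go R refl
        where
        R : List V
        R = filter (λ v → ¬? (v ∈? S)) (allFin n)
        lenS : length S ≡ M + M
        lenS = trans (Lₚ.length-++ S⁺) (cong₂ _+_ len⁺ len⁻)
        all⊆ : allFin n ⊆ S ++ R
        all⊆ {v} i with v ∈? S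
        ... | yes j = ∈-++⁺ˡ j
        ... | no ne = ∈-++⁺ʳ S (∈-filter⁺ (λ v → ¬? (v ∈? S)) i ne)
        n≤ : n ≤ (M + M) + length R
        n≤ = ≤-trans (≤-reflexive (sym length-allFin)) (≤-trans (unique-⊆⇒length≤ (Uₚ.allFin⁺ n) all⊆)
          (≤-reflexive (trans (Lₚ.length-++ S) (cong (_+ length R) lenS))))
        R≤ : length R ≤ n
        R≤ = ≤-trans (Lₚ.length-filter (λ v → ¬? (v ∈? S)) (allFin n)) (≤-reflexive length-allFin)
        go : ∀ R′ → R′ ≡ R → Typical
        go [] e = contradiction (≤-trans K<n (≤-trans n≤ (≤-trans (≤-reflexive (trans (cong (λ r → M + M + length r) (sym e)) (ℕₚ.+-identityʳ _))) M+M≤B)))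
          (ℕₚ.≤⇒≯ (ℕₚ.<⇒≤ (small-K 1 (≤-reflexive (sym (ℕₚ.*-identityˡ B))) (s≤s z≤n))))
        go (x ∷ xs) e with HO.halving x xs
        ... | v , i , half = typical
          (≤-trans (high⁻ v∉) (≤-trans (Lₚ.length-filter _ (allFin n)) (≤-reflexive length-allFin)))
          (begin
            2 * D⁺                                       ≤⟨ ℕₚ.*-monoʳ-≤ 2 (≤-trans (high⁺ v∉) (unique-⊆⇒length≤ (O.outN-unique v) sub)) ⟩
            2 * length (S ++ filter (O.arc? v) (x ∷ xs)) ≡⟨ cong (2 *_) (trans (Lₚ.length-++ S) (cong (_+ length (filter (O.arc? v) (x ∷ xs))) lenS)) ⟩
            2 * ((M + M) + length (filter (O.arc? v) (x ∷ xs)))  ≡⟨ ℕₚ.*-distribˡ-+ 2 (M + M) _ ⟩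
            2 * (M + M) + 2 * length (filter (O.arc? v) (x ∷ xs)) ≤⟨ ℕₚ.+-monoʳ-≤ (2 * (M + M)) (≤-trans half (≤-trans (≤-reflexive (cong length e)) R≤)) ⟩
            2 * (M + M) + n                              ≡⟨ ℕₚ.+-comm (2 * (M + M)) n ⟩
            n + 2 * (M + M)                              ∎)
          where
          open ≤-Reasoning
          v∉ : v ∉ S
          v∉ = proj₂ (∈-filter⁻ (λ v → ¬? (v ∈? S)) {xs = allFin n} (subst (v ∈_) e i))
          sub : O.outN v ⊆ S ++ filter (O.arc? v) (x ∷ xs)
          sub {w} j with w ∈? S
          ... | yes k = ∈-++⁺ˡ k
          ... | no ne = ∈-++⁺ʳ S (∈-filter⁺ (O.arc? v)
            (subst (w ∈_) (sym e) (∈-filter⁺ (λ v → ¬? (v ∈? S)) (∈-allFin w) ne)) (O.∈-outN⁻ j))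

    big-in : ∀ {a} → a ∈ S⁺ → n ≤ 2 + 2 * (M + M) + 2 * length (I.outN a)
    big-in {a} a∈ = ℕₚ.+-cancelˡ-≤ n _ _ (begin
      n + n                                                         ≡⟨ cong (n +_) (sym (ℕₚ.+-identityʳ n)) ⟩
      2 * n                                                         ≤⟨ ℕₚ.*-monoʳ-≤ 2 (≤-trans (O.degrees tour a) (s≤s (ℕₚ.+-monoˡ-≤ _ (low⁺ a∈)))) ⟩
      2 * suc (D⁺ + length (I.outN a))                              ≡⟨ solve 2 (λ d i → con 2 :* (con 1 :+ (d :+ i)) := con 2 :* d :+ (con 2 :+ con 2 :* i)) refl D⁺ (length (I.outN a)) ⟩
      2 * D⁺ + (2 + 2 * length (I.outN a))                          ≤⟨ ℕₚ.+-monoˡ-≤ _ (Typical.D⁺-half is-typical) ⟩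
      (n + 2 * (M + M)) + (2 + 2 * length (I.outN a))               ≡⟨ solve 3 (λ n m i → (n :+ m) :+ (con 2 :+ i) := n :+ (con 2 :+ m :+ i)) refl n (2 * (M + M)) (2 * length (I.outN a)) ⟩
      n + (2 + 2 * (M + M) + 2 * length (I.outN a))                 ∎)
      where
      open ≤-Reasoning
      open +-*-Solver

    record Bridge (b a : V) (F : List V) : Set where
      constructor bridge
      field
        {first last} : V
        {mid} : List V
        mpath : Path Arcs first last mid
        arc-in : T b first ≡ true
        arc-out : T last a ≡ true
        fresh : Disjoint mid F
        unique : Unique mid
        short : length mid ≤ 2

    abstract
      -- If no path of length at most 3 avoids F, then all in-neighbours of any vertex of Y (the
      -- in-neighbours of a outside F) lie in F or among the in-neighbours of b, the latter also containing
      -- Y. As b has small in-degree, this fails for a vertex of small in-degree within Y.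
      find-bridge : ∀ {a b F} → a ∈ S⁺ → b ∈ S⁻ → PV ⊆ F → 3 * length F < length (I.outN a) → Bridge b a F
      find-bridge {a} {b} {F} a∈ b∈ PV⊆ lt = search
        where
        inPV : ∀ {v} → v ∈ S → v ∈ F
        inPV i = PV⊆ (extremes i)
        X Y : List V
        X = filter (λ v → ¬? (v ∈? F)) (O.outN b)
        Y = filter (λ v → ¬? (v ∈? F)) (I.outN a)
        X⁻ : ∀ {v} → v ∈ X → T b v ≡ true × v ∉ F
        X⁻ i = O.∈-outN⁻ (proj₁ (∈-filter⁻ (λ v → ¬? (v ∈? F)) {xs = O.outN b} i)) , proj₂ (∈-filter⁻ (λ v → ¬? (v ∈? F)) {xs = O.outN b} i)
        Y⁻ : ∀ {v} → v ∈ Y → T v a ≡ true × v ∉ F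
        Y⁻ i = I.∈-outN⁻ (proj₁ (∈-filter⁻ (λ v → ¬? (v ∈? F)) {xs = I.outN a} i)) , proj₂ (∈-filter⁻ (λ v → ¬? (v ∈? F)) {xs = I.outN a} i)
        Y-unique : Unique Y
        Y-unique = Uₚ.filter⁺ (λ v → ¬? (v ∈? F)) (I.outN-unique a)
        Y-big : length (I.outN a) ≤ length F + length Y
        Y-big = ≤-trans (unique-⊆⇒length≤ (I.outN-unique a) sub) (≤-reflexive (Lₚ.length-++ F))
          where
          sub : I.outN a ⊆ F ++ Y
          sub {v} i with v ∈? F
          ... | yes j = ∈-++⁺ˡ j
          ... | no ne = ∈-++⁺ʳ F (∈-filter⁺ (λ v → ¬? (v ∈? F)) i ne)
        in-b : (∀ {v} → v ∈ X → v ∉ Y) → (∀ {x y} → x ∈ X → y ∈ Y → T x y ≢ true) → ∀ {v u} → v ∈ Y → u ∉ F →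
          u ≡ v ⊎ T u v ≡ true → T u b ≡ true
        in-b noX noXY {v} {u} v∈ u∉ h with proj₂ tour u b (λ { refl → u∉ (inPV (∈-++⁺ʳ S⁺ b∈)) })
        ... | inj₁ (e , _) = e
        in-b noX noXY {v} {u} v∈ u∉ (inj₁ refl) | inj₂ (_ , e) =
          contradiction v∈ (noX (∈-filter⁺ (λ v → ¬? (v ∈? F)) (O.∈-outN⁺ e) u∉))
        in-b noX noXY {v} {u} v∈ u∉ (inj₂ f) | inj₂ (_ , e) =
          contradiction f (noXY (∈-filter⁺ (λ v → ¬? (v ∈? F)) (O.∈-outN⁺ e) u∉) v∈)

        absurd : ∀ Y′ → Y′ ≡ Y → (∀ {v} → v ∈ X → v ∉ Y) → (∀ {x y} → x ∈ X → y ∈ Y → T x y ≢ true) → ⊥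
        absurd [] e noX noXY = ℕₚ.<⇒≱ lt (≤-trans Y-big (≤-trans (≤-reflexive (trans (cong (λ y → length F + length y) (sym e)) (ℕₚ.+-identityʳ _))) (ℕₚ.m≤m+n _ _)))
        absurd (y ∷ ys) e noX noXY with HI.halving y ys
        ... | v , i , half = ℕₚ.<⇒≱ lt (≤-trans Y-big (≤-trans (ℕₚ.+-monoʳ-≤ (length F) Y≤)
            (≤-reflexive (solve 1 (λ f → f :+ con 2 :* f := con 3 :* f) refl (length F)))))
          where
          open +-*-Solver
          v∈ : v ∈ Y
          v∈ = subst (v ∈_) e i
          δ : ℕ
          δ = length (filter (I.arc? v) (y ∷ ys))
          R : List V
          R = filter (λ v → ¬? (v ∈? Y)) (I.outN b)
          R+Y : length R + length Y ≤ D⁻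
          R+Y = ≤-trans (≤-reflexive (sym (Lₚ.length-++ R))) (≤-trans (unique-⊆⇒length≤
            (Uₚ.++⁺ (Uₚ.filter⁺ (λ v → ¬? (v ∈? Y)) (I.outN-unique b)) Y-unique (λ (j , k) → proj₂ (∈-filter⁻ (λ v → ¬? (v ∈? Y)) {xs = I.outN b} j) k))
            (λ j → [ (λ k → proj₁ (∈-filter⁻ (λ v → ¬? (v ∈? Y)) {xs = I.outN b} k))
                   , (λ k → I.∈-outN⁺ (in-b noX noXY k (proj₂ (Y⁻ k)) (inj₁ refl))) ]′ (∈-++⁻ R j))) (low⁻ b∈))
          v∉S : v ∉ S
          v∉S j = proj₂ (Y⁻ v∈) (inPV j)
          sub : I.outN v ⊆ F ++ filter (I.arc? v) (y ∷ ys) ++ R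
          sub {u} j with u ∈? F | u ∈? Y
          ... | yes k | _ = ∈-++⁺ˡ k
          ... | no _ | yes k = ∈-++⁺ʳ F (∈-++⁺ˡ (∈-filter⁺ (I.arc? v) (subst (u ∈_) (sym e) k) (I.∈-outN⁻ j)))
          ... | no u∉ | no ne = ∈-++⁺ʳ F (∈-++⁺ʳ (filter (I.arc? v) (y ∷ ys))
            (∈-filter⁺ (λ v → ¬? (v ∈? Y)) (I.∈-outN⁺ (in-b noX noXY v∈ u∉ (inj₂ (I.∈-outN⁻ j)))) ne))
          deg : D⁻ ≤ length F + (δ + length R)
          deg = ≤-trans (high⁻ v∉S) (≤-trans (unique-⊆⇒length≤ (I.outN-unique v) sub)
            (≤-reflexive (trans (Lₚ.length-++ F) (cong (length F +_) (Lₚ.length-++ (filter (I.arc? v) (y ∷ ys)))))))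
          Y≤F+h : length Y ≤ length F + δ
          Y≤F+h = ℕₚ.+-cancelˡ-≤ (length R) _ _ (≤-trans R+Y (≤-trans deg
            (≤-reflexive (solve 3 (λ f d r → f :+ (d :+ r) := r :+ (f :+ d)) refl (length F) δ (length R)))))
          -- Comparing the in-degrees of `v` and `b` with `D⁻` bounds `Y` by `F` plus `δ`, and `δ`
          -- is at most half of `Y`. Thus `Y` is at most twice `F`, and the in-degree of `a` at most
          -- three times `F`.
          Y≤ : length Y ≤ 2 * length F
          Y≤ = ℕₚ.+-cancelʳ-≤ (length Y) _ _ (begin
            length Y + length Y                  ≡⟨ cong (length Y +_) (sym (ℕₚ.+-identityʳ _)) ⟩
            2 * length Y                         ≤⟨ ℕₚ.*-monoʳ-≤ 2 Y≤F+h ⟩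
            2 * (length F + δ)                   ≡⟨ ℕₚ.*-distribˡ-+ 2 (length F) δ ⟩
            2 * length F + 2 * δ                 ≤⟨ ℕₚ.+-monoʳ-≤ (2 * length F) (≤-trans half (≤-reflexive (cong length e))) ⟩
            2 * length F + length Y              ∎)
            where open ≤-Reasoning

        search : Bridge b a F
        search with disjoint? X Y
        ... | inj₂ (h , i , j) = bridge (point h) (proj₁ (X⁻ i)) (proj₁ (Y⁻ j))
          (λ { (here refl , k) → proj₂ (X⁻ i) k }) ([] ∷ []) (s≤s z≤n)
        ... | inj₁ d with any? (λ x → any? (O.arc? x) Y) X
        ...   | no none = ⊥-elim (absurd Y refl (λ i j → d (i , j)) (λ i j t → none (lose i (lose j t))))
        ...   | yes some with find some
        ...     | x , i , some′ with find some′
        ...       | y , j , t = bridge (t ◅ point y) (proj₁ (X⁻ i)) (proj₁ (Y⁻ j))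
          (λ { (here refl , k) → proj₂ (X⁻ i) k ; (there (here refl) , k) → proj₂ (Y⁻ j) k })
          (unique-∷ (λ { (here e) → loopless t e }) ([] ∷ [])) (s≤s (s≤s z≤n))

    -- Along the path the arcs between its vertices and `v` change direction at some point: the
    -- first vertex receives nothing from `v` but sends an arc to it, the last one is an
    -- out-neighbour of `v`. The arc where the change occurs is the one wanted.
    cover-arc : ∀ {v p q l} → Path Arcs p q l → v ∉ l → T p v ≡ true → T v q ≡ true →
      ∃₂ λ x y → x ∈ l × y ∈ l × T x y ≡ true × T x v ≡ true × T v y ≡ true
    cover-arc (point p) v∉ e f = ⊥-elim (asym e f)
    cover-arc {v} (_◅_ {u} {w} t p) v∉ e f with proj₂ tour v w (λ { refl → v∉ (there (start-∈ p)) })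
    ... | inj₁ (g , _) = u , w , here refl , there (start-∈ p) , t , e , g
    ... | inj₂ (_ , g) with cover-arc p (v∉ ∘ there) g f
    ...   | x , y , i , j , h = x , y , there i , there j , h

    abstract
      -- Connectivity supplies a path from an in-neighbour to an out-neighbour of `v` that avoids
      -- `F` and `v` itself; the one extra vertex to be avoided accounts for the `+ 1`.
      find-cover : ∀ v F → length F + 1 < K → ∃₂ λ x y → T x y ≡ true × T x v ≡ true × T v y ≡ true × x ∉ F × y ∉ F
      find-cover v F lt with in-K v F (≤-trans (s≤s (ℕₚ.m≤m+n _ 1)) lt) | out-K v F (≤-trans (s≤s (ℕₚ.m≤m+n _ 1)) lt)
      ... | p , e , p∉ | q , f , q∉ with conn (v ∷ F) (≤-trans (≤-reflexive (cong suc (ℕₚ.+-comm 1 (length F)))) lt)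
              (λ { (here r) → loopless e r ; (there i) → p∉ i }) (λ { (here r) → loopless f (sym r) ; (there i) → q∉ i })
      ...   | l , path , d with cover-arc path (λ i → d (i , here refl)) e f
      ...     | x , y , i , j , g , h , k = x , y , g , h , k , (λ m → d (i , there m)) , (λ m → d (j , there m))

    -- A vertex of this kind is dominated in both directions by every gap. Bridges consist of such
    -- vertices because the closing of the cycle lets paths start or end in a gap's middle.
    Clean : V → Set
    Clean v = v ∉ PV × v ∉ EA × v ∉ EB

    -- `pathB` lives in the transposed tournament and is traversed backwards: the gap runs from the
    -- source of the owner to `exit₀`, over the bridge to `entry₀`, and on to the sink.
    record GapO : Set where
      constructor gapO
      field
        owner : Pair
        {first last} : V
        {mid} : List V
        mpath : Path Arcs first last mid
        arc-in : T (exit₀ owner) first ≡ true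
        arc-out : T last (entry₀ owner) ≡ true

      toGap : Gap V
      toGap = gap (reverse (listB owner)) mid (listA owner)

      gapSeg : Seg
      gapSeg = seg (path-++ (path-reverse (pathB owner)) arc-in (path-++ mpath arc-out (pathA owner)))

    open GapO

    record CovO : Set where
      constructor covO
      field
        cov : Cover V
        through : T (Cover.from cov) (Cover.to cov) ≡ true
        inward : T (Cover.from cov) (Cover.at cov) ≡ true
        outward : T (Cover.at cov) (Cover.to cov) ≡ true

      covSeg : Seg
      covSeg = seg (through ◅ point (Cover.to cov))

      at : V
      at = Cover.at cov

      edge : List V
      edge = Cover.edge cov

    open CovO

    -- Two vertices on each side are needed. An end of `base` may be an extreme vertex with only the
    -- degree guaranteed by connectivity, enough to reach a vertex outside `PV`. Such a vertex has
    -- degree at least `D⁺` or `D⁻`, which suffices to escape from the exceptional set in a second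
    -- step.
    record Ext : Set where
      constructor ext
      field
        base : Seg
        s″ s′ t′ t″ : V
        s-arc : T s″ s′ ≡ true
        start-arc : T s′ (start base) ≡ true
        end-arc : T (end base) t′ ≡ true
        t-arc : T t′ t″ ≡ true

      added : List V
      added = s″ ∷ s′ ∷ t′ ∷ t″ ∷ []

      whole : Seg
      whole = seg (s-arc ◅ start-arc ◅ path-++ (path base) end-arc (t-arc ◅ point t″))

      body-↭ : body whole ↭ body base ++ added
      body-↭ = solve 3 (λ s b t → s ⊕ b ⊕ t ⊜ b ⊕ s ⊕ t) ↭-refl (s″ ∷ s′ ∷ []) (body base) (t′ ∷ t″ ∷ [])
        where open ↭-Solver

      base-infix : Infix (body base) (body whole)
      base-infix = s″ ∷ s′ ∷ [] , t′ ∷ t″ ∷ [] , refl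

    open Ext

    hB≤n : h * B ≤ n
    hB≤n = ≤-trans B≤ (ℕₚ.<⇒≤ K<n)

    h≤n : h ≤ n
    h≤n = ≤-trans (≤-trans (≤-reflexive (sym (ℕₚ.*-identityʳ h))) (ℕₚ.*-monoʳ-≤ h B>0)) hB≤n

    abstract
      choose-gap : ∀ p U → p ∈ pairs⁰ → length U ≤ B → ∃ λ g → owner g ≡ p × Unique (mid g) × Disjoint (mid g) U ×
        length (mid g) ≤ 2 × All Clean (mid g)
      choose-gap p U p∈ le with find-bridge {F = PV ++ U ++ EA ++ EB} (entry₀∈ p) (exit₀∈ p) ∈-++⁺ˡ
          (mid-arith h n (M + M) _ _ h> (big-in (entry₀∈ p)) (≤-trans (ℕₚ.*-monoʳ-≤ h M+M≤B) hB≤n) h≤n F≤)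
        where
        F≤ : h * length (PV ++ U ++ EA ++ EB) ≤ 4 * n
        F≤ = begin
          h * length (PV ++ U ++ EA ++ EB)
            ≡⟨ cong (h *_) (trans (Lₚ.length-++ PV) (cong (length PV +_) (trans (Lₚ.length-++ U) (cong (length U +_) (Lₚ.length-++ EA))))) ⟩
          h * (length PV + (length U + (length EA + length EB)))
            ≡⟨ solve 5 (λ h a b c d → h :* (a :+ (b :+ (c :+ d))) := h :* a :+ (h :* b :+ (h :* c :+ h :* d))) refl h (length PV) (length U) (length EA) (length EB) ⟩
          h * length PV + (h * length U + (h * length EA + h * length EB))
            ≤⟨ ℕₚ.+-mono-≤ (≤-trans (ℕₚ.*-monoʳ-≤ h PV≤) hB≤n) (ℕₚ.+-mono-≤ (≤-trans (ℕₚ.*-monoʳ-≤ h le) hB≤n)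
                 (ℕₚ.+-mono-≤ (≤-trans EA≤ (≤-trans D≤ (Typical.D⁻≤n is-typical))) (≤-trans EB≤ (Typical.D⁻≤n is-typical)))) ⟩
          n + (n + (n + n))
            ≡⟨ solve 1 (λ n → n :+ (n :+ (n :+ n)) := con 4 :* n) refl n ⟩
          4 * n ∎
          where
          open ≤-Reasoning
          open +-*-Solver
      ... | bridge mp ai ao fr un sh = gapO p mp ai ao , refl , un , (λ (i , j) → fr (i , ∈-++⁺ʳ PV (∈-++⁺ˡ j))) , sh
        , All.tabulate λ i → (λ j → fr (i , ∈-++⁺ˡ j)) , (λ j → fr (i , ∈-++⁺ʳ PV (∈-++⁺ʳ U (∈-++⁺ˡ j)))) , (λ j → fr (i , ∈-++⁺ʳ PV (∈-++⁺ʳ U (∈-++⁺ʳ EA j))))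

    PV+U≤ : ∀ U → length U ≤ B → length (PV ++ U) ≤ 2 * B
    PV+U≤ U le = ≤-trans (≤-reflexive (Lₚ.length-++ PV)) (≤-trans (ℕₚ.+-mono-≤ PV≤ le) (≤-reflexive (cong (B +_) (sym (ℕₚ.+-identityʳ B)))))

    abstract
      choose-cov : ∀ v U → ⊤ → length U ≤ B → ∃ λ c → at c ≡ v × Unique (edge c) × Disjoint (edge c) U × length (edge c) ≤ 2 ×
        All (_∉ PV) (edge c)
      choose-cov v U _ le = from-arc (find-cover v (PV ++ U) (small-K 3 (≤-trans (ℕₚ.+-mono-≤ (PV+U≤ U le) B>0)
          (≤-reflexive (ℕₚ.+-comm (2 * B) B))) (ℕₚ.m≤m+n 3 25)))
        where
        from-arc : (∃₂ λ x y → T x y ≡ true × T x v ≡ true × T v y ≡ true × x ∉ PV ++ U × y ∉ PV ++ U) →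
          ∃ λ c → at c ≡ v × Unique (edge c) × Disjoint (edge c) U × length (edge c) ≤ 2 × All (_∉ PV) (edge c)
        from-arc (x , y , e , f , g , x∉ , y∉) = covO (cover {from = x} {v} {y}) e f g , refl
          , unique-∷ (λ { (here r) → loopless e r }) ([] ∷ [])
          , (λ { (here refl , j) → x∉ (∈-++⁺ʳ PV j) ; (there (here refl) , j) → y∉ (∈-++⁺ʳ PV j) }) , ≤-refl
          , (λ j → x∉ (∈-++⁺ˡ j)) ∷ (λ j → y∉ (∈-++⁺ˡ j)) ∷ []

    EndsOK : Ext → Set
    EndsOK e = Disjoint (added e) PV × s″ e ∉ EB × t″ e ∉ EA

    abstract
      size₃ : ∀ {w} j → w ≤ 2 * B → j ≤ 6 → suc (j + w) ≤ 9 * B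
      size₃ {w} j le jl = ≤-trans (ℕₚ.+-mono-≤ (≤-trans (s≤s jl) (ℕₚ.*-monoʳ-≤ 7 B>0)) le)
        (≤-reflexive (solve 1 (λ b → con 7 :* b :+ con 2 :* b := con 9 :* b) refl B))
        where open +-*-Solver

    abstract
      choose-ext : ∀ b U → ⊤ → length U ≤ B → ∃ λ e → base e ≡ b × Unique (added e) × Disjoint (added e) U × length (added e) ≤ 4 × EndsOK e
      choose-ext b U _ le =

        step₁ (in-K (start b) W (small-K 9 (≤-trans (ℕₚ.n≤1+n _) (size₃ 0 (PV+U≤ U le) z≤n)) (ℕₚ.m≤m+n 9 19)))
        where
        W : List V
        W = PV ++ U
        W≤ : length W ≤ 2 * B
        W≤ = PV+U≤ U le
        Res : Set
        Res = ∃ λ e → base e ≡ b × Unique (added e) × Disjoint (added e) U × length (added e) ≤ 4 × EndsOK e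
        step₁ : (∃ λ z → T z (start b) ≡ true × z ∉ W) → Res
        step₁ (s1 , e1 , n1) = step₂ (in-D s1 (s1 ∷ W ++ EB) (n1 ∘ ∈-++⁺ˡ)
            (small-D⁻ (≤-trans (≤-reflexive (cong suc (Lₚ.length-++ W))) (ℕₚ.+-monoˡ-≤ (length EB) (size₃ 0 W≤ z≤n)))))
          where
          step₂ : (∃ λ z → T z s1 ≡ true × z ∉ s1 ∷ W ++ EB) → Res
          step₂ (s2 , e2 , n2) = step₃ (out-K (end b) (s2 ∷ s1 ∷ W) (small-K 9 (size₃ 1 W≤ (s≤s z≤n)) (ℕₚ.m≤m+n 9 19)))
            where
            step₃ : (∃ λ z → T (end b) z ≡ true × z ∉ s2 ∷ s1 ∷ W) → Res
            step₃ (t1 , e3 , n3) = step₄ (out-D t1 (t1 ∷ s2 ∷ s1 ∷ W ++ EA) (λ i → n3 (there (there (∈-++⁺ˡ i))))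
                (small-D⁺ (≤-trans (≤-reflexive (cong (3 +_) (Lₚ.length-++ W))) (ℕₚ.+-monoˡ-≤ (length EA) (size₃ 2 W≤ (s≤s (s≤s z≤n)))))))
              where
              step₄ : (∃ λ z → T t1 z ≡ true × z ∉ t1 ∷ s2 ∷ s1 ∷ W ++ EA) → Res
              step₄ (t2 , e4 , n4) = ext b s2 s1 t1 t2 e2 e1 e3 e4 , refl
                , unique-∷ (λ { (here r) → n2 (here r) ; (there (here r)) → n3 (here (sym r)) ; (there (there (here r))) → n4 (there (here (sym r))) })
                    (unique-∷ (λ { (here r) → n3 (there (here (sym r))) ; (there (here r)) → n4 (there (there (here (sym r)))) })
                      (unique-∷ (λ { (here r) → n4 (here (sym r)) }) ([] ∷ [])))
                , (λ (i , j) → notW i (∈-++⁺ʳ PV j)) , ≤-refl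
                , (λ (i , j) → notW i (∈-++⁺ˡ j)) , (λ i → n2 (there (∈-++⁺ʳ W i))) , (λ i → n4 (there (there (there (∈-++⁺ʳ W i)))))
                where
                notW : ∀ {v} → v ∈ s2 ∷ s1 ∷ t1 ∷ t2 ∷ [] → v ∉ W
                notW (here refl) j = n2 (there (∈-++⁺ˡ j))
                notW (there (here refl)) j = n1 j
                notW (there (there (here refl))) j = n3 (there (there j))
                notW (there (there (there (here refl)))) j = n4 (there (there (there (∈-++⁺ˡ j))))

    -- The raw material of one track. By `ats` every vertex of every gap, bridges included, has its
    -- own cover; by `bases` the gaps and the cover arcs together are the segments that remain to be
    -- linked.
    record Proto : Set where
      field
        ds : List Pair
        gs : List GapO
        cs : List CovO
        es : List Ext
        owners : map owner gs ≡ ds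
        ats : map at cs ≡ concatMap (Gap.vertices ∘ toGap) gs
        bases : map base es ≡ map gapSeg gs ++ map covSeg cs
        clean : ∀ {g v} → g ∈ gs → v ∈ mid g → Clean v
        es≤ : length es ≤ length ds + length ds * (4 + (c + c))
        ends-ok : ∀ {e} → e ∈ es → EndsOK e

      chosen : List V
      chosen = concatMap mid gs ++ concatMap edge cs ++ concatMap added es

    open Proto

    gap-vertices-↭ : ∀ gs → concatMap (Gap.vertices ∘ toGap) gs ↭ concatMap vertices (map owner gs) ++ concatMap mid gs
    gap-vertices-↭ gs = ↭-trans (concatMap-split (Gap.vertices ∘ toGap) (vertices ∘ owner) mid
        (λ g → ↭-trans (Permₚ.++⁺ʳ _ (Permₚ.↭-reverse (listB (owner g))))
          (solve 3 (λ b m a → b ⊕ m ⊕ a ⊜ (a ⊕ b) ⊕ m) ↭-refl (listB (owner g)) (mid g) (listA (owner g)))) gs)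
      (Permₚ.++⁺ʳ (concatMap mid gs) (↭-reflexive (sym (concatMap-map′ vertices owner gs))))
      where open ↭-Solver

    allVertices : Proto → List V
    allVertices o = concatMap (body ∘ whole) (es o)

    all-↭ : ∀ o → allVertices o ↭ concatMap vertices (ds o) ++ chosen o
    all-↭ o = ↭-trans (concatMap-split (body ∘ whole) (body ∘ base) added body-↭ (es o))
      (↭-trans (Permₚ.++⁺ʳ (concatMap added (es o)) (↭-trans
        (↭-reflexive (trans (sym (concatMap-map′ body base (es o))) (trans (cong (concatMap body) (bases o))
          (trans (concatMap-++ body (map gapSeg (gs o)) (map covSeg (cs o)))
            (cong₂ _++_ (concatMap-map′ body gapSeg (gs o)) (concatMap-map′ body covSeg (cs o)))))))
        (Permₚ.++⁺ʳ (concatMap edge (cs o)) (↭-trans (gap-vertices-↭ (gs o))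
          (↭-reflexive (cong (λ d → concatMap vertices d ++ concatMap mid (gs o)) (owners o)))))))
        (solve 4 (λ d m e a → ((d ⊕ m) ⊕ e) ⊕ a ⊜ d ⊕ m ⊕ e ⊕ a) ↭-refl
          (concatMap vertices (ds o)) (concatMap mid (gs o)) (concatMap edge (cs o)) (concatMap added (es o))))
      where open ↭-Solver

  open Choices
  open GapO
  open CovO using (cov; covSeg; at; edge)
  open Ext
  open Proto

  module Building where

    module G₁ = Greedy {V} owner mid (λ g _ → All Clean (mid g)) (λ _ q → q) (_∈ pairs⁰) 2 B choose-gap
    module G₂ = Greedy {V} at edge (λ c _ → All (_∉ PV) (edge c)) (λ _ q → q) (λ _ → ⊤) 2 B choose-cov
    module G₃ = Greedy {V} base added (λ e _ → EndsOK e) (λ _ q → q) (λ _ → ⊤) 4 B choose-ext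

    vertices≤ : ∀ p → length (vertices p) ≤ 2 + (c + c)
    vertices≤ p = ≤-trans (≤-reflexive (trans (cong suc (trans (Lₚ.length-++ (tailA p)) (ℕₚ.+-suc _ _)))
      (cong (2 +_) (sym (Lₚ.length-++ (tailA p)))))) (s≤s (s≤s (tails≤ p)))

    Picked : List Pair → List V → Set
    Picked ds′ U = ∃ λ o → ds o ≡ ds′ × Unique (chosen o) × Disjoint (chosen o) U × length (chosen o) ≤ protoSize m c ×
      All (_∉ PV) (chosen o)

    abstract
      -- Three greedy rounds, for bridges, cover arcs and end vertices, each avoiding the results of
      -- the earlier ones. The whole is in turn one choice of the greedy selection over all `k`
      -- tracks.
      choose-proto : ∀ ds′ U → length ds′ ≡ m × ds′ ⊆ pairs⁰ → length U ≤ B′ → Picked ds′ U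
      choose-proto ds′ U (len , sub) le = step₁ (G₁.greedy ds′ U (All.tabulate sub)
          (≤-trans (ℕₚ.+-mono-≤ le (≤-trans (≤-reflexive (cong (_* 2) len)) (ℕₚ.m≤m+n _ _))) B′≤))
        where
        g : ℕ
        g = m * (4 + (c + c))
        step₁ : G₁.Chosen ds′ U → Picked ds′ U
        step₁ (G₁.picked gs′ keys₁ uniq₁ fresh₁ size₁ props₁) = step₂ (G₂.greedy GV U₂ (All.tabulate (λ _ → tt))
            (≤-trans (ℕₚ.+-mono-≤ U₂≤ (ℕₚ.*-monoˡ-≤ 2 GV≤)) (≤-trans (≤-reflexive (ℕₚ.+-assoc B′ (m * 2) (g * 2)))
              (≤-trans (ℕₚ.+-monoʳ-≤ B′ (ℕₚ.+-monoʳ-≤ (m * 2) (ℕₚ.m≤m+n _ _))) B′≤))))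
          where
          GV U₂ : List V
          GV = concatMap (Gap.vertices ∘ toGap) gs′
          U₂ = concatMap mid gs′ ++ U
          size₁′ : length (concatMap mid gs′) ≤ m * 2
          size₁′ = ≤-trans size₁ (≤-reflexive (cong (_* 2) len))
          U₂≤ : length U₂ ≤ B′ + m * 2
          U₂≤ = ≤-trans (≤-reflexive (trans (Lₚ.length-++ (concatMap mid gs′)) (ℕₚ.+-comm _ (length U)))) (ℕₚ.+-mono-≤ le size₁′)
          GV≤ : length GV ≤ g
          GV≤ = begin
            length GV ≡⟨ trans (Permₚ.↭-length (gap-vertices-↭ gs′)) (Lₚ.length-++ (concatMap vertices (map owner gs′))) ⟩
            length (concatMap vertices (map owner gs′)) + length (concatMap mid gs′)
              ≤⟨ ℕₚ.+-mono-≤ (≤-trans (≤-reflexive (cong (length ∘ concatMap vertices) keys₁)) (≤-trans (concatMap-length≤ vertices (2 + (c + c)) ds′ (λ {p} _ → vertices≤ p)) (≤-reflexive (cong (_* (2 + (c + c))) len)))) size₁′ ⟩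
            m * (2 + (c + c)) + m * 2 ≡⟨ solve 2 (λ m d → m :* (con 2 :+ d) :+ m :* con 2 := m :* (con 4 :+ d)) refl m (c + c) ⟩
            g ∎
            where
            open ≤-Reasoning
            open +-*-Solver
          step₂ : G₂.Chosen GV U₂ → Picked ds′ U
          step₂ (G₂.picked cs′ keys₂ uniq₂ fresh₂ size₂ props₂) = step₃ (G₃.greedy bs U₃ (All.tabulate (λ _ → tt))
              (≤-trans (ℕₚ.+-mono-≤ U₃≤ (ℕₚ.*-monoˡ-≤ 4 bs≤)) (≤-trans (≤-reflexive
                (trans (ℕₚ.+-assoc (B′ + m * 2) (g * 2) ((m + g) * 4)) (ℕₚ.+-assoc B′ (m * 2) (g * 2 + (m + g) * 4)))) B′≤)))
            where
            bs : List Seg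
            bs = map gapSeg gs′ ++ map covSeg cs′
            U₃ : List V
            U₃ = concatMap edge cs′ ++ U₂
            U₃≤ : length U₃ ≤ (B′ + m * 2) + g * 2
            U₃≤ = ≤-trans (≤-reflexive (trans (Lₚ.length-++ (concatMap edge cs′)) (ℕₚ.+-comm _ (length U₂))))
              (ℕₚ.+-mono-≤ U₂≤ (≤-trans size₂ (ℕₚ.*-monoˡ-≤ 2 GV≤)))
            bs≤ : length bs ≤ m + g
            bs≤ = ≤-trans (≤-reflexive (trans (Lₚ.length-++ (map gapSeg gs′)) (cong₂ _+_ (Lₚ.length-map gapSeg gs′) (Lₚ.length-map covSeg cs′))))
              (ℕₚ.+-mono-≤ (≤-reflexive (trans (sym (Lₚ.length-map owner gs′)) (trans (cong length keys₁) len)))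
                (≤-trans (≤-reflexive (trans (sym (Lₚ.length-map at cs′)) (cong length keys₂))) GV≤))
            step₃ : G₃.Chosen bs U₃ → Picked ds′ U
            step₃ (G₃.picked es′ keys₃ uniq₃ fresh₃ size₃ props₃) = record
              { ds = ds′ ; gs = gs′ ; cs = cs′ ; es = es′ ; owners = keys₁ ; ats = keys₂ ; bases = keys₃
              ; clean = λ i j → All.lookup (props₁ i) j
              ; es≤ = ≤-trans (≤-reflexive (trans (sym (Lₚ.length-map base es′)) (cong length keys₃)))
                  (≤-trans bs≤ (≤-reflexive (cong (λ x → x + x * (4 + (c + c))) (sym len))))
              ; ends-ok = props₃ }
              , refl
              , Uₚ.++⁺ uniq₁ (Uₚ.++⁺ uniq₂ uniq₃ (λ (i , j) → fresh₃ (j , ∈-++⁺ˡ i)))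
                  (λ (i , j) → [ (λ k → fresh₂ (k , ∈-++⁺ˡ i)) , (λ k → fresh₃ (k , ∈-++⁺ʳ (concatMap edge cs′) (∈-++⁺ˡ i))) ]′ (∈-++⁻ (concatMap edge cs′) j))
              , avoid
              , ≤-trans (≤-reflexive (trans (Lₚ.length-++ (concatMap mid gs′)) (cong (length (concatMap mid gs′) +_) (Lₚ.length-++ (concatMap edge cs′)))))
                  (ℕₚ.+-mono-≤ size₁′ (ℕₚ.+-mono-≤ (≤-trans size₂ (ℕₚ.*-monoˡ-≤ 2 GV≤)) (≤-trans size₃ (ℕₚ.*-monoˡ-≤ 4 bs≤))))
              , All.tabulate noPV
              where
              avoid : Disjoint (concatMap mid gs′ ++ concatMap edge cs′ ++ concatMap added es′) U
              avoid (i , j) with ∈-++⁻ (concatMap mid gs′) i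
              ... | inj₁ k = fresh₁ (k , j)
              ... | inj₂ i′ with ∈-++⁻ (concatMap edge cs′) i′
              ...   | inj₁ k = fresh₂ (k , ∈-++⁺ʳ (concatMap mid gs′) j)
              ...   | inj₂ k = fresh₃ (k , ∈-++⁺ʳ (concatMap edge cs′) (∈-++⁺ʳ (concatMap mid gs′) j))
              edges-PV′ : Disjoint (concatMap edge cs′) PV
              edges-PV′ (i , j) with ∈-concatMap⁻′ edge cs′ i
              ... | c′ , k , l = All.lookup (props₂ k) l j
              noPV : ∀ {v} → v ∈ concatMap mid gs′ ++ concatMap edge cs′ ++ concatMap added es′ → v ∉ PV
              noPV i with ∈-++⁻ (concatMap mid gs′) i
              ... | inj₁ k with ∈-concatMap⁻′ mid gs′ k
              ...   | g′ , a , b = proj₁ (All.lookup (props₁ a) b)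
              noPV i | inj₂ i′ with ∈-++⁻ (concatMap edge cs′) i′
              ...   | inj₁ k = λ j → edges-PV′ (k , j)
              ...   | inj₂ k with ∈-concatMap⁻′ added es′ k
              ...     | e′ , a , b = λ j → proj₁ (props₃ a) (b , j)

  open Building using (choose-proto)

  -- Links: dominating paths joined by Menger's theorem

  module Linking where

    record Layout : Set where
      field
        os : List Proto
        aux : List Pair
        os-count : length os ≡ k
        aux-count : length aux ≡ q
        groups : ∀ {o} → o ∈ os → length (ds o) ≡ m × ds o ⊆ pairs⁰
        aux⊆ : aux ⊆ pairs⁰

      X : List V
      X = PV ++ concatMap chosen os

      field
        X≤ : length X ≤ B
        X-↭ : X ↭ concatMap allVertices os ++ concatMap vertices aux
        X-unique : Unique X

      all-unique : Unique (concatMap allVertices os ++ concatMap vertices aux)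
      all-unique = Unique-resp-↭ X-↭ X-unique

    abstract
      layout : Layout
      layout = go (split-list (k * m) q pairs⁰ (trans count M≡))
        where
        go : (∃₂ λ gp aux → pairs⁰ ≡ gp ++ aux × length gp ≡ k * m × length aux ≡ q) → Layout
        go (gp , aux′ , eq , len₁ , len₂) = go′ (chunks k m gp len₁)
          where
          module G = Greedy {V} ds chosen (λ o _ → All (_∉ PV) (chosen o)) (λ _ x → x) (λ d → length d ≡ m × d ⊆ pairs⁰)
            (protoSize m c) B′ choose-proto
          go′ : (∃ λ xss → concat xss ≡ gp × length xss ≡ k × All (λ ys → length ys ≡ m) xss) → Layout
          go′ (xss , eq′ , len₃ , al) = go″ (G.greedy xss PV (All.tabulate ok)
              (≤-trans (≤-reflexive (cong (λ x → length PV + x * protoSize m c) len₃)) room))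
            where
            sub : ∀ {xs} → xs ∈ xss → xs ⊆ pairs⁰
            sub i j = subst (_ ∈_) (sym eq) (∈-++⁺ˡ (subst (_ ∈_) (trans (cong concat (Lₚ.map-id xss)) eq′) (∈-concatMap⁺′ id i j)))
            ok : ∀ {xs} → xs ∈ xss → length xs ≡ m × xs ⊆ pairs⁰
            ok i = All.lookup al i , sub i
            go″ : G.Chosen xss PV → Layout
            go″ (G.picked os′ keys uniq′ fresh size props) = record
              { os = os′ ; aux = aux′
              ; os-count = trans (sym (Lₚ.length-map ds os′)) (trans (cong length keys) len₃)
              ; aux-count = len₂
              ; groups = λ {o} i → ok (subst (ds o ∈_) keys (∈-map⁺ ds i))
              ; aux⊆ = λ i → subst (_ ∈_) (sym eq) (∈-++⁺ʳ gp i)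
              ; X≤ = ≤-trans (≤-reflexive (Lₚ.length-++ PV)) (≤-trans (ℕₚ.+-monoʳ-≤ (length PV) (≤-trans size
                  (≤-reflexive (cong (_* protoSize m c) len₃)))) (≤-trans room (≤-trans (ℕₚ.m≤m+n B′ _) B′≤)))
              ; X-↭ = perm
              ; X-unique = Uₚ.++⁺ unique⁰ uniq′ (λ (i , j) → fresh (j , i)) }
              where
              gpv : concatMap (λ o → concatMap vertices (ds o)) os′ ≡ concatMap vertices gp
              gpv = trans (concatMap-concatMap vertices ds os′) (cong (concatMap vertices) (trans (cong concat keys) eq′))
              perm : PV ++ concatMap chosen os′ ↭ concatMap allVertices os′ ++ concatMap vertices aux′
              perm = ↭-trans (↭-reflexive (cong (_++ concatMap chosen os′) (trans (cong (concatMap vertices) eq) (concatMap-++ vertices gp aux′))))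
                (↭-trans (solve 3 (λ g a c → (g ⊕ a) ⊕ c ⊜ (g ⊕ c) ⊕ a) ↭-refl (concatMap vertices gp) (concatMap vertices aux′) (concatMap chosen os′))
                  (Permₚ.++⁺ʳ (concatMap vertices aux′) (↭-trans (↭-reflexive (cong (_++ concatMap chosen os′) (sym gpv)))
                    (↭-sym (concatMap-split allVertices (λ o → concatMap vertices (ds o)) chosen all-↭ os′)))))
                where open ↭-Solver

    open Layout layout

    AV : List V
    AV = concatMap vertices aux

    AV-unique : Unique AV
    AV-unique = unique-++ʳ (concatMap allVertices os) all-unique

    AV⊆X : AV ⊆ X
    AV⊆X i = ↭-∈ (↭-sym X-↭) (∈-++⁺ʳ (concatMap allVertices os) i)

    sinks sources terminals : List V
    sinks = map sink aux
    sources = map source aux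
    terminals = sinks ++ sources

    sink∈A : ∀ p → sink p ∈ listA p
    sink∈A p = end-∈ (pathA p)

    source∈B : ∀ p → source p ∈ listB p
    source∈B p = end-∈ (pathB p)

    -- The reserved vertices that links must avoid. The ends of the linking paths are left out,
    -- since the Menger paths have to start and finish there.
    F : List V
    F = filter (λ v → ¬? (v ∈? terminals)) X

    ∉F-terminal : ∀ {v} → v ∈ X → v ∉ F → v ∈ terminals
    ∉F-terminal {v} i n with v ∈? terminals
    ... | yes j = j
    ... | no t = contradiction (∈-filter⁺ (λ v → ¬? (v ∈? terminals)) i t) n

    terminal-∉F : ∀ {v} → v ∈ terminals → v ∉ F
    terminal-∉F j i = proj₂ (∈-filter⁻ (λ v → ¬? (v ∈? terminals)) {xs = X} i) j

    Free : V × V → Set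
    Free a = T (proj₁ a) (proj₂ a) ≡ true × proj₁ a ∉ F × proj₂ a ∉ F

    free? : Decidable Free
    free? (u , v) = O.arc? u v ×-dec (¬? (u ∈? F) ×-dec ¬? (v ∈? F))

    freeArcs : List (V × V)
    freeArcs = filter free? (cartesianProduct (allFin n) (allFin n))

    open Menger (Fin._≟_ {n}) using (Arc; Separator; ABPath; Family; menger)

    free⁻ : ∀ {u v} → Arc freeArcs u v → Free (u , v)
    free⁻ i = proj₂ (∈-filter⁻ free? {xs = cartesianProduct (allFin n) (allFin n)} i)

    free⁺ : ∀ {u v} → Free (u , v) → Arc freeArcs u v
    free⁺ f = ∈-filter⁺ free? (∈-cartesianProduct⁺ (∈-allFin _) (∈-allFin _)) f

    -- Fewer than `q` vertices leave out some sink and some source. As `F` and `Z` together have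
    -- fewer than `K` vertices, connectivity joins these two by a path that avoids both sets.
    no-separator : ∀ Z → length Z < q → ¬ Separator freeArcs sinks sources Z
    no-separator Z lt sep = go (pick′ sinks sinks-unique (Lₚ.length-map sink aux)) (pick′ sources sources-unique (Lₚ.length-map source aux))
      where
      sinks-unique : Unique sinks
      sinks-unique = unique-map-blocks vertices sink aux (λ p → ∈-++⁺ˡ (sink∈A p)) AV-unique
      sources-unique : Unique sources
      sources-unique = unique-map-blocks vertices source aux (λ p → ∈-++⁺ʳ (listA p) (source∈B p)) AV-unique
      pick′ : ∀ xs → Unique xs → length xs ≡ length aux → ∃ λ y → y ∈ xs × y ∉ Z
      pick′ xs u e = escape Z u (≤-trans lt (≤-reflexive (sym (trans e aux-count))))
      small : length (F ++ Z) < K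
      small = small-K 2 (≤-trans (≤-reflexive (Lₚ.length-++ F)) (≤-trans
        (ℕₚ.+-mono-≤ (≤-trans (Lₚ.length-filter (λ v → ¬? (v ∈? terminals)) X) X≤) (≤-trans (ℕₚ.<⇒≤ lt) q≤B))
        (≤-reflexive (cong (B +_) (sym (ℕₚ.+-identityʳ B)))))) (s≤s (s≤s z≤n))
      avoid : ∀ {v} → v ∈ terminals → v ∉ Z → v ∉ F ++ Z
      avoid t nz i = [ terminal-∉F t , nz ]′ (∈-++⁻ F i)
      convert : ∀ {u v l} → Path Arcs u v l → Disjoint l (F ++ Z) → Path (Arc freeArcs) u v l
      convert (point u) d = point u
      convert (e ◅ p) d = free⁺ (e , (λ i → d (here refl , ∈-++⁺ˡ i)) , λ i → d (there (start-∈ p) , ∈-++⁺ˡ i))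
        ◅ convert p (λ (i , j) → d (there i , j))
      go : (∃ λ y → y ∈ sinks × y ∉ Z) → (∃ λ y → y ∈ sources × y ∉ Z) → ⊥
      go (a , a∈ , a∉) (b , b∈ , b∉) = go′ (conn (F ++ Z) small (avoid (∈-++⁺ˡ a∈) a∉) (avoid (∈-++⁺ʳ sinks b∈) b∉))
        where
        go′ : (∃ λ l → Path Arcs a b l × Disjoint l (F ++ Z)) → ⊥
        go′ (l , p , d) with sep (convert p d) a∈ b∈
        ... | w , i , j = d (i , ∈-++⁺ʳ F j)

    abstract
      family : Family freeArcs sinks sources q
      family = [ (λ (Z , lt , sep) → ⊥-elim (no-separator Z lt sep)) , id ]′ (menger freeArcs sinks sources q)

    open Family family using (member; disjoint)

    module Member (i : Fin q) where
      line : List V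
      line = ABPath.body (member i)
      sink-of : ∃ λ p → p ∈ aux × ABPath.start (member i) ≡ sink p
      sink-of = ∈-map⁻ sink (ABPath.start∈ (member i))
      source-of : ∃ λ p → p ∈ aux × ABPath.end (member i) ≡ source p
      source-of = ∈-map⁻ source (ABPath.end∈ (member i))
      -- In general two different pairs, as Menger's theorem does not prescribe which sink is joined
      -- to which source.
      pA pB : Pair
      pA = proj₁ sink-of
      pB = proj₁ source-of
      cv : List V
      cv = listA pA ++ line ++ listB pB
      body-∉F : ∀ {v} → v ∈ line → v ∉ F
      body-∉F = go (ABPath.path (member i)) (terminal-∉F (∈-++⁺ˡ (ABPath.start∈ (member i))))
        where
        go : ∀ {u w l v} → Path (Arc freeArcs) u w l → u ∉ F → v ∈ l → v ∉ F
        go (point u) nu (here refl) = nu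
        go (e ◅ p) nu (here refl) = nu
        go (e ◅ p) nu (there i) = go p (proj₂ (proj₂ (free⁻ e))) i

    open Member using (cv; pA; pB)

    pairA∈ : ∀ i → pA i ∈ aux
    pairA∈ i = proj₁ (proj₂ (Member.sink-of i))
    pairB∈ : ∀ i → pB i ∈ aux
    pairB∈ i = proj₁ (proj₂ (Member.source-of i))

    same-pair : ∀ {p p′ v} → p ∈ aux → p′ ∈ aux → v ∈ vertices p → v ∈ vertices p′ → p ≡ p′
    same-pair = unique-blocks vertices AV-unique

    A∩B : ∀ {p p′ v} → p ∈ aux → p′ ∈ aux → v ∈ listA p → v ∈ listB p′ → ⊥
    A∩B {p} {p′} i j a b with same-pair i j (∈-++⁺ˡ a) (∈-++⁺ʳ (listA p′) b)
    ... | refl = unique-++-disjoint (listA p) (unique-block aux AV-unique i) (a , b)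
      where
      unique-block : ∀ ps → Unique (concatMap vertices ps) → p ∈ ps → Unique (vertices p)
      unique-block (p ∷ ps) u (here refl) = unique-++ˡ (vertices p) u
      unique-block (p ∷ ps) u (there i) = unique-block ps (unique-++ʳ (vertices p) u) i

    -- A reserved vertex on a Menger path must be a terminal. Being on an out-dominating path, it
    -- can only be the sink of that path, where the `i`-th Menger path starts; disjointness does the
    -- rest.
    A-body : ∀ i j {v} → v ∈ listA (pA i) → v ∈ ABPath.body (member j) → i ≡ j
    A-body i j {v} a b with ∈-++⁻ sinks (∉F-terminal (AV⊆X (∈-concatMap⁺′ vertices (pairA∈ i) (∈-++⁺ˡ a))) (Member.body-∉F j b))
    ... | inj₁ s with ∈-map⁻ sink s
    ...   | p , p∈ , refl with same-pair (pairA∈ i) p∈ (∈-++⁺ˡ a) (∈-++⁺ˡ (sink∈A p))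
    ...     | refl = disjoint i j (subst (_∈ ABPath.body (member i)) (proj₂ (proj₂ (Member.sink-of i))) (start-∈ (ABPath.path (member i)))) b
    A-body i j {v} a b | inj₂ s with ∈-map⁻ source s
    ... | p , p∈ , refl = ⊥-elim (A∩B (pairA∈ i) p∈ a (source∈B p))

    B-body : ∀ i j {v} → v ∈ listB (pB i) → v ∈ ABPath.body (member j) → i ≡ j
    B-body i j {v} a b with ∈-++⁻ sinks (∉F-terminal (AV⊆X (∈-concatMap⁺′ vertices (pairB∈ i) (∈-++⁺ʳ (listA (pB i)) a))) (Member.body-∉F j b))
    ... | inj₂ s with ∈-map⁻ source s
    ...   | p , p∈ , refl with same-pair (pairB∈ i) p∈ (∈-++⁺ʳ (listA (pB i)) a) (∈-++⁺ʳ (listA p) (source∈B p))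
    ...     | refl = disjoint i j (subst (_∈ ABPath.body (member i)) (proj₂ (proj₂ (Member.source-of i))) (end-∈ (ABPath.path (member i)))) b
    B-body i j {v} a b | inj₁ s with ∈-map⁻ sink s
    ... | p , p∈ , refl = ⊥-elim (A∩B p∈ (pairB∈ i) (sink∈A p) a)

    A-A : ∀ i j {v} → v ∈ listA (pA i) → v ∈ listA (pA j) → i ≡ j
    A-A i j a b with same-pair (pairA∈ i) (pairA∈ j) (∈-++⁺ˡ a) (∈-++⁺ˡ b)
    ... | e = A-body i j (sink∈A (pA i)) (subst (_∈ ABPath.body (member j))
      (trans (proj₂ (proj₂ (Member.sink-of j))) (cong sink (sym e))) (start-∈ (ABPath.path (member j))))

    B-B : ∀ i j {v} → v ∈ listB (pB i) → v ∈ listB (pB j) → i ≡ j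
    B-B i j a b with same-pair (pairB∈ i) (pairB∈ j) (∈-++⁺ʳ (listA (pB i)) a) (∈-++⁺ʳ (listA (pB j)) b)
    ... | e = B-body i j (source∈B (pB i)) (subst (_∈ ABPath.body (member j))
      (trans (proj₂ (proj₂ (Member.source-of j))) (cong source (sym e))) (end-∈ (ABPath.path (member j))))

    data Where (i : Fin q) (v : V) : Set where
      inA : v ∈ listA (pA i) → Where i v
      inBody : v ∈ ABPath.body (member i) → Where i v
      inB : v ∈ listB (pB i) → Where i v

    locate : ∀ i {v} → v ∈ cv i → Where i v
    locate i {v} j with ∈-++⁻ (listA (pA i)) j
    ... | inj₁ a = inA a
    ... | inj₂ j′ with ∈-++⁻ (ABPath.body (member i)) j′
    ...   | inj₁ b = inBody b
    ...   | inj₂ b = inB b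

    cv-disjoint : ∀ i j {v} → v ∈ cv i → v ∈ cv j → i ≡ j
    cv-disjoint i j x y with locate i x | locate j y
    ... | inA a | inA b = A-A i j a b
    ... | inA a | inBody b = A-body i j a b
    ... | inA a | inB b = ⊥-elim (A∩B (pairA∈ i) (pairB∈ j) a b)
    ... | inBody a | inA b = sym (A-body j i b a)
    ... | inBody a | inBody b = disjoint i j a b
    ... | inBody a | inB b = sym (B-body j i b a)
    ... | inB a | inA b = ⊥-elim (A∩B (pairA∈ j) (pairB∈ i) b a)
    ... | inB a | inBody b = B-body i j a b
    ... | inB a | inB b = B-B i j a b

    cv-fresh : ∀ i → Disjoint (cv i) (concatMap allVertices os)
    cv-fresh i {v} (x , y) = unique-++-disjoint (concatMap allVertices os) all-unique (y , inAV (locate i x))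
      where
      inAV : Where i v → v ∈ AV
      inAV (inA a) = ∈-concatMap⁺′ vertices (pairA∈ i) (∈-++⁺ˡ a)
      inAV (inB b) = ∈-concatMap⁺′ vertices (pairB∈ i) (∈-++⁺ʳ (listA (pB i)) b)
      inAV (inBody b) with ∈-++⁻ sinks (∉F-terminal (↭-∈ (↭-sym X-↭) (∈-++⁺ˡ y)) (Member.body-∉F i b))
      ... | inj₁ s with ∈-map⁻ sink s
      ...   | p , p∈ , refl = ∈-concatMap⁺′ vertices p∈ (∈-++⁺ˡ (sink∈A p))
      inAV (inBody b) | inj₂ s with ∈-map⁻ source s
      ... | p , p∈ , refl = ∈-concatMap⁺′ vertices p∈ (∈-++⁺ʳ (listA p) (source∈B p))

    record Link (i : Fin q) (x z : V) : Set where
      constructor mkLink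
      field
        {from to} : V
        {list} : List V
        lpath : Path Arcs from to list
        enter-arc : T x from ≡ true
        exit-arc : T to z ≡ true
        link-unique : Unique list
        within : list ⊆ cv i

    WalkIn WalkOut : Fin q → V → Set
    WalkIn i x = ∃₂ λ a l → T x a ≡ true × Path Arcs a (ABPath.start (member i)) l × l ⊆ cv i
    WalkOut i z = ∃₂ λ b l → T b z ≡ true × Path Arcs (ABPath.end (member i)) b l × l ⊆ cv i

    walk-in : ∀ i {x} → x ∉ PV → x ∉ EA → WalkIn i x
    walk-in i {x} x∉ x∉E = go (proj₂ (proj₂ (Member.sink-of i))) (dominatesA (aux⊆ (pairA∈ i)) x∉ x∉E)
      where
      go : ABPath.start (member i) ≡ sink (pA i) → (∃ λ a → a ∈ listA (pA i) × T x a ≡ true) → WalkIn i x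
      go eq (a , a∈ , e) = go′ (walk-from (pathA (pA i)) a∈)
        where
        go′ : (∃ λ l → Path Arcs a (sink (pA i)) l × l ⊆ listA (pA i)) → WalkIn i x
        go′ (l , p , s) = a , l , e , subst (λ v → Path Arcs a v l) (sym eq) p , ∈-++⁺ˡ ∘ s

    walk-out : ∀ i {z} → z ∉ PV → z ∉ EB → WalkOut i z
    walk-out i {z} z∉ z∉E = go (proj₂ (proj₂ (Member.source-of i))) (dominatesB (aux⊆ (pairB∈ i)) z∉ z∉E)
      where
      go : ABPath.end (member i) ≡ source (pB i) → (∃ λ b → b ∈ listB (pB i) × T b z ≡ true) → WalkOut i z
      go eq (b , b∈ , e) = go′ (walk-to (path-reverse (pathB (pB i))) (↭-∈ (↭-sym (Permₚ.↭-reverse (listB (pB i)))) b∈))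
        where
        go′ : (∃ λ l → Path Arcs (source (pB i)) b l × l ⊆ reverse (listB (pB i))) → WalkOut i z
        go′ (l , p , s) = b , l , e , subst (λ v → Path Arcs v b l) (sym eq) p
          , (λ j → ∈-++⁺ʳ (listA (pA i)) (∈-++⁺ʳ (Member.line i) (↭-∈ (Permₚ.↭-reverse (listB (pB i))) (s j))))

    member-path : ∀ i → Path Arcs (ABPath.start (member i)) (ABPath.end (member i)) (Member.line i)
    member-path i = path-map (proj₁ ∘ free⁻) (ABPath.path (member i))

    abstract
      link : ∀ i {x z} → x ∉ PV → x ∉ EA → z ∉ PV → z ∉ EB → Link i x z
      link i {x} {z} x∉ x∉E z∉ z∉E = go (walk-in i x∉ x∉E) (walk-out i z∉ z∉E)
        where
        go : WalkIn i x → WalkOut i z → Link i x z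
        go (a , l₁ , e , p₁ , s₁) (b , l₃ , f , p₃ , s₃) = go₁ (path-join p₁ (member-path i))
          where
          go₁ : (∃ λ l → Path Arcs a (ABPath.end (member i)) l × (∀ {v} → v ∈ l → v ∈ l₁ ⊎ v ∈ Member.line i)) → Link i x z
          go₁ (l₁₂ , p₁₂ , s₁₂) = go₂ (path-join p₁₂ p₃)
            where
            go₂ : (∃ λ l → Path Arcs a b l × (∀ {v} → v ∈ l → v ∈ l₁₂ ⊎ v ∈ l₃)) → Link i x z
            go₂ (l , p , s) = go₃ (path-simplify p)
              where
              sub : ∀ {v} → v ∈ l₁₂ ⊎ v ∈ l₃ → v ∈ cv i
              sub (inj₂ k) = s₃ k
              sub (inj₁ k) = [ s₁ , (λ j → ∈-++⁺ʳ (listA (pA i)) (∈-++⁺ˡ j)) ]′ (s₁₂ k)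
              go₃ : (∃ λ l′ → Path Arcs a b l′ × Unique l′ × l′ ⊆ l) → Link i x z
              go₃ (l′ , p′ , u , t) = mkLink p′ e f u (λ j → sub (s (t j)))

  open Linking
  open Layout layout
  open Member using (cv)

  -- Assembling the tracks

  bodies : List Ext → List V
  bodies = concatMap (body ∘ whole)

  record Track (e : Ext) (es : List Ext) (is : List (Fin q)) : Set where
    constructor mkTrack
    field
      {target} : V
      {track} : List V
      spine : Path Arcs (s″ e) target track
      track-unique : Unique track
      contains : ∀ {e′} → e′ ∈ e ∷ es → Infix (body (whole e′)) track
      within : ∀ {x} → x ∈ track → x ∈ bodies (e ∷ es) ⊎ (∃ λ i → i ∈ is × x ∈ cv i)

  abstract
    -- Each junction uses up its own index from `is`, and different indices have disjoint links, so
    -- no vertex is visited twice.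
    assemble : ∀ e es is → length es ≤ length is → Unique (bodies (e ∷ es)) → Unique is →
      (∀ {e′} → e′ ∈ e ∷ es → EndsOK e′) → (∀ i → Disjoint (cv i) (bodies (e ∷ es))) → Track e es is
    assemble e [] is le u ui ok fr = mkTrack (path (whole e)) (unique-++ˡ (body (whole e)) u)
      (λ { (here refl) → infix-refl }) (inj₁ ∘ ∈-++⁺ˡ)
    assemble e (e₁ ∷ es) (i ∷ is) (s≤s le) u ui ok fr = join
        (assemble e₁ es is le (unique-++ʳ (body (whole e)) u) (unique-tail ui) (ok ∘ there) (λ j (x , y) → fr j (x , ∈-++⁺ʳ (body (whole e)) y)))
        (link i (λ j → proj₁ (ok (here refl)) (there (there (there (here refl))) , j)) (proj₂ (proj₂ (ok (here refl))))
          (λ j → proj₁ (ok (there (here refl))) (here refl , j)) (proj₁ (proj₂ (ok (there (here refl))))))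
      where
      join : Track e₁ es is → Link i (t″ e) (s″ e₁) → Track e (e₁ ∷ es) (i ∷ is)
      join (mkTrack {track = t} sp tu con win) (mkLink {list = l} lp ea xa lu lw) = mkTrack
        (path-++ (path (whole e)) ea (path-++ lp xa sp))
        (Uₚ.++⁺ (unique-++ˡ (body (whole e)) u) (Uₚ.++⁺ lu tu apart) apart′)
        (λ { (here refl) → infix-++ʳ (l ++ t) infix-refl ; (there j) → infix-++ˡ (body (whole e)) (infix-++ˡ l (con j)) })
        (λ j → [ (λ x → inj₁ (∈-++⁺ˡ x)) , (λ j′ → [ (λ x → inj₂ (i , here refl , lw x)) ,
          (λ x → [ inj₁ ∘ ∈-++⁺ʳ (body (whole e)) , (λ (k , a , b) → inj₂ (k , there a , b)) ]′ (win x)) ]′ (∈-++⁻ l j′)) ]′ (∈-++⁻ (body (whole e)) j))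
        where
        apart : Disjoint l t
        apart (x , y) = [ (λ b → fr i (lw x , ∈-++⁺ʳ (body (whole e)) b))
          , (λ (j , j∈ , z) → unique-head ui (subst (_∈ is) (cv-disjoint j i z (lw x)) j∈)) ]′ (win y)
        apart′ : Disjoint (body (whole e)) (l ++ t)
        apart′ (x , y) = [ (λ z → fr i (lw z , ∈-++⁺ˡ x))
          , (λ z → [ (λ b → unique-++-disjoint (body (whole e)) u (x , b)) , (λ (j , _ , w) → fr j (w , ∈-++⁺ˡ x)) ]′ (win z)) ]′ (∈-++⁻ l y)

  r : ℕ
  r = 3 * k

  abstract
    leave : ∀ v l → length l ≤ 3 * length X + r → ∃ λ z → T v z ≡ true × z ∉ l
    leave v l le = out-K v l (small-K 4 (≤-trans le (≤-trans (ℕₚ.+-mono-≤ (ℕₚ.*-monoʳ-≤ 3 X≤) 3k≤B) (≤-reflexive (ℕₚ.+-comm (3 * B) B)))) (ℕₚ.m≤m+n 4 24))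

    enter : ∀ v l → length l ≤ 3 * length X + r → ∃ λ z → T z v ≡ true × z ∉ l
    enter v l le = in-K v l (small-K 4 (≤-trans le (≤-trans (ℕₚ.+-mono-≤ (ℕₚ.*-monoʳ-≤ 3 X≤) 3k≤B) (≤-reflexive (ℕₚ.+-comm (3 * B) B)))) (ℕₚ.m≤m+n 4 24))

    leave′ : ∀ v l → v ∉ X → length l ≤ 3 * length (X ++ EA) + r → ∃ λ z → T v z ≡ true × z ∉ l
    leave′ v l n le = out-D v l (n ∘ ∈-++⁺ˡ) (below h 10
      (≤-trans (ℕₚ.*-monoʳ-≤ h (≤-trans le (≤-reflexive (cong (λ y → 3 * y + r) (trans (Lₚ.length-++ X) (cong (length X +_) (sym (ℕₚ.+-identityʳ _))))))))
        (weigh h (length X) (length EA) 0 r D⁺ (≤-trans (ℕₚ.*-monoʳ-≤ h X≤) (≤-trans B≤ K≤D⁺)) EA≤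
          (≤-trans (≤-reflexive (ℕₚ.*-zeroʳ h)) z≤n) (≤-trans (ℕₚ.*-monoʳ-≤ h 3k≤B) (≤-trans B≤ K≤D⁺))))
      (≤-trans (ℕₚ.m≤m+n 11 18) h>) (≤-trans K>0 K≤D⁺))

    -- Here `D⁺` must not exceed `D⁻`: the bound on `EA` is a fraction of `D⁺`, yet `EA` has to be
    -- small compared with in-degrees.
    enter′ : ∀ v l → v ∉ X → length l ≤ 3 * length (X ++ EA ++ EB) + r → ∃ λ z → T z v ≡ true × z ∉ l
    enter′ v l n le = in-D v l (n ∘ ∈-++⁺ˡ) (below h 10
      (≤-trans (ℕₚ.*-monoʳ-≤ h (≤-trans le (≤-reflexive (cong (λ y → 3 * y + r) (trans (Lₚ.length-++ X) (cong (length X +_) (Lₚ.length-++ EA)))))))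
        (weigh h (length X) (length EA) (length EB) r D⁻ (≤-trans (ℕₚ.*-monoʳ-≤ h X≤) (≤-trans B≤ K≤D⁻)) (≤-trans EA≤ D≤)
          EB≤ (≤-trans (ℕₚ.*-monoʳ-≤ h 3k≤B) (≤-trans B≤ K≤D⁻))))
      (≤-trans (ℕₚ.m≤m+n 11 18) h>) (≤-trans K>0 K≤D⁻))

  module One {o : Proto} (o∈ : o ∈ os) where

    o-unique : Unique (allVertices o)
    o-unique = block os (unique-++ˡ (concatMap allVertices os) all-unique) o∈
      where
      block : ∀ os′ → Unique (concatMap allVertices os′) → o ∈ os′ → Unique (allVertices o)
      block (o′ ∷ os′) u (here refl) = unique-++ˡ (allVertices o′) u
      block (o′ ∷ os′) u (there i) = block os′ (unique-++ʳ (allVertices o′) u) i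

    gapVerts edgeVerts : List V
    gapVerts = concatMap (Gap.vertices ∘ toGap) (gs o)
    edgeVerts = concatMap edge (cs o)

    shape : allVertices o ↭ gapVerts ++ edgeVerts ++ concatMap added (es o)
    shape = ↭-trans (all-↭ o) (↭-trans
      (↭-reflexive (sym (Lₚ.++-assoc (concatMap vertices (ds o)) (concatMap mid (gs o)) (edgeVerts ++ concatMap added (es o)))))
      (Permₚ.++⁺ʳ (edgeVerts ++ concatMap added (es o)) (↭-trans
        (↭-reflexive (cong (λ d → concatMap vertices d ++ concatMap mid (gs o)) (sym (owners o))))
        (↭-sym (gap-vertices-↭ (gs o))))))

    shape-unique : Unique (gapVerts ++ edgeVerts ++ concatMap added (es o))
    shape-unique = Unique-resp-↭ shape o-unique

    allV⊆X : allVertices o ⊆ X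
    allV⊆X i = ↭-∈ (↭-sym X-↭) (∈-++⁺ˡ (∈-concatMap⁺′ allVertices o∈ i))

    Γ : List (Gap V)
    Γ = map toGap (gs o)

    covs : List (Cover V)
    covs = map cov (cs o)

    Γ-vertices : concatMap Gap.vertices Γ ≡ gapVerts
    Γ-vertices = concatMap-map′ Gap.vertices toGap (gs o)

    covs-edges : concatMap Cover.edge covs ≡ edgeVerts
    covs-edges = concatMap-map′ Cover.edge cov (cs o)

    covs-at : map Cover.at covs ≡ gapVerts
    covs-at = trans (sym (Lₚ.map-∘ (cs o))) (ats o)

    in-gaps : ∀ {γ v} → γ ∈ Γ → v ∈ Gap.vertices γ → v ∈ gapVerts
    in-gaps {v = v} i j = subst (v ∈_) Γ-vertices (∈-concatMap⁺′ Gap.vertices i j)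

    in-edges : ∀ {c v} → c ∈ covs → v ∈ Cover.edge c → v ∈ edgeVerts
    in-edges {v = v} i j = subst (v ∈_) covs-edges (∈-concatMap⁺′ Cover.edge i j)

    owner∈ : ∀ {g} → g ∈ gs o → owner g ∈ pairs⁰
    owner∈ {g} i = proj₂ (groups o∈) (subst (owner g ∈_) (owners o) (∈-map⁺ owner i))

    based : ∀ {s} → s ∈ map gapSeg (gs o) ++ map covSeg (cs o) → ∃ λ e → e ∈ es o × s ≡ base e
    based {s} i = ∈-map⁻ base (subst (s ∈_) (sym (bases o)) i)

    into : ∀ {v} → v ∉ PV → v ∉ EA → ∀ γ → γ ∈ Γ → ∃ λ a → a ∈ Gap.entries γ × T v a ≡ true
    into n n′ γ i with ∈-map⁻ toGap i
    ... | g , j , refl = dominatesA (owner∈ j) n n′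

    outOf : ∀ {v} → v ∉ PV → v ∉ EB → ∀ γ → γ ∈ Γ → ∃ λ b → b ∈ Gap.exits γ × T b v ≡ true
    outOf n n′ γ i with ∈-map⁻ toGap i
    ... | g , j , refl = let b , b∈ , e = dominatesB (owner∈ j) n n′ in b , ↭-∈ (↭-sym (Permₚ.↭-reverse (listB (owner g)))) b∈ , e

  packData : PackData
  packData = record { n = n ; T = T ; tournament = tour ; X = X ; EA = EA ; EB = EB ; r = r ; leave = leave
      ; enter = enter ; leave′ = leave′ ; enter′ = enter′ }

  module P = PackingOf packData

  abstract
    struct : ∀ {o} (o∈ : o ∈ os) {e es′ is} → es o ≡ e ∷ es′ → Track e es′ is → P.Struct
    struct {o} o∈ eq t = record
      { spine = spine ; track-unique = track-unique ; Γ = Γ ; covs = covs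
      ; gap-unique = subst Unique (sym Γ-vertices) (unique-++ˡ gapVerts shape-unique)
      ; cov-unique = subst Unique (sym covs-edges) (unique-++ˡ edgeVerts (unique-++ʳ gapVerts shape-unique))
      ; at-unique = subst Unique (sym covs-at) (unique-++ˡ gapVerts shape-unique)
      ; cov-gap = λ c∈ γ∈ (i , j) → unique-++-disjoint gapVerts shape-unique (in-gaps γ∈ i , ∈-++⁺ˡ (in-edges c∈ j))
      ; cov-arcs = cov-arcs′
      ; gap-middle = gap-middle′
      ; covered = covered′
      ; at∈ = at∈′
      ; gap⊆X = λ i j → allV⊆X (↭-∈ (↭-sym shape) (∈-++⁺ˡ (in-gaps i j)))
      ; cov⊆X = λ i j → allV⊆X (↭-∈ (↭-sym shape) (∈-++⁺ʳ gapVerts (∈-++⁺ˡ (in-edges i j))))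
      ; gaps-in = gaps-in′
      ; edges-in = edges-in′
      ; into = λ n → into (n ∘ ∈-++⁺ˡ ∘ ∈-++⁺ˡ) (n ∘ ∈-++⁺ʳ X)
      ; outOf = λ n → outOf (n ∘ ∈-++⁺ˡ ∘ ∈-++⁺ˡ) (n ∘ ∈-++⁺ʳ X)
      ; middle-good = middle-good′
      ; enough = ≤-trans gaps≤ (≤-reflexive (sym (trans (Lₚ.length-map toGap (gs o))
          (trans (sym (Lₚ.length-map owner (gs o))) (trans (cong length (owners o)) (proj₁ (groups o∈)))))))
      }
      where
      open Track t
      open One o∈
      whole-in : ∀ {e′} → e′ ∈ es o → Infix (body (whole e′)) track
      whole-in {e′} i = contains (subst (e′ ∈_) eq i)
      gaps-in′ : ∀ {γ} → γ ∈ Γ → Infix (Gap.vertices γ) track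
      gaps-in′ i with ∈-map⁻ toGap i
      ... | g , j , refl with based (∈-++⁺ˡ (∈-map⁺ gapSeg j))
      ...   | e′ , k , eq′ = subst (λ b → Infix b track) (sym (cong body eq′)) (infix-trans (base-infix e′) (whole-in k))
      edges-in′ : ∀ {c} → c ∈ covs → Infix (Cover.edge c) track
      edges-in′ i with ∈-map⁻ cov i
      ... | g , j , refl with based (∈-++⁺ʳ (map gapSeg (gs o)) (∈-map⁺ covSeg j))
      ...   | e′ , k , eq′ = subst (λ b → Infix b track) (sym (cong body eq′)) (infix-trans (base-infix e′) (whole-in k))
      cov-arcs′ : ∀ {c} → c ∈ covs → T (Cover.from c) (Cover.at c) ≡ true × T (Cover.at c) (Cover.to c) ≡ true
      cov-arcs′ i with ∈-map⁻ cov i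
      ... | g , j , refl = CovO.inward g , CovO.outward g
      gap-middle′ : ∀ {γ} → γ ∈ Γ → Gap.middle γ ≢ []
      gap-middle′ i with ∈-map⁻ toGap i
      ... | g , j , refl = λ e → contradiction (subst (GapO.first g ∈_) e (start-∈ (GapO.mpath g))) λ ()
      covered′ : ∀ {γ v} → γ ∈ Γ → v ∈ Gap.vertices γ → ∃ λ c → c ∈ covs × Cover.at c ≡ v
      covered′ {v = v} i j with ∈-map⁻ Cover.at (subst (v ∈_) (sym covs-at) (in-gaps i j))
      ... | c′ , k , e = c′ , k , sym e
      at∈′ : ∀ {c} → c ∈ covs → Cover.at c ∈ track
      at∈′ {c} i with ∈-concatMap⁻′ Gap.vertices Γ (subst (Cover.at c ∈_) (trans covs-at (sym Γ-vertices)) (∈-map⁺ Cover.at i))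
      ... | γ , γ∈ , j = infix-∈ (gaps-in′ γ∈) j
      middle-good′ : ∀ {γ v} → γ ∈ Γ → v ∈ Gap.middle γ → P.OutOf Γ v × P.Into Γ v
      middle-good′ i j with ∈-map⁻ toGap i
      ... | g , g∈ , refl with clean o g∈ j
      ...   | n , nA , nB = outOf n nB , into n nA

    struct-track : ∀ {o} (o∈ : o ∈ os) {e es′ is} (eq : es o ≡ e ∷ es′) (t : Track e es′ is) →
      P.Struct.track (struct o∈ eq t) ≡ Track.track t
    struct-track o∈ eq t = refl

  Structs : List Proto → List (List (Fin q)) → Set
  Structs os′ iss = ∃ λ Ss → length Ss ≡ length os′ × Unique (concatMap P.Struct.track Ss) ×
    (∀ {x} → x ∈ concatMap P.Struct.track Ss → x ∈ concatMap allVertices os′ ⊎ (∃ λ i → i ∈ concat iss × x ∈ cv i))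

  structs : ∀ os′ iss → os′ ⊆ os → length iss ≡ length os′ → All (λ is → length is ≡ ℓ) iss → Unique (concat iss) →
    Unique (concatMap allVertices os′) → Structs os′ iss
  structs [] iss _ _ _ _ _ = [] , refl , [] , λ ()
  structs (o ∷ os′) (is ∷ iss) sub le (l ∷ ls) ui uo = go (es o) refl
      (structs os′ iss (sub ∘ there) (ℕₚ.suc-injective le) ls (unique-++ʳ is ui) (unique-++ʳ (allVertices o) uo))
    where
    o∈ : o ∈ os
    o∈ = sub (here refl)
    nonempty : es o ≢ []
    nonempty eq = contradiction (≤-trans m>0 (≤-reflexive (trans (sym len) (cong length gs≡[])))) λ ()
      where
      gs≡[] : gs o ≡ []
      gs≡[] with gs o | trans (sym (bases o)) (cong (map base) eq)
      ... | [] | _ = refl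
      len : length (gs o) ≡ m
      len = trans (sym (Lₚ.length-map owner (gs o))) (trans (cong length (owners o)) (proj₁ (groups o∈)))
    cv-apart : ∀ i → Disjoint (cv i) (allVertices o)
    cv-apart i (x , y) = cv-fresh i (x , ∈-concatMap⁺′ allVertices o∈ y)
    go : ∀ es′ → es o ≡ es′ → Structs os′ iss → Structs (o ∷ os′) (is ∷ iss)
    go [] eq _ = contradiction eq nonempty
    go (e ∷ es′) eq (Ss , len , u , win) = finish (assemble e es′ is enough
        (subst (Unique ∘ bodies) eq (One.o-unique o∈)) (unique-++ˡ is ui) (λ {e′} i → ends-ok o (subst (e′ ∈_) (sym eq) i))
        (λ i {v} (x , y) → cv-apart i (x , subst (λ es → v ∈ bodies es) (sym eq) y)))
      where
      enough : length es′ ≤ length is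
      enough = ≤-trans (ℕₚ.n≤1+n _) (≤-trans (≤-reflexive (cong length (sym eq))) (≤-trans (es≤ o)
        (≤-trans (≤-reflexive (cong (λ x → x + x * (4 + (c + c))) (proj₁ (groups o∈)))) (≤-trans ℓ≥ (≤-reflexive (sym l))))))
      finish : Track e es′ is → Structs (o ∷ os′) (is ∷ iss)
      finish t = struct o∈ eq t ∷ Ss , cong suc len
        , Uₚ.++⁺ (subst Unique (sym (struct-track o∈ eq t)) (Track.track-unique t)) u apart
        , λ {x} i → [ (λ j → place (Track.within t (subst (x ∈_) (struct-track o∈ eq t) j)))
                , (λ j → [ (λ k → inj₁ (∈-++⁺ʳ (allVertices o) k)) , (λ (i , a , b) → inj₂ (i , ∈-++⁺ʳ is a , b)) ]′ (win j)) ]′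
                (∈-++⁻ (P.Struct.track (struct o∈ eq t)) i)
        where
        in-o : ∀ {x} → x ∈ bodies (e ∷ es′) → x ∈ allVertices o
        in-o {x} i = subst (λ es → x ∈ bodies es) (sym eq) i
        place : ∀ {x} → x ∈ bodies (e ∷ es′) ⊎ (∃ λ i → i ∈ is × x ∈ cv i) →
          x ∈ concatMap allVertices (o ∷ os′) ⊎ (∃ λ i → i ∈ concat (is ∷ iss) × x ∈ cv i)
        place (inj₁ i) = inj₁ (∈-++⁺ˡ (in-o i))
        place (inj₂ (i , a , b)) = inj₂ (i , ∈-++⁺ˡ a , b)
        clash : ∀ {x} → x ∈ bodies (e ∷ es′) ⊎ (∃ λ i → i ∈ is × x ∈ cv i) →
          x ∈ concatMap allVertices os′ ⊎ (∃ λ i → i ∈ concat iss × x ∈ cv i) → ⊥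
        clash (inj₁ a) (inj₁ b) = unique-++-disjoint (allVertices o) uo (in-o a , b)
        clash (inj₁ a) (inj₂ (i , _ , b)) = cv-apart i (b , in-o a)
        clash (inj₂ (i , _ , a)) (inj₁ b) with ∈-concatMap⁻′ allVertices os′ b
        ... | o′ , j , k = cv-fresh i (a , ∈-concatMap⁺′ allVertices (sub (there j)) k)
        clash (inj₂ (i , i∈ , a)) (inj₂ (j , j∈ , b)) with cv-disjoint i j a b
        ... | refl = unique-++-disjoint is ui (i∈ , j∈)
        apart : Disjoint (P.Struct.track (struct o∈ eq t)) (concatMap P.Struct.track Ss)
        apart {v} (x , y) = clash (Track.within t (subst (v ∈_) (struct-track o∈ eq t) x)) (win y)

  abstract
    packed : Cycles.Packing T k
    packed = go (chunks k ℓ (allFin q) (trans (Lₚ.length-tabulate {n = q} id) q≡))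
      where
      go : (∃ λ iss → concat iss ≡ allFin q × length iss ≡ k × All (λ is → length is ≡ ℓ) iss) → Cycles.Packing T k
      go (iss , eq , len , al) = go′ (structs os iss id (trans len (sym os-count)) al (subst Unique (sym eq) (Uₚ.allFin⁺ q))
          (unique-++ˡ (concatMap allVertices os) all-unique))
        where
        go′ : Structs os iss → Cycles.Packing T k
        go′ (Ss , len′ , u , _) = subst (Cycles.Packing T) (trans len′ os-count)
          (P.pack Ss (≤-reflexive (cong (3 *_) (trans len′ os-count))) u)

-- Numerical requirements, and the packing that follows from them

lin-+ : ∀ {a b x} α β → a ≤ α * x → b ≤ β * x → a + b ≤ (α + β) * x
lin-+ {x = x} α β p q = ≤-trans (ℕₚ.+-mono-≤ p q) (≤-reflexive (sym (ℕₚ.*-distribʳ-+ x α β)))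

lin-↑ : ∀ {a x y} α → a ≤ α * x → x ≤ y → a ≤ α * y
lin-↑ α p q = ≤-trans p (ℕₚ.*-monoʳ-≤ α q)

lin-* : ∀ {a b x y} α β → a ≤ α * x → b ≤ β * y → a * b ≤ (α * β) * (x * y)
lin-* {x = x} {y} α β p q = ≤-trans (ℕₚ.*-mono-≤ p q)
  (≤-reflexive (solve 4 (λ α x β y → (α :* x) :* (β :* y) := (α :* β) :* (x :* y)) refl α x β y))
  where open +-*-Solver

lin-1 : ∀ x → x ≤ 1 * x
lin-1 x = ≤-reflexive (sym (ℕₚ.*-identityˡ x))

record Numbers (k K : ℕ) : Set where
  field
    h c m ℓ q M B B′ : ℕ
    h> : 28 < h
    B>0 : 0 < B
    B≤ : h * B ≤ K
    M+M≤B : M + M ≤ B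
    pairs≤ : M * (2 + (c + c)) ≤ B
    missed≤ : h * M ≤ 2 ^ c
    M>0 : 0 < M
    B′≤ : B′ + protoSize m c ≤ B
    M≡ : M ≡ k * m + q
    q≤B : q ≤ B
    room : M * (2 + (c + c)) + k * protoSize m c ≤ B′
    m>0 : 0 < m
    q≡ : q ≡ k * ℓ
    ℓ≥ : m + m * (4 + (c + c)) ≤ ℓ
    3k≤B : 3 * k ≤ B
    gaps≤ : partCount (3 * k + 3 * k) + suc (suc (3 * k + 3 * k + (3 * k + 3 * k))) ≤ m

pack-extremal : ∀ {n k K} (T : Digraph n) → IsTournament T → K < n → Tournament.Connected T K →
  (N : Numbers k K) (E : Extremal T (Numbers.M N) K) → Extremal.D⁺ E ≤ Extremal.D⁻ E → Cycles.Packing T k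
pack-extremal {n} {k} {K} T tour K<n conn N E D≤ =
  Construction.packed (record { n = n ; T = T ; tour = tour ; M = M ; K = K ; c = c ; E = E ; sel = sel ; K<n = K<n
      ; conn = conn ; D≤ = D≤ ; h = h ; h> = h> ; B = B ; B>0 = B>0 ; B≤ = B≤ ; M+M≤B = M+M≤B
      ; PV≤ = ≤-trans size⁰ pairs≤ ; EA≤ = bound D⁺ (length EA) (missed missA (λ {p} _ → Pair.missA≤ p))
      ; EB≤ = bound D⁻ (length EB) (missed missB (λ {p} _ → Pair.missB≤ p)) ; m = m ; B′ = B′ ; B′≤ = B′≤ ; k = k
      ; q = q ; M≡ = M≡ ; q≤B = q≤B ; room = ≤-trans (ℕₚ.+-monoˡ-≤ (k * protoSize m c) size⁰) room ; m>0 = m>0 ; ℓ = ℓ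
      ; q≡ = q≡ ; ℓ≥ = ℓ≥ ; 3k≤B = 3k≤B ; gaps≤ = gaps≤ })
  where
  open Numbers N
  open Extremal E using (D⁺; D⁻)
  open Pairs T tour M K c E using (Pair; Selection; select)
  open Pair using (missA; missB)
  sel : Selection
  sel = select
  open Selection sel
  missed : ∀ (miss : Pair → List (Fin n)) {D} → (∀ {p} → p ∈ pairs⁰ → 2 ^ c * length (miss p) ≤ D) →
    2 ^ c * length (concatMap miss pairs⁰) ≤ M * D
  missed miss {D} le = subst (λ x → 2 ^ c * length (concatMap miss pairs⁰) ≤ x * D) count (go pairs⁰ le)
    where
    go : ∀ ps → (∀ {p} → p ∈ ps → 2 ^ c * length (miss p) ≤ D) → 2 ^ c * length (concatMap miss ps) ≤ length ps * D
    go [] le = ≤-reflexive (ℕₚ.*-zeroʳ (2 ^ c))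
    go (p ∷ ps) le = ≤-trans (≤-reflexive (trans (cong (2 ^ c *_) (Lₚ.length-++ (miss p))) (ℕₚ.*-distribˡ-+ (2 ^ c) (length (miss p)) _)))
      (ℕₚ.+-mono-≤ (le (here refl)) (go ps (le ∘ there)))
  -- There are `M` exceptional sets, each a fraction 2^-`c` of `D`. Since 2^`c` is at least `h * M`,
  -- their total is at most `D` divided by `h`.
  bound : ∀ D e → 2 ^ c * e ≤ M * D → h * e ≤ D
  bound D e le = ℕₚ.*-cancelˡ-≤ M {{>-nonZero M>0}} (≤-trans
    (≤-reflexive (trans (sym (ℕₚ.*-assoc M h e)) (cong (_* e) (ℕₚ.*-comm M h)))) (≤-trans (ℕₚ.*-monoˡ-≤ e missed≤) le))

-- Reversing all arcs exchanges `D⁺` and `D⁻` and respects packings, so the construction is needed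
-- only when `D⁺` is the smaller one.
pack-tournament : ∀ {n k K} (T : Digraph n) → IsTournament T → K < n → Tournament.Connected T K → Numbers k K → Cycles.Packing T k
pack-tournament {n} {k} {K} T tour K<n conn N = go (ℕₚ.≤-total (Extremal.D⁺ E) (Extremal.D⁻ E))
  where
  open Numbers N
  tourᵗ = transpose-tournament tour
  connᵗ : Tournament.Connected (transpose T) K
  connᵗ = transpose-connected {T = T} conn
  degree : ∀ (T : Digraph n) → IsTournament T → Tournament.Connected T K → ∀ v → K ≤ length (Tournament.outN T v)
  degree T tour conn v = ℕₚ.≮⇒≥ λ lt →
    let z , e , z∉ = Tournament.connected⇒out T tour K<n conn v (Tournament.outN T v) lt in z∉ (Tournament.∈-outN⁺ T e)
  B≤K : B ≤ K
  B≤K = ≤-trans (≤-trans (lin-1 B) (ℕₚ.*-monoˡ-≤ B (≤-trans (s≤s z≤n) h>))) B≤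
  E : Extremal T M K
  E = extremal T M K (≤-trans M+M≤B (≤-trans B≤K (ℕₚ.<⇒≤ K<n))) (degree T tour conn) (degree (transpose T) tourᵗ connᵗ)
  go : Extremal.D⁺ E ≤ Extremal.D⁻ E ⊎ Extremal.D⁻ E ≤ Extremal.D⁺ E → Cycles.Packing T k
  go (inj₁ le) = pack-extremal T tour K<n conn N E le
  go (inj₂ le) = transpose-packing T (pack-extremal (transpose T) tourᵗ K<n connᵗ N (transpose-extremal E) le)

n≤2^n : ∀ n → n ≤ 2 ^ n
n≤2^n zero = z≤n
n≤2^n (suc n) = ≤-trans (ℕₚ.+-mono-≤ (ℕₚ.m^n>0 2 n) (n≤2^n n)) (≤-reflexive (cong (2 ^ n +_) (sym (ℕₚ.+-identityʳ (2 ^ n)))))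

-- This allows lower-order terms to be absorbed into multiples of the logarithm. It also makes
-- rounding up harmless, as a number that is at least 1 at most doubles by it.
log>0 : ∀ k → 2 ≤ k → 1 ≤ ⌈log₂ k ⌉
log>0 k 2≤k = ⌈log₂⌉-mono-≤ 2≤k

n≤2^log : ∀ n → n ≤ 2 ^ ⌈log₂ n ⌉
n≤2^log = <-rec _ step′
  where
  step′ : ∀ n → (∀ {m} → m < n → m ≤ 2 ^ ⌈log₂ m ⌉) → n ≤ 2 ^ ⌈log₂ n ⌉
  step′ zero rec = z≤n
  step′ (suc zero) rec = ℕₚ.m^n>0 2 ⌈log₂ 1 ⌉
  step′ n@(suc (suc n′)) rec = begin
    n                                        ≡⟨ sym (ℕₚ.⌊n/2⌋+⌈n/2⌉≡n n) ⟩
    Data.Nat.⌊ n /2⌋ + ⌈ n /2⌉               ≤⟨ ℕₚ.+-monoˡ-≤ ⌈ n /2⌉ (ℕₚ.⌊n/2⌋≤⌈n/2⌉ n) ⟩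
    ⌈ n /2⌉ + ⌈ n /2⌉                        ≡⟨ cong (⌈ n /2⌉ +_) (sym (ℕₚ.+-identityʳ _)) ⟩
    2 * ⌈ n /2⌉                              ≤⟨ ℕₚ.*-monoʳ-≤ 2 (rec (ℕₚ.⌈n/2⌉<n n′)) ⟩
    2 * 2 ^ ⌈log₂ ⌈ n /2⌉ ⌉                  ≡⟨ cong (λ e → 2 * 2 ^ e) (⌈log₂⌈n/2⌉⌉≡⌈log₂n⌉∸1 n) ⟩
    2 ^ suc (⌈log₂ n ⌉ ∸ 1)                  ≡⟨ cong (2 ^_) (ℕₚ.m+[n∸m]≡n (log>0 n (s≤s (s≤s z≤n)))) ⟩
    2 ^ ⌈log₂ n ⌉                            ∎
    where open ≤-Reasoning

-- The constants

module Constants (h μ t : ℕ) where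

  -- Coefficients of upper bounds, with `L` for the logarithm: `A` for the size of a gap against
  -- `L`, `λ′` and `π` for `ℓ` and `protoSize` against `k * L`, `ν` for the number of pairs against
  -- `k * k * L`, and `β` for `B` against the product of both squares.
  A λ′ ν π β : ℕ
  A = 4 + ((t + (1 + (1 + 1))) + (t + (1 + (1 + 1))))
  λ′ = μ + μ * A
  ν = μ + λ′
  π = μ * 2 + (μ * A * 2 + λ′ * 4)
  β = (((ν * A + π) + π) + (ν + ν)) + (3 + 1)

  numbers : 28 < h → 0 < μ → h * ν ≤ 2 ^ t → (∀ k → 1 ≤ k → partCount (3 * k + 3 * k) + suc (suc (3 * k + 3 * k + (3 * k + 3 * k))) ≤ μ * k) →
    ∀ k L → 1 ≤ k → 1 ≤ L → k ≤ 2 ^ L → Numbers k (h * β * (k * k) * (L * L))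
  numbers h> μ>0 hν gaps k L k>0 L>0 k≤ = record
    { h = h ; c = c ; m = m ; ℓ = ℓ ; q = q ; M = M ; B = B ; B′ = B′
    ; h> = h>
    ; B>0 = ≤-trans (ℕₚ.m≤n+m 1 (3 * k)) (ℕₚ.m≤n+m (3 * k + 1) ((B′ + protoSize m c) + (M + M)))
    ; B≤ = ≤-trans (ℕₚ.*-monoʳ-≤ h B-bound) (≤-reflexive (trans (sym (ℕₚ.*-assoc h β W)) K≡))
    ; M+M≤B = ≤-trans (ℕₚ.m≤n+m (M + M) (B′ + protoSize m c)) (ℕₚ.m≤m+n _ _)
    ; pairs≤ = ≤-trans (ℕₚ.m≤m+n _ (k * protoSize m c)) B′≤B
    ; missed≤ = missed
    ; M>0 = ≤-trans (ℕₚ.*-mono-≤ k>0 m>0) (ℕₚ.m≤m+n (k * m) q)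
    ; B′≤ = ≤-trans (ℕₚ.m≤m+n _ (M + M)) (ℕₚ.m≤m+n _ _)
    ; M≡ = refl
    ; q≤B = ≤-trans (ℕₚ.m≤n+m q (k * m)) (≤-trans (ℕₚ.m≤m+n M M) (≤-trans (ℕₚ.m≤n+m (M + M) (B′ + protoSize m c)) (ℕₚ.m≤m+n _ _)))
    ; room = ≤-refl
    ; m>0 = m>0 ; q≡ = refl ; ℓ≥ = ≤-refl
    ; 3k≤B = ≤-trans (ℕₚ.m≤m+n (3 * k) 1) (ℕₚ.m≤n+m (3 * k + 1) ((B′ + protoSize m c) + (M + M)))
    ; gaps≤ = gaps k k>0 }
    where
    c m g ℓ q M B B′ x W : ℕ
    -- Three summands `L` pay for the factors `k`, `k` and `L` in the bound on `M`, each at most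
    -- 2^`L`; the summand `t * L` pays for the constant `h * ν`.
    c = t * L + (L + (L + L))
    m = μ * k
    g = m * (4 + (c + c))
    ℓ = m + g
    q = k * ℓ
    M = k * m + q
    B′ = M * (2 + (c + c)) + k * protoSize m c
    -- A sum instead of a maximum: every quantity that `B` has to exceed is bounded by some of the
    -- summands.
    B = ((B′ + protoSize m c) + (M + M)) + (3 * k + 1)
    x = k * L
    W = k * x * L
    m>0 : 0 < m
    m>0 = ℕₚ.*-mono-≤ μ>0 k>0
    B′≤B : B′ ≤ B
    B′≤B = ≤-trans (ℕₚ.m≤m+n B′ (protoSize m c)) (≤-trans (ℕₚ.m≤m+n _ (M + M)) (ℕₚ.m≤m+n _ _))
    k≤x : k ≤ x
    k≤x = ℕₚ.m≤m*n k L {{>-nonZero L>0}}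
    kx≤W : k * x ≤ W
    kx≤W = ℕₚ.m≤m*n (k * x) L {{>-nonZero L>0}}
    x≤kx : x ≤ k * x
    x≤kx = ℕₚ.m≤n*m x k {{>-nonZero k>0}}
    x≤W : x ≤ W
    x≤W = ≤-trans x≤kx kx≤W
    1≤x : 1 ≤ x
    1≤x = ℕₚ.*-mono-≤ k>0 L>0
    c≤ : c ≤ (t + (1 + (1 + 1))) * L
    c≤ = lin-+ {x = L} t (1 + (1 + 1)) ≤-refl (lin-+ {x = L} 1 (1 + 1) (lin-1 L) (lin-+ {x = L} 1 1 (lin-1 L) (lin-1 L)))
    4+2c≤ : 4 + (c + c) ≤ A * L
    4+2c≤ = lin-+ {4} {c + c} {L} 4 ((t + 3) + (t + 3)) (ℕₚ.*-monoʳ-≤ 4 L>0) (lin-+ {c} {c} {L} (t + 3) (t + 3) c≤ c≤)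
    2+2c≤ : 2 + (c + c) ≤ A * L
    2+2c≤ = ≤-trans (s≤s (s≤s (ℕₚ.m≤n+m (c + c) 2))) 4+2c≤
    m≤ : m ≤ μ * x
    m≤ = ℕₚ.*-monoʳ-≤ μ k≤x
    g≤ : g ≤ (μ * A) * x
    g≤ = lin-* {x = k} {L} μ A ≤-refl 4+2c≤
    ℓ≤ : ℓ ≤ λ′ * x
    ℓ≤ = lin-+ {x = x} μ (μ * A) m≤ g≤
    k· : ∀ {a} α → a ≤ α * x → k * a ≤ α * (k * x)
    k· {a} α p = ≤-trans (ℕₚ.*-monoʳ-≤ k p) (≤-reflexive (trans (sym (ℕₚ.*-assoc k α x)) (trans (cong (_* x) (ℕₚ.*-comm k α)) (ℕₚ.*-assoc α k x))))
    M≤ : M ≤ ν * (k * x)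
    M≤ = lin-+ {x = k * x} μ λ′ (k· μ m≤) (k· λ′ ℓ≤)
    proto≤ : protoSize m c ≤ π * x
    proto≤ = lin-+ {x = x} (μ * 2) (μ * A * 2 + λ′ * 4) (times μ 2 m≤) (lin-+ {x = x} (μ * A * 2) (λ′ * 4) (times (μ * A) 2 g≤) (times λ′ 4 ℓ≤))
      where
      times : ∀ {a} α j → a ≤ α * x → a * j ≤ (α * j) * x
      times α j p = ≤-trans (ℕₚ.*-monoˡ-≤ j p) (≤-reflexive (trans (ℕₚ.*-assoc α x j) (trans (cong (α *_) (ℕₚ.*-comm x j)) (sym (ℕₚ.*-assoc α j x)))))
    B-bound : B ≤ β * W
    B-bound = lin-+ {x = W} (((ν * A + π) + π) + (ν + ν)) (3 + 1)
      (lin-+ {x = W} ((ν * A + π) + π) (ν + ν)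
        (lin-+ {x = W} (ν * A + π) π
          (lin-+ {x = W} (ν * A) π (lin-* {x = k * x} {L} ν A M≤ 2+2c≤) (lin-↑ π (k· π proto≤) kx≤W))
          (lin-↑ π proto≤ x≤W))
        (lin-+ {x = W} ν ν (lin-↑ ν M≤ kx≤W) (lin-↑ ν M≤ kx≤W)))
      (lin-+ {x = W} 3 1 (ℕₚ.*-monoʳ-≤ 3 (≤-trans k≤x x≤W)) (≤-trans (≤-trans 1≤x x≤W) (lin-1 W)))
    K≡ : h * β * W ≡ h * β * (k * k) * (L * L)
    K≡ = trans (cong (h * β *_) (trans (cong (_* L) (sym (ℕₚ.*-assoc k k L))) (ℕₚ.*-assoc (k * k) L L))) (sym (ℕₚ.*-assoc (h * β) (k * k) (L * L)))
    missed : h * M ≤ 2 ^ c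
    missed = begin
      h * M                                  ≤⟨ ℕₚ.*-monoʳ-≤ h M≤ ⟩
      h * (ν * (k * (k * L)))                ≡⟨ sym (ℕₚ.*-assoc h ν _) ⟩
      h * ν * (k * (k * L))                  ≤⟨ ℕₚ.*-mono-≤ (≤-trans hν (ℕₚ.^-monoʳ-≤ 2 (ℕₚ.m≤m*n t L {{>-nonZero L>0}})))
                                                  (ℕₚ.*-mono-≤ k≤ (ℕₚ.*-mono-≤ k≤ (n≤2^n L))) ⟩
      2 ^ (t * L) * (2 ^ L * (2 ^ L * 2 ^ L)) ≡⟨ cong (2 ^ (t * L) *_) (trans (cong (2 ^ L *_) (sym (ℕₚ.^-distribˡ-+-* 2 L L))) (sym (ℕₚ.^-distribˡ-+-* 2 L (L + L)))) ⟩
      2 ^ (t * L) * 2 ^ (L + (L + L))        ≡⟨ sym (ℕₚ.^-distribˡ-+-* 2 (t * L) (L + (L + L))) ⟩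
      2 ^ c                                  ∎
      where open ≤-Reasoning

abstract
  gaps-suffice : ∀ k → 1 ≤ k → partCount (3 * k + 3 * k) + suc (suc (3 * k + 3 * k + (3 * k + 3 * k))) ≤ 200 * k
  gaps-suffice k k>0 = begin
    partCount (3 * k + 3 * k) + suc (suc (3 * k + 3 * k + (3 * k + 3 * k)))
      ≡⟨ cong (_+ suc (suc (3 * k + 3 * k + (3 * k + 3 * k)))) (partCount≡ (3 * k + 3 * k)) ⟩
    21 * (3 * k + 3 * k) + 37 + suc (suc (3 * k + 3 * k + (3 * k + 3 * k)))
      ≡⟨ solve 1 (λ k → con 21 :* (con 3 :* k :+ con 3 :* k) :+ con 37 :+ (con 1 :+ (con 1 :+ (con 3 :* k :+ con 3 :* k :+ (con 3 :* k :+ con 3 :* k)))) :=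
           con 138 :* k :+ con 39) refl k ⟩
    138 * k + 39
      ≤⟨ ℕₚ.+-monoʳ-≤ (138 * k) (ℕₚ.*-monoʳ-≤ 39 k>0) ⟩
    138 * k + 39 * k
      ≡⟨ sym (ℕₚ.*-distribʳ-+ k 138 39) ⟩
    177 * k
      ≤⟨ ℕₚ.*-monoˡ-≤ k (ℕₚ.m≤m+n 177 23) ⟩
    200 * k ∎
    where
    open ≤-Reasoning
    open +-*-Solver

  C : ℕ
  C = 29 * Constants.β 29 200 21

  C>0 : 0 < C
  C>0 = ℕₚ.≤ᵇ⇒≤ 1 (29 * Constants.β 29 200 21) tt

  numbers-for : ∀ k → 2 ≤ k → Numbers k (C * (k * k) * (⌈log₂ k ⌉ * ⌈log₂ k ⌉))
  numbers-for k 2≤k = Constants.numbers 29 200 21 ≤-refl (s≤s z≤n) (ℕₚ.≤ᵇ⇒≤ (29 * Constants.ν 29 200 21) (2 ^ 21) tt) gaps-suffice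
    k ⌈log₂ k ⌉ (≤-trans (s≤s z≤n) 2≤k) (log>0 k 2≤k) (n≤2^log k)

theorem1p1 : ∃ λ (C : ℕ) → 0 < C ×
    (∀ (k : ℕ) → 2 ≤ k → ∀ (n : ℕ) (T : Digraph n) → IsTournament T →
    StronglyConnected (C * (k * k) * (⌈log₂ k ⌉ * ⌈log₂ k ⌉)) T →
    ∃ λ (H : Fin k → Fin n → Fin n) → EdgeDisjointHamiltonCycles T k H)
theorem1p1 = C , C>0 , λ k 2≤k n T tour sc →
  Cycles.packing⇒disjoint-cycles T (pack-tournament T tour (proj₁ sc) (Tournament.connected T sc) (numbers-for k 2≤k))
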